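{- Let $s\ge 1$ be an integer and let $0<\varepsilon\le 1/2$. There is an $\varepsilon$-relative-error testing algorithm for the class of $s$-term DNF formulas over $\{0,1\}^n$ whose query complexity (total number of calls to $\mathrm{MQ}(f)$ and $\mathrm{SAMP}(f)$) is $\mathrm{poly}(s,1/\varepsilon)$, independent of $n$.
   Context: An $s$-term DNF formula is a function $f:\{0,1\}^n\to\{0,1\}$ of the form $T_1\vee\cdots\vee T_{s'}$ with $s'\le s$, each $T_i$ a conjunction of literals. For $f,g:\{0,1\}^n\to\{0,1\}$, the relative distance is $\mathrm{reldist}(f,g)=|f^{ -1}(1)\,\triangle\, g^{ -1}(1)|/|f^{ -1}(1)|$, and for a class $\mathcal C$, $\mathrm{reldist}(f,\mathcal C)=\min_{g\in\mathcal C}\mathrm{reldist}(f,g)$. In the relative-error testing model, the algorithm has access to a membership oracle $\mathrm{MQ}(f)$ (returns $f(x)$ on query $x$) and a sampling oracle $\mathrm{SAMP}(f)$ (returns an independent uniformly random element of $f^{ -1}(1)$). An $\varepsilon$-relative-error tester for $\mathcal C$ must accept with probability at least $2/3$ if $f\in\mathcal C$, and reject with probability at least $2/3$ if $\mathrm{reldist}(f,\mathcal C)\ge\varepsilon$. -}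

module Defs where

open import Data.Bool using (Bool; true; false; if_then_else_; _∧_; _∨_)
open import Data.Nat as ℕ using (ℕ; zero; suc)
open import Data.Integer using (+_)
open import Data.Fin using (Fin)
open import Data.Vec using (Vec; []; _∷_; lookup)
open import Data.List using (List; []; _∷_; _++_; map; length; filter)
open import Data.Product using (Σ; _×_; _,_)
open import Data.Rational using (ℚ; 0ℚ; 1ℚ; ½; _+_; _*_; _-_; _/_; _≤_)
open import Relation.Binary.PropositionalEquality using (_≡_)
open import Relation.Nullary using (¬_)
open import Data.Bool.Properties using (T?)

Point : ℕ → Set
Point n = Vec Bool n

BoolFun : ℕ → Set
BoolFun n = Point n → Bool

allPoints : (n : ℕ) → List (Point n)
allPoints zero    = [] ∷ []
allPoints (suc n) = map (true ∷_) (allPoints n) ++ map (false ∷_) (allPoints n)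

ones : ∀ {n} → BoolFun n → List (Point n)
ones {n} f = filter (λ x → T? (f x)) (allPoints n)

count1 : ∀ {n} → BoolFun n → ℕ
count1 f = length (ones f)

xor : Bool → Bool → Bool
xor true  b = if b then false else true
xor false b = b

symDiff : ∀ {n} → BoolFun n → BoolFun n → ℕ
symDiff f g = count1 (λ x → xor (f x) (g x))

-- a literal: variable index and polarity (true = x_i, false = ¬x_i)
Literal : ℕ → Set
Literal n = Fin n × Bool

Term : ℕ → Set
Term n = List (Literal n)

DNF : ℕ → Set
DNF n = List (Term n)

evalLit : ∀ {n} → Literal n → Point n → Bool
evalLit (i , true)  x = lookup x i
evalLit (i , false) x = if lookup x i then false else true

evalTerm : ∀ {n} → Term n → Point n → Bool
evalTerm []      x = true
evalTerm (l ∷ t) x = evalLit l x ∧ evalTerm t x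

evalDNF : ∀ {n} → DNF n → Point n → Bool
evalDNF []      x = false
evalDNF (t ∷ d) x = evalTerm t x ∨ evalDNF d x

IsSTermDNF : ∀ {n} → ℕ → BoolFun n → Set
IsSTermDNF {n} s f = Σ (DNF n) λ d → (length d ℕ.≤ s) × (∀ x → f x ≡ evalDNF d x)

reldist : ∀ {n} (f g : BoolFun n) → .{{_ : ℕ.NonZero (count1 f)}} → ℚ
reldist f g = (+ symDiff f g) / count1 f

-- reldist(f, C_s) ≥ ε, where the minimum over the (finite) class is unfolded:
-- every s-term DNF g has reldist(f,g) ≥ ε
FarFromSTermDNF : ∀ {n} → ℕ → ℚ → (f : BoolFun n) → .{{_ : ℕ.NonZero (count1 f)}} → Set
FarFromSTermDNF {n} s ε f = ∀ (g : BoolFun n) → IsSTermDNF s g → ε ≤ reldist f g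

data Alg (n : ℕ) : Set where
  accept : Alg n
  reject : Alg n
  mq     : Point n → (Bool → Alg n) → Alg n
  samp   : (Point n → Alg n) → Alg n
  coin   : (Bool → Alg n) → Alg n

data QueriesAtMost {n : ℕ} : Alg n → ℕ → Set where
  acc≤  : ∀ {q} → QueriesAtMost accept q
  rej≤  : ∀ {q} → QueriesAtMost reject q
  mq≤   : ∀ {q x k} → (∀ b → QueriesAtMost (k b) q) → QueriesAtMost (mq x k) (suc q)
  samp≤ : ∀ {q k} → (∀ y → QueriesAtMost (k y) q) → QueriesAtMost (samp k) (suc q)
  coin≤ : ∀ {q k} → (∀ b → QueriesAtMost (k b) q) → QueriesAtMost (coin k) q

mutual
  accProb : ∀ {n} → BoolFun n → Alg n → ℚ
  accProb f accept   = 1ℚ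
  accProb f reject   = 0ℚ
  accProb f (mq x k) = accProb f (k (f x))
  accProb f (coin k) = ½ * (accProb f (k true) + accProb f (k false))
  accProb f (samp k) = avgOver f k (ones f)

  sumOver : ∀ {n} → BoolFun n → (Point n → Alg n) → List (Point n) → ℚ
  sumOver f k []       = 0ℚ
  sumOver f k (y ∷ ys) = accProb f (k y) + sumOver f k ys

  avgOver : ∀ {n} → BoolFun n → (Point n → Alg n) → List (Point n) → ℚ
  avgOver f k []       = 0ℚ
  avgOver f k (y ∷ ys) = ((+ 1) / suc (length ys)) * sumOver f k (y ∷ ys)

powℚ : ℚ → ℕ → ℚ
powℚ p zero    = 1ℚ
powℚ p (suc m) = p * powℚ p m

ℕtoℚ : ℕ → ℚ
ℕtoℚ m = (+ m) / 1

twoThirds : ℚ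
twoThirds = (+ 2) / 3

{-# OPTIONS --safe #-}
module Submission where

-- For points x, y, w and a mask R let z = x ⊕ (y ⊕ w) ⊓ R. If x and y are uniform in a subcube T, then z is
-- uniform in the smallest subcube containing T and w. Draw M seeds (x, y, R) with x, y positive samples. A
-- subset Θ of the seeds labels the points w with f w = 1 for which at most K₀ of the points z given by Θ
-- falsify f. A hypothesis is a list of at most s such subsets. A trial draws positive samples x, y, y′ and a
-- mask R; it is bad if x carries no label, or if x, y and y′ carry a label that z = x ⊕ (y ⊕ y′) ⊓ R does not.
-- The tester queries all the labels on N trials and accepts if some hypothesis has few bad trials.
--
-- Soundness. By a union bound over the 2^poly hypotheses, likely acceptance yields one whose trials are rarely
-- bad. Each large label class C is then almost closed under splicing. The number φ(u) of points of C that
-- translation by u moves out of C is subadditive, and the average over R of φ(d ⊓ R), d = y ⊕ y′, bounds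
-- φ(d ⊓ S) for every S, as d ⊓ S = d ⊓ R ⊕ d ⊓ (R ⊕ S). So 4 φ(u) ≤ |C| already forces φ(u ⊓ S) to be tiny
-- for all S, and the set of such u is a coordinate subspace, one coset of which nearly equals C. These s cosets
-- form a DNF close to f.
--
-- Completeness. Each term that covers a non-negligible part of f extends to a cube T that is almost contained
-- in f, while every cube twice as large misses f a constant factor more often. Taking for Θ the seeds
-- with x, y ∈ T, the points in T and outside T are separated by a Chernoff bound, so the label class is T.

open import Defs

-- The query bound may not mention `n`, so the tester can never find out which coordinates a term
-- fixes. A cube is known to it only through the membership test that suitable seeds induce, and
-- since it cannot tell which seeds are suitable, it tries all subsets; a surplus of trials pays for
-- this search, not extra queries per hypothesis.
--
-- One threshold `K₀` serves cubes of all sizes because a subset may also thin the seeds. If a seed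
-- fails on points of the cube with probability at most `1/(6m)` and on other points with
-- probability at least `10/m`, then `m * K₀` seeds put the expected number of failures below `K₀/6`
-- or above `10 * K₀`.
--
-- A term itself need not be a label class: a point just outside it may lie in other terms, and then
-- its splices stay in `f`. Growing the term until every further doubling visibly hurts creates the
-- gap. Soundness, in contrast, knows nothing of terms; it treats arbitrary label classes inside
-- `f`, for every fixed choice of seeds.
--
-- Probabilities are integer counts over finite sample spaces and inequalities are cross-multiplied;
-- rationals occur only at the interface with `accProb` and `ε`.

module Counting where
  open import Data.Bool using (Bool; true; false; if_then_else_; _∧_; _∨_; not) renaming (_xor_ to _⊻_; T to IsTrue)
  open import Data.Bool.Properties using (T?; ∧-assoc; ∧-comm; ∧-identityʳ; ∨-zeroʳ)
  open import Data.Nat hiding (_⊓_)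
  open import Data.Nat.Properties
  open import Data.Nat.DivMod using (m≡m%n+[m/n]*n; m%n<n)
  open import Data.Nat.Tactic.RingSolver using (solve-∀)
  import Data.Integer as ℤ
  import Data.Integer.Properties as ℤₚ
  import Data.Rational as ℚ
  import Data.Rational.Properties as ℚₚ
  import Data.Rational.Unnormalised as ℚᵘ
  import Data.Rational.Unnormalised.Properties as ℚᵘₚ
  open import Data.Empty using (⊥; ⊥-elim)
  open import Data.Fin using (Fin; zero; suc)
  open import Data.List using (List; []; _∷_; _++_; map; length; filter)
  open import Data.List.Membership.Propositional using (_∈_)
  open import Data.List.Membership.Propositional.Properties using (∈-++⁺ˡ; ∈-++⁺ʳ; ∈-map⁺)
  open import Data.List.Properties using (length-map)
  open import Data.List.Relation.Unary.Any using (here; there)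
  open import Data.Maybe using (Maybe; just; nothing)
  open import Data.Product using (Σ; _×_; _,_; proj₁; proj₂; ∃)
  open import Data.Sum using (_⊎_; inj₁; inj₂)
  open import Data.Vec as Vec using (Vec; []; _∷_; lookup; zipWith; replicate; _[_]≔_)
  open import Relation.Nullary using (¬_; yes; no)
  open import Relation.Binary.PropositionalEquality

  -- Finite sums and tail bounds

  ⟦_⟧ : Bool → ℕ
  ⟦ true ⟧  = 1
  ⟦ false ⟧ = 0

  ⟦⟧≤1 : ∀ b → ⟦ b ⟧ ≤ 1
  ⟦⟧≤1 true  = ≤-refl
  ⟦⟧≤1 false = z≤n

  ⟦∧⟧ : ∀ b c → ⟦ b ∧ c ⟧ ≡ ⟦ b ⟧ * ⟦ c ⟧
  ⟦∧⟧ true  c = sym (+-identityʳ ⟦ c ⟧)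
  ⟦∧⟧ false c = refl

  ⟦not⟧ : ∀ b → ⟦ b ⟧ + ⟦ not b ⟧ ≡ 1
  ⟦not⟧ true  = refl
  ⟦not⟧ false = refl

  ⟦⟧*⟦not⟧ : ∀ b → ⟦ b ⟧ * ⟦ not b ⟧ ≡ 0
  ⟦⟧*⟦not⟧ true  = refl
  ⟦⟧*⟦not⟧ false = refl

  ⟦⟧-mono : ∀ p q → (p ≡ true → q ≡ true) → ⟦ p ⟧ ≤ ⟦ q ⟧
  ⟦⟧-mono false q i = z≤n
  ⟦⟧-mono true  q i = ≤-reflexive (cong ⟦_⟧ (sym (i refl)))

  ∨-⟦⟧ˡ : ∀ a b → ⟦ a ⟧ ≤ ⟦ a ∨ b ⟧
  ∨-⟦⟧ˡ true  b = ≤-refl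
  ∨-⟦⟧ˡ false b = z≤n

  ∨-⟦⟧ʳ : ∀ a b → ⟦ b ⟧ ≤ ⟦ a ∨ b ⟧
  ∨-⟦⟧ʳ true  b = ⟦⟧≤1 b
  ∨-⟦⟧ʳ false b = ≤-refl

  ∨-⟦⟧-+ : ∀ a b → ⟦ a ∨ b ⟧ ≤ ⟦ a ⟧ + ⟦ b ⟧
  ∨-⟦⟧-+ true  b = s≤s z≤n
  ∨-⟦⟧-+ false b = ≤-refl

  ∨-∖ : ∀ p q m → ⟦ p ∨ q ⟧ * ⟦ not m ⟧ ≤ ⟦ p ⟧ + ⟦ q ⟧ * ⟦ not m ⟧
  ∨-∖ true  q m = ≤-trans (≤-reflexive (*-identityˡ ⟦ not m ⟧)) (≤-trans (⟦⟧≤1 (not m)) (s≤s z≤n))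
  ∨-∖ false q m = ≤-refl

  ∨-∖-∨ : ∀ p q t m → ⟦ p ∨ q ⟧ * ⟦ not (t ∨ m) ⟧ ≤ ⟦ p ⟧ * ⟦ not t ⟧ + ⟦ q ⟧ * ⟦ not m ⟧
  ∨-∖-∨ p     q true  m = ≤-trans (≤-reflexive (*-zeroʳ ⟦ p ∨ q ⟧)) z≤n
  ∨-∖-∨ true  q false m = ≤-trans (≤-reflexive (*-identityˡ ⟦ not m ⟧)) (≤-trans (⟦⟧≤1 (not m)) (s≤s z≤n))
  ∨-∖-∨ false q false m = ≤-refl

  not-false : ∀ {b} → not b ≡ false → b ≡ true
  not-false {true} _ = refl

  not-true : ∀ {b} → not b ≡ true → b ≡ false
  not-true {false} _ = refl

  false≢true : false ≡ true → ⊥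
  false≢true ()

  private variable
    X Y : Set

  ∑ : List X → (X → ℕ) → ℕ
  ∑ []       φ = 0
  ∑ (x ∷ xs) φ = φ x + ∑ xs φ

  ∑-cong : (L : List X) {φ ψ : X → ℕ} → (∀ x → φ x ≡ ψ x) → ∑ L φ ≡ ∑ L ψ
  ∑-cong []      e = refl
  ∑-cong (x ∷ L) e = cong₂ _+_ (e x) (∑-cong L e)

  ∑-mono : (L : List X) {φ ψ : X → ℕ} → (∀ x → φ x ≤ ψ x) → ∑ L φ ≤ ∑ L ψ
  ∑-mono []      e = z≤n
  ∑-mono (x ∷ L) e = +-mono-≤ (e x) (∑-mono L e)

  ∑-+ : (L : List X) (φ ψ : X → ℕ) → ∑ L (λ x → φ x + ψ x) ≡ ∑ L φ + ∑ L ψ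
  ∑-+ []      φ ψ = refl
  ∑-+ (x ∷ L) φ ψ = trans (cong (φ x + ψ x +_) (∑-+ L φ ψ)) (lem (φ x) (ψ x) _ _)
    where
    lem : ∀ a b c d → a + b + (c + d) ≡ a + c + (b + d)
    lem = solve-∀

  ∑-*ˡ : (L : List X) (c : ℕ) (φ : X → ℕ) → ∑ L (λ x → c * φ x) ≡ c * ∑ L φ
  ∑-*ˡ []      c φ = sym (*-zeroʳ c)
  ∑-*ˡ (x ∷ L) c φ = trans (cong (c * φ x +_) (∑-*ˡ L c φ)) (sym (*-distribˡ-+ c (φ x) (∑ L φ)))

  ∑-*ʳ : (L : List X) (c : ℕ) (φ : X → ℕ) → ∑ L (λ x → φ x * c) ≡ ∑ L φ * c
  ∑-*ʳ L c φ = trans (∑-cong L (λ x → *-comm (φ x) c)) (trans (∑-*ˡ L c φ) (*-comm c (∑ L φ)))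

  ∑-const : (L : List X) (c : ℕ) → ∑ L (λ _ → c) ≡ length L * c
  ∑-const []      c = refl
  ∑-const (x ∷ L) c = cong (c +_) (∑-const L c)

  ∑-swap : (L : List X) (K : List Y) (φ : X → Y → ℕ) →
           ∑ L (λ x → ∑ K (φ x)) ≡ ∑ K (λ y → ∑ L (λ x → φ x y))
  ∑-swap []      K φ = sym (trans (∑-const K 0) (*-zeroʳ (length K)))
  ∑-swap (x ∷ L) K φ = trans (cong (∑ K (φ x) +_) (∑-swap L K φ)) (sym (∑-+ K (φ x) _))

  ∑-++ : (L K : List X) (φ : X → ℕ) → ∑ (L ++ K) φ ≡ ∑ L φ + ∑ K φ
  ∑-++ []      K φ = refl
  ∑-++ (x ∷ L) K φ = trans (cong (φ x +_) (∑-++ L K φ)) (sym (+-assoc (φ x) _ _))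

  ∑-map : (g : X → Y) (L : List X) (φ : Y → ℕ) → ∑ (map g L) φ ≡ ∑ L (λ x → φ (g x))
  ∑-map g []      φ = refl
  ∑-map g (x ∷ L) φ = cong (φ (g x) +_) (∑-map g L φ)

  ∑-filter : (p : X → Bool) (L : List X) (φ : X → ℕ) →
             ∑ (filter (λ x → T? (p x)) L) φ ≡ ∑ L (λ x → ⟦ p x ⟧ * φ x)
  ∑-filter p []      φ = refl
  ∑-filter p (x ∷ L) φ with p x
  ... | true  = cong₂ _+_ (sym (+-identityʳ (φ x))) (∑-filter p L φ)
  ... | false = ∑-filter p L φ

  ∑-witness : (L : List X) (φ ψ : X → ℕ) → ∑ L φ < ∑ L ψ → ∃ λ x → φ x < ψ x
  ∑-witness (x ∷ L) φ ψ lt with φ x <? ψ x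
  ... | yes p = x , p
  ... | no ¬p with ∑ L φ <? ∑ L ψ
  ...   | yes q = ∑-witness L φ ψ q
  ...   | no ¬q = ⊥-elim (<⇒≱ lt (+-mono-≤ (≮⇒≥ ¬p) (≮⇒≥ ¬q)))

  infixr 5 _⊗_
  _⊗_ : List X → List Y → List (X × Y)
  []      ⊗ K = []
  (x ∷ L) ⊗ K = map (x ,_) K ++ L ⊗ K

  ∑-⊗ : (L : List X) (K : List Y) (φ : X × Y → ℕ) →
        ∑ (L ⊗ K) φ ≡ ∑ L (λ x → ∑ K (λ y → φ (x , y)))
  ∑-⊗ []      K φ = refl
  ∑-⊗ (x ∷ L) K φ = trans (∑-++ (map (x ,_) K) (L ⊗ K) φ) (cong₂ _+_ (∑-map (x ,_) K φ) (∑-⊗ L K φ))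

  length-∑ : (L : List X) → length L ≡ ∑ L (λ _ → 1)
  length-∑ L = sym (trans (∑-const L 1) (*-identityʳ (length L)))

  length-⊗ : (L : List X) (K : List Y) → length (L ⊗ K) ≡ length L * length K
  length-⊗ L K = begin
    length (L ⊗ K) ≡⟨ length-∑ (L ⊗ K) ⟩
    ∑ (L ⊗ K) (λ _ → 1) ≡⟨ ∑-⊗ L K _ ⟩
    ∑ L (λ _ → ∑ K (λ _ → 1)) ≡⟨ ∑-const L _ ⟩
    length L * ∑ K (λ _ → 1) ≡⟨ cong (length L *_) (sym (length-∑ K)) ⟩
    length L * length K ∎
    where open ≡-Reasoning

  vecs : List X → (k : ℕ) → List (Vec X k)
  vecs L zero    = [] ∷ []
  vecs L (suc k) = map (λ p → proj₁ p ∷ proj₂ p) (L ⊗ vecs L k)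

  ∑-vecs : (L : List X) (k : ℕ) (φ : Vec X (suc k) → ℕ) →
           ∑ (vecs L (suc k)) φ ≡ ∑ L (λ x → ∑ (vecs L k) (λ v → φ (x ∷ v)))
  ∑-vecs L k φ = trans (∑-map _ (L ⊗ vecs L k) φ) (∑-⊗ L (vecs L k) _)

  length-vecs : (L : List X) (k : ℕ) → length (vecs L k) ≡ length L ^ k
  length-vecs L zero    = refl
  length-vecs L (suc k) = begin
    length (vecs L (suc k)) ≡⟨ length-∑ (vecs L (suc k)) ⟩
    ∑ (vecs L (suc k)) (λ _ → 1) ≡⟨ ∑-vecs L k _ ⟩
    ∑ L (λ _ → ∑ (vecs L k) (λ _ → 1)) ≡⟨ ∑-const L _ ⟩
    length L * ∑ (vecs L k) (λ _ → 1) ≡⟨ cong (length L *_) (sym (length-∑ (vecs L k))) ⟩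
    length L * length (vecs L k) ≡⟨ cong (length L *_) (length-vecs L k) ⟩
    length L * length L ^ k ∎
    where open ≡-Reasoning

  -- Chernoff bounds from exponential moments

  hits : ∀ {k} → (X → Bool) → Vec Bool k → Vec X k → ℕ
  hits ξ []       []       = 0
  hits ξ (b ∷ bs) (x ∷ xs) = ⟦ b ∧ ξ x ⟧ + hits ξ bs xs

  trues : ∀ {k} → Vec Bool k → ℕ
  trues []       = 0
  trues (b ∷ bs) = ⟦ b ⟧ + trues bs

  trues-≤ : ∀ {k} (v : Vec Bool k) → trues v ≤ k
  trues-≤ []       = z≤n
  trues-≤ (b ∷ bs) = +-mono-≤ (⟦⟧≤1 b) (trues-≤ bs)

  mask : (k c : ℕ) → c ≤ k → Σ (Vec Bool k) λ v → trues v ≡ c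
  mask zero    zero    z≤n     = [] , refl
  mask (suc k) zero    z≤n with mask k zero z≤n
  ... | v , e = false ∷ v , e
  mask (suc k) (suc c) (s≤s l) with mask k c l
  ... | v , e = true ∷ v , cong suc e

  weight : ℕ → ℕ → Bool → ℕ
  weight α β true  = α
  weight α β false = β

  weights : ∀ {k} → ℕ → ℕ → (X → Bool) → Vec Bool k → Vec X k → ℕ
  weights α β ξ []       []       = 1
  weights α β ξ (b ∷ bs) (x ∷ xs) = weight α β (b ∧ ξ x) * weights α β ξ bs xs

  -- The exponential moment of a sum of independent indicators factorises; the factor v ^ trues bs
  -- is moved to the left so that no truncated exponent M ∸ trues bs is needed.
  ∑-weights : ∀ {k} (L : List X) (α β : ℕ) (ξ : X → Bool) (bs : Vec Bool k) →
              ∑ (vecs L k) (weights α β ξ bs) * (length L * β) ^ trues bs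
              ≡ (∑ L λ x → weight α β (ξ x)) ^ trues bs * (length L * β) ^ k
  ∑-weights L α β ξ []       = refl
  ∑-weights {k = suc k} L α β ξ (b ∷ bs) = begin
    ∑ (vecs L (suc k)) (weights α β ξ (b ∷ bs)) * v ^ trues (b ∷ bs)
      ≡⟨ cong (_* v ^ trues (b ∷ bs)) (trans (∑-vecs L k _) (trans (∑-cong L (λ x → ∑-*ˡ (vecs L k) (weight α β (b ∧ ξ x)) _)) (∑-*ʳ L _ _))) ⟩
    (∑ L λ x → weight α β (b ∧ ξ x)) * S * v ^ (⟦ b ⟧ + trues bs)
      ≡⟨ step b ⟩
    u ^ (⟦ b ⟧ + trues bs) * v ^ suc k ∎
    where
    open ≡-Reasoning
    v = length L * β
    u = ∑ L λ x → weight α β (ξ x)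
    S = ∑ (vecs L k) (weights α β ξ bs)
    IH = ∑-weights L α β ξ bs
    r1 : ∀ a b c d → a * b * (c * d) ≡ a * c * (b * d)
    r1 = solve-∀
    r2 : ∀ a b c → a * (b * c) ≡ b * (a * c)
    r2 = solve-∀
    step : ∀ b → (∑ L λ x → weight α β (b ∧ ξ x)) * S * v ^ (⟦ b ⟧ + trues bs) ≡ u ^ (⟦ b ⟧ + trues bs) * v ^ suc k
    step true  = trans (r1 u S v (v ^ trues bs)) (trans (cong (u * v *_) IH) (r1 u v (u ^ trues bs) (v ^ k)))
    step false = trans (cong (λ z → z * S * v ^ trues bs) (∑-const L β))
                 (trans (*-assoc v S _) (trans (cong (v *_) IH) (r2 v (u ^ trues bs) (v ^ k))))

  -- The weights 1 and 4 represent `4 ^ (- hits)`, scaled by 4 in every position so that a moment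
  -- generating function at a negative argument stays integral.
  weights-lower : ∀ {k} (ξ : X → Bool) (bs : Vec Bool k) (xs : Vec X k) →
                  weights 1 4 ξ bs xs * 4 ^ hits ξ bs xs ≡ 4 ^ k
  weights-lower ξ []       []       = refl
  weights-lower {k = suc k} ξ (b ∷ bs) (x ∷ xs) with b ∧ ξ x
  ... | true  = trans (lem (weights 1 4 ξ bs xs) (4 ^ hits ξ bs xs)) (cong (4 *_) (weights-lower ξ bs xs))
    where
    lem : ∀ a b → (a + 0) * (4 * b) ≡ 4 * (a * b)
    lem = solve-∀
  ... | false = trans (*-assoc 4 (weights 1 4 ξ bs xs) _) (cong (4 *_) (weights-lower ξ bs xs))

  weights-upper : ∀ {k} (ξ : X → Bool) (bs : Vec Bool k) (xs : Vec X k) →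
                  weights 4 1 ξ bs xs ≡ 4 ^ hits ξ bs xs
  weights-upper ξ []       []       = refl
  weights-upper ξ (b ∷ bs) (x ∷ xs) with b ∧ ξ x
  ... | true  = cong (4 *_) (weights-upper ξ bs xs)
  ... | false = trans (+-identityʳ _) (weights-upper ξ bs xs)

  -- Bernoulli's inequality `(1 + e/u)^m ≥ 1 + m e/u` with denominators cleared; the extra factor
  -- `u` on both sides avoids the exponent `m - 1`.
  bernoulli : ∀ u e m → u ^ m * u + m * e * u ^ m ≤ (u + e) ^ m * u
  bernoulli u e zero    = ≤-reflexive (lem u)
    where
    lem : ∀ u → 1 * u + 0 * 1 ≡ 1 * u
    lem = solve-∀
  bernoulli u e (suc m) = begin
    u * p * u + suc m * e * (u * p) ≤⟨ m≤m+n _ (m * e * p * e) ⟩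
    u * p * u + suc m * e * (u * p) + m * e * p * e ≡⟨ lem u e p m ⟩
    (u + e) * (p * u + m * e * p) ≤⟨ *-monoʳ-≤ (u + e) (bernoulli u e m) ⟩
    (u + e) * ((u + e) ^ m * u) ≡⟨ sym (*-assoc (u + e) ((u + e) ^ m) u) ⟩
    (u + e) * (u + e) ^ m * u ∎
    where
    open ≤-Reasoning
    p = u ^ m
    lem : ∀ u e p m → u * p * u + (1 + m) * e * (u * p) + m * e * p * e ≡ (u + e) * (p * u + m * e * p)
    lem = solve-∀

  -- With `x = e/w` this is `(1 + x)^m ≤ 1 + 2mx`. In the induction the quadratic term `2mx * x` is
  -- at most `x`, which is what the factor 2 pays for.
  upper-power : ∀ w e m → 2 * (m * e) ≤ w → (w + e) ^ m * w ≤ w ^ m * (w + 2 * (m * e))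
  upper-power w e zero    h = ≤-reflexive (lem w)
    where
    lem : ∀ w → 1 * w ≡ 1 * (w + 0)
    lem = solve-∀
  upper-power w e (suc m) h = begin
    (w + e) * (w + e) ^ m * w ≡⟨ *-assoc (w + e) _ w ⟩
    (w + e) * ((w + e) ^ m * w) ≤⟨ *-monoʳ-≤ (w + e) (upper-power w e m h′) ⟩
    (w + e) * (p * (w + 2 * (m * e))) ≡⟨ lem w e p m ⟩
    p * (w * w + w * e + 2 * (m * e) * w) + p * e * (2 * (m * e))
                                          ≤⟨ +-monoʳ-≤ _ (*-monoʳ-≤ (p * e) h′) ⟩
    p * (w * w + w * e + 2 * (m * e) * w) + p * e * w ≡⟨ lem2 w e p m ⟩
    w * p * (w + 2 * (suc m * e)) ∎
    where
    open ≤-Reasoning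
    p = w ^ m
    h′ : 2 * (m * e) ≤ w
    h′ = ≤-trans (*-monoʳ-≤ 2 (m≤n+m (m * e) e)) h
    lem : ∀ w e p m → (w + e) * (p * (w + 2 * (m * e))) ≡ p * (w * w + w * e + 2 * (m * e) * w) + p * e * (2 * (m * e))
    lem = solve-∀
    lem2 : ∀ w e p m → p * (w * w + w * e + 2 * (m * e) * w) + p * e * w ≡ w * p * (w + 2 * ((1 + m) * e))
    lem2 = solve-∀

  ^-distribʳ-* : ∀ k a b → (a * b) ^ k ≡ a ^ k * b ^ k
  ^-distribʳ-* zero    a b = refl
  ^-distribʳ-* (suc k) a b = trans (cong (a * b *_) (^-distribʳ-* k a b)) (r a b (a ^ k) (b ^ k))
    where
    r : ∀ a b c d → a * b * (c * d) ≡ a * c * (b * d)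
    r = solve-∀

  pos-cancel : ∀ {a b c} → 0 < c → a * c ≤ b * c → a ≤ b
  pos-cancel {a} {b} {suc c} _ h = *-cancelʳ-≤ a b (suc c) h

  -- At least `10 * k` hits are expected in the `m * k` active positions. A block of `m` of them
  -- divides the moment of `4 ^ (- hits)` by at least 8 (`step`), while Markov's inequality for at
  -- most `k` hits gives back `4 ^ k`; each of the `k` blocks thus gains a factor 2.
  lower-tail : ∀ {M} (L : List X) (ξ : X → Bool) (bs : Vec Bool M) (m k : ℕ) → 0 < length L →
               trues bs ≡ m * k → 10 * length L ≤ m * ∑ L (λ x → ⟦ ξ x ⟧) →
               ∑ (vecs L M) (λ v → ⟦ hits ξ bs v ≤ᵇ k ⟧) * 2 ^ k ≤ length L ^ M
  lower-tail {M = M} L ξ bs m k W>0 tr big = pos-cancel (m^n>0 4 M) (pos-cancel (m^n>0 v ⦃ >-nonZero v>0 ⦄ (m * k)) chain)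
    where
    open ≤-Reasoning
    W = length L
    p = ∑ L (λ x → ⟦ ξ x ⟧)
    v = W * 4
    v>0 : 0 < v
    v>0 = *-mono-≤ W>0 (s≤s {n = 3} z≤n)
    u = ∑ L (λ x → weight 1 4 (ξ x))
    uv : u + 3 * p ≡ v
    uv = trans (cong (u +_) (sym (∑-*ˡ L 3 _))) (trans (sym (∑-+ L _ _)) (trans (∑-cong L (λ x → h (ξ x))) (∑-const L 4)))
      where
      h : ∀ b → weight 1 4 b + 3 * ⟦ b ⟧ ≡ 4
      h true  = refl
      h false = refl
    N = ∑ (vecs L M) (λ v → ⟦ hits ξ bs v ≤ᵇ k ⟧)
    S = ∑ (vecs L M) (weights 1 4 ξ bs)
    pointwise : ∀ x → ⟦ hits ξ bs x ≤ᵇ k ⟧ * 4 ^ M ≤ weights 1 4 ξ bs x * 4 ^ k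
    pointwise x with hits ξ bs x ≤ᵇ k in eq
    ... | false = z≤n
    ... | true  = begin
      1 * 4 ^ M ≡⟨ *-identityˡ (4 ^ M) ⟩
      4 ^ M ≡⟨ sym (weights-lower ξ bs x) ⟩
      weights 1 4 ξ bs x * 4 ^ hits ξ bs x ≤⟨ *-monoʳ-≤ (weights 1 4 ξ bs x) (^-monoʳ-≤ 4 (≤ᵇ⇒≤ (hits ξ bs x) k (subst IsTrue (sym eq) _))) ⟩
      weights 1 4 ξ bs x * 4 ^ k ∎
    step : 8 * u ^ m ≤ v ^ m
    step with u in equ
    ... | zero  = zero-case m big
      where
      zero-case : ∀ m → 10 * W ≤ m * p → 8 * 0 ^ m ≤ v ^ m
      zero-case zero    h = ⊥-elim (<⇒≱ (*-mono-≤ (s≤s (z≤n {9})) W>0) h)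
      zero-case (suc m) h = z≤n
    ... | suc u′ = *-cancelʳ-≤ _ _ (suc u′) (begin
      8 * suc u′ ^ m * suc u′ ≡⟨ l1 (suc u′ ^ m) (suc u′) ⟩
      suc u′ ^ m * suc u′ + 7 * suc u′ * suc u′ ^ m ≤⟨ +-monoʳ-≤ _ (*-monoˡ-≤ (suc u′ ^ m) h7) ⟩
      suc u′ ^ m * suc u′ + m * (3 * p) * suc u′ ^ m ≤⟨ bernoulli (suc u′) (3 * p) m ⟩
      (suc u′ + 3 * p) ^ m * suc u′ ≡⟨ cong (λ z → z ^ m * suc u′) (trans (cong (_+ 3 * p) (sym equ)) uv) ⟩
      v ^ m * suc u′ ∎)
      where
      l1 : ∀ a b → 8 * a * b ≡ a * b + 7 * b * a
      l1 = solve-∀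
      l2 : ∀ w → 7 * (w * 4) ≡ 28 * w
      l2 = solve-∀
      l3 : ∀ w → 3 * (10 * w) ≡ 28 * w + 2 * w
      l3 = solve-∀
      l4 : ∀ m p → 3 * (m * p) ≡ m * (3 * p)
      l4 = solve-∀
      -- Ten expected hits per block give `m * (3 * p) ≥ 30 * W`, more than `7 * v = 28 * W`;
      -- Bernoulli's `1 + 7` is the 8 of `step`.
      h7 : 7 * suc u′ ≤ m * (3 * p)
      h7 = begin
        7 * suc u′ ≤⟨ *-monoʳ-≤ 7 (≤-trans (≤-reflexive (sym equ)) (≤-trans (m≤m+n u (3 * p)) (≤-reflexive uv))) ⟩
        7 * v ≡⟨ l2 W ⟩
        28 * W ≤⟨ m≤m+n _ (2 * W) ⟩
        28 * W + 2 * W ≡⟨ sym (l3 W) ⟩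
        3 * (10 * W) ≤⟨ *-monoʳ-≤ 3 big ⟩
        3 * (m * p) ≡⟨ l4 m p ⟩
        m * (3 * p) ∎
    stepk : 8 ^ k * u ^ (m * k) ≤ v ^ (m * k)
    stepk = begin
      8 ^ k * u ^ (m * k) ≡⟨ cong (8 ^ k *_) (sym (^-*-assoc u m k)) ⟩
      8 ^ k * (u ^ m) ^ k ≡⟨ sym (^-distribʳ-* k 8 (u ^ m)) ⟩
      (8 * u ^ m) ^ k ≤⟨ ^-monoˡ-≤ k step ⟩
      (v ^ m) ^ k ≡⟨ ^-*-assoc v m k ⟩
      v ^ (m * k) ∎
    r1 : ∀ a b c d → a * b * c * d ≡ a * c * (b * d)
    r1 = solve-∀
    r2 : ∀ s f t g → s * f * (t * g) ≡ f * t * (s * g)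
    r2 = solve-∀
    chain : N * 2 ^ k * 4 ^ M * v ^ (m * k) ≤ W ^ M * 4 ^ M * v ^ (m * k)
    chain = begin
      N * 2 ^ k * 4 ^ M * v ^ (m * k) ≡⟨ r1 N (2 ^ k) (4 ^ M) (v ^ (m * k)) ⟩
      N * 4 ^ M * (2 ^ k * v ^ (m * k)) ≤⟨ *-monoˡ-≤ _ (≤-trans (≤-reflexive (sym (∑-*ʳ (vecs L M) (4 ^ M) _))) (≤-trans (∑-mono (vecs L M) pointwise) (≤-reflexive (∑-*ʳ (vecs L M) (4 ^ k) _)))) ⟩
      S * 4 ^ k * (2 ^ k * v ^ (m * k)) ≡⟨ r2 S (4 ^ k) (2 ^ k) _ ⟩
      4 ^ k * 2 ^ k * (S * v ^ (m * k)) ≡⟨ cong₂ _*_ (sym (^-distribʳ-* k 4 2)) (trans (cong (λ z → S * v ^ z) (sym tr)) (trans (∑-weights L 1 4 ξ bs) (cong (λ z → u ^ z * v ^ M) tr))) ⟩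
      8 ^ k * (u ^ (m * k) * v ^ M) ≡⟨ sym (*-assoc (8 ^ k) _ _) ⟩
      8 ^ k * u ^ (m * k) * v ^ M ≤⟨ *-monoˡ-≤ (v ^ M) stepk ⟩
      v ^ (m * k) * v ^ M ≡⟨ cong (v ^ (m * k) *_) (^-distribʳ-* M W 4) ⟩
      v ^ (m * k) * (W ^ M * 4 ^ M) ≡⟨ *-comm (v ^ (m * k)) _ ⟩
      W ^ M * 4 ^ M * v ^ (m * k) ∎

  -- At most `k / 6` hits are expected. A block of `m` positions multiplies the moment of `4 ^ hits`
  -- by at most 2, and more than `k` hits make the weight at least `4 ^ k`, so `2 ^ k / 4 ^ k`
  -- remains.
  upper-tail : ∀ {M} (L : List X) (ξ : X → Bool) (bs : Vec Bool M) (m k : ℕ) → 0 < length L →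
               trues bs ≡ m * k → 6 * (m * ∑ L (λ x → ⟦ ξ x ⟧)) ≤ length L →
               ∑ (vecs L M) (λ v → ⟦ not (hits ξ bs v ≤ᵇ k) ⟧) * 2 ^ k ≤ length L ^ M
  upper-tail {M = M} L ξ bs m k W>0 tr small = pos-cancel (m^n>0 2 k) (pos-cancel (m^n>0 v ⦃ >-nonZero v>0 ⦄ (m * k)) chain)
    where
    open ≤-Reasoning
    W = length L
    p = ∑ L (λ x → ⟦ ξ x ⟧)
    v = W * 1
    v≡W : v ≡ W
    v≡W = *-identityʳ W
    v>0 : 0 < v
    v>0 = subst (0 <_) (sym v≡W) W>0
    u = ∑ L (λ x → weight 4 1 (ξ x))
    uv : u ≡ W + 3 * p
    uv = trans (∑-cong L (λ x → h (ξ x))) (trans (∑-+ L _ _) (cong₂ _+_ (sym (length-∑ L)) (∑-*ˡ L 3 _)))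
      where
      h : ∀ b → weight 4 1 b ≡ 1 + 3 * ⟦ b ⟧
      h true  = refl
      h false = refl
    N = ∑ (vecs L M) (λ v → ⟦ not (hits ξ bs v ≤ᵇ k) ⟧)
    S = ∑ (vecs L M) (weights 4 1 ξ bs)
    pointwise : ∀ x → ⟦ not (hits ξ bs x ≤ᵇ k) ⟧ * 4 ^ k ≤ weights 4 1 ξ bs x
    pointwise x with hits ξ bs x ≤ᵇ k in eq
    ... | true  = z≤n
    ... | false = begin
      1 * 4 ^ k ≡⟨ *-identityˡ (4 ^ k) ⟩
      4 ^ k ≤⟨ ^-monoʳ-≤ 4 {k} {hits ξ bs x} (<⇒≤ (≰⇒> (λ le → subst IsTrue eq (≤⇒≤ᵇ {hits ξ bs x} {k} le)))) ⟩
      4 ^ hits ξ bs x ≡⟨ sym (weights-upper ξ bs x) ⟩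
      weights 4 1 ξ bs x ∎
    step : u ^ m ≤ 2 * W ^ m
    step = pos-cancel W>0 (begin
      u ^ m * W ≡⟨ cong (λ z → z ^ m * W) uv ⟩
      (W + 3 * p) ^ m * W ≤⟨ upper-power W (3 * p) m h ⟩
      W ^ m * (W + 2 * (m * (3 * p))) ≤⟨ *-monoʳ-≤ (W ^ m) (+-monoʳ-≤ W h) ⟩
      W ^ m * (W + W) ≡⟨ l1 (W ^ m) W ⟩
      2 * W ^ m * W ∎)
      where
      l1 : ∀ a b → a * (b + b) ≡ 2 * a * b
      l1 = solve-∀
      l2 : ∀ m p → 2 * (m * (3 * p)) ≡ 6 * (m * p)
      l2 = solve-∀
      h : 2 * (m * (3 * p)) ≤ W
      h = ≤-trans (≤-reflexive (l2 m p)) small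
    stepk : u ^ (m * k) ≤ 2 ^ k * W ^ (m * k)
    stepk = begin
      u ^ (m * k) ≡⟨ sym (^-*-assoc u m k) ⟩
      (u ^ m) ^ k ≤⟨ ^-monoˡ-≤ k step ⟩
      (2 * W ^ m) ^ k ≡⟨ ^-distribʳ-* k 2 (W ^ m) ⟩
      2 ^ k * (W ^ m) ^ k ≡⟨ cong (2 ^ k *_) (^-*-assoc W m k) ⟩
      2 ^ k * W ^ (m * k) ∎
    r3 : ∀ a b c → a * b * c ≡ c * a * b
    r3 = solve-∀
    chain : N * 2 ^ k * 2 ^ k * v ^ (m * k) ≤ W ^ M * 2 ^ k * v ^ (m * k)
    chain = begin
      N * 2 ^ k * 2 ^ k * v ^ (m * k) ≡⟨ cong (_* v ^ (m * k)) (trans (*-assoc N _ _) (cong (N *_) (sym (^-distribʳ-* k 2 2)))) ⟩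
      N * 4 ^ k * v ^ (m * k) ≤⟨ *-monoˡ-≤ _ (≤-trans (≤-reflexive (sym (∑-*ʳ (vecs L M) (4 ^ k) _))) (∑-mono (vecs L M) pointwise)) ⟩
      S * v ^ (m * k) ≡⟨ trans (cong (λ z → S * v ^ z) (sym tr)) (trans (∑-weights L 4 1 ξ bs) (cong (λ z → u ^ z * v ^ M) tr)) ⟩
      u ^ (m * k) * v ^ M ≤⟨ *-monoˡ-≤ (v ^ M) stepk ⟩
      2 ^ k * W ^ (m * k) * v ^ M ≡⟨ cong₂ (λ y z → 2 ^ k * y ^ (m * k) * z ^ M) (sym v≡W) v≡W ⟩
      2 ^ k * v ^ (m * k) * W ^ M ≡⟨ r3 (2 ^ k) (v ^ (m * k)) (W ^ M) ⟩
      W ^ M * 2 ^ k * v ^ (m * k) ∎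

  -- Points and subcubes

  infixl 6 _⊕_
  infixl 7 _⊓_

  _⊕_ _⊓_ : ∀ {n} → Point n → Point n → Point n
  _⊕_ = zipWith _⊻_
  _⊓_ = zipWith _∧_

  𝟎 𝟏 : ∀ {n} → Point n
  𝟎 = replicate _ false
  𝟏 = replicate _ true

  ⊕-cancel : ∀ {n} (u v : Point n) → u ⊕ v ⊕ v ≡ u
  ⊕-cancel []      []      = refl
  ⊕-cancel (a ∷ u) (b ∷ v) = cong₂ _∷_ (h a b) (⊕-cancel u v)
    where
    h : ∀ a b → (a ⊻ b) ⊻ b ≡ a
    h true  true  = refl
    h true  false = refl
    h false true  = refl
    h false false = refl

  ⊕-comm : ∀ {n} (u v : Point n) → u ⊕ v ≡ v ⊕ u
  ⊕-comm []      []      = refl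
  ⊕-comm (a ∷ u) (b ∷ v) = cong₂ _∷_ (h a b) (⊕-comm u v)
    where
    h : ∀ a b → a ⊻ b ≡ b ⊻ a
    h true  true  = refl
    h true  false = refl
    h false true  = refl
    h false false = refl

  ⊕-assoc : ∀ {n} (u v w : Point n) → u ⊕ v ⊕ w ≡ u ⊕ (v ⊕ w)
  ⊕-assoc []      []      []      = refl
  ⊕-assoc (a ∷ u) (b ∷ v) (c ∷ w) = cong₂ _∷_ (h a b c) (⊕-assoc u v w)
    where
    h : ∀ a b c → (a ⊻ b) ⊻ c ≡ a ⊻ (b ⊻ c)
    h true  true  true  = refl
    h true  true  false = refl
    h true  false true  = refl
    h true  false false = refl
    h false b     c     = refl

  ⊕-⊓ : ∀ {n} (u v w : Point n) → (u ⊕ v) ⊓ w ≡ u ⊓ w ⊕ v ⊓ w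
  ⊕-⊓ []      []      []      = refl
  ⊕-⊓ (a ∷ u) (b ∷ v) (c ∷ w) = cong₂ _∷_ (h a b c) (⊕-⊓ u v w)
    where
    h : ∀ a b c → (a ⊻ b) ∧ c ≡ (a ∧ c) ⊻ (b ∧ c)
    h true  true  true  = refl
    h true  true  false = refl
    h true  false true  = refl
    h true  false false = refl
    h false b     c     = refl

  ⊓-⊕ : ∀ {n} (u v w : Point n) → u ⊓ (v ⊕ w) ≡ u ⊓ v ⊕ u ⊓ w
  ⊓-⊕ []      []      []      = refl
  ⊓-⊕ (a ∷ u) (b ∷ v) (c ∷ w) = cong₂ _∷_ (h a b c) (⊓-⊕ u v w)
    where
    h : ∀ a b c → a ∧ (b ⊻ c) ≡ (a ∧ b) ⊻ (a ∧ c)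
    h true  b c = refl
    h false b c = refl

  ⊓-𝟏 : ∀ {n} (u : Point n) → u ⊓ 𝟏 ≡ u
  ⊓-𝟏 []      = refl
  ⊓-𝟏 (a ∷ u) = cong₂ _∷_ (∧-identityʳ a) (⊓-𝟏 u)

  ⊓-𝟎 : ∀ {n} (u : Point n) → u ⊓ 𝟎 ≡ 𝟎
  ⊓-𝟎 []          = refl
  ⊓-𝟎 (true ∷ u)  = cong (_∷_ _) (⊓-𝟎 u)
  ⊓-𝟎 (false ∷ u) = cong (_∷_ _) (⊓-𝟎 u)

  ⊕-𝟎 : ∀ {n} (u : Point n) → u ⊕ 𝟎 ≡ u
  ⊕-𝟎 []          = refl
  ⊕-𝟎 (true ∷ u)  = cong (_∷_ _) (⊕-𝟎 u)
  ⊕-𝟎 (false ∷ u) = cong (_∷_ _) (⊕-𝟎 u)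

  𝟎-⊕ : ∀ {n} (u : Point n) → 𝟎 ⊕ u ≡ u
  𝟎-⊕ u = trans (⊕-comm 𝟎 u) (⊕-𝟎 u)

  ⊕-cancelˡ : ∀ {n} (u v : Point n) → u ⊕ (u ⊕ v) ≡ v
  ⊕-cancelˡ u v = trans (cong (u ⊕_) (⊕-comm u v)) (trans (⊕-comm u (v ⊕ u)) (⊕-cancel v u))

  splice : ∀ {n} → Point n → Point n → Point n → Point n → Point n
  splice x y w R = x ⊕ (y ⊕ w) ⊓ R

  ∑-points : ∀ n (φ : Point (suc n) → ℕ) →
             ∑ (allPoints (suc n)) φ ≡ ∑ (allPoints n) (λ p → φ (true ∷ p)) + ∑ (allPoints n) (λ p → φ (false ∷ p))
  ∑-points n φ = trans (∑-++ (map (true ∷_) (allPoints n)) _ φ)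
                       (cong₂ _+_ (∑-map (true ∷_) (allPoints n) φ) (∑-map (false ∷_) (allPoints n) φ))

  length-points : ∀ n → length (allPoints n) ≡ 2 ^ n
  length-points zero    = refl
  length-points (suc n) = begin
    length (allPoints (suc n)) ≡⟨ length-∑ (allPoints (suc n)) ⟩
    ∑ (allPoints (suc n)) (λ _ → 1) ≡⟨ ∑-points n (λ _ → 1) ⟩
    ∑ (allPoints n) (λ _ → 1) + ∑ (allPoints n) (λ _ → 1) ≡⟨ cong (λ z → z + z) (trans (sym (length-∑ (allPoints n))) (length-points n)) ⟩
    2 ^ n + 2 ^ n ≡⟨ cong (2 ^ n +_) (sym (+-identityʳ (2 ^ n))) ⟩
    2 ^ suc n ∎
    where open ≡-Reasoning

  ∑-shift : ∀ {n} (u : Point n) (φ : Point n → ℕ) → ∑ (allPoints n) (λ p → φ (p ⊕ u)) ≡ ∑ (allPoints n) φ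
  ∑-shift []      φ = refl
  ∑-shift {suc n} (a ∷ u) φ = begin
    ∑ (allPoints (suc n)) (λ p → φ (p ⊕ (a ∷ u))) ≡⟨ ∑-points n _ ⟩
    ∑ P (λ p → φ ((true ⊻ a) ∷ (p ⊕ u))) + ∑ P (λ p → φ (a ∷ (p ⊕ u)))
      ≡⟨ cong₂ _+_ (∑-shift u (λ p → φ ((true ⊻ a) ∷ p))) (∑-shift u (λ p → φ (a ∷ p))) ⟩
    ∑ P (λ p → φ ((true ⊻ a) ∷ p)) + ∑ P (λ p → φ (a ∷ p)) ≡⟨ h a ⟩
    ∑ P (λ p → φ (true ∷ p)) + ∑ P (λ p → φ (false ∷ p)) ≡⟨ sym (∑-points n φ) ⟩
    ∑ (allPoints (suc n)) φ ∎
    where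
    open ≡-Reasoning
    P = allPoints n
    h : ∀ a → ∑ P (λ p → φ ((true ⊻ a) ∷ p)) + ∑ P (λ p → φ (a ∷ p)) ≡ ∑ P (λ p → φ (true ∷ p)) + ∑ P (λ p → φ (false ∷ p))
    h true  = +-comm (∑ P (λ p → φ (false ∷ p))) _
    h false = refl

  -- A subcube: just b fixes a coordinate to b, nothing leaves it free.
  Cube : ℕ → Set
  Cube n = Vec (Maybe Bool) n

  fits : Maybe Bool → Bool → Bool
  fits nothing      _     = true
  fits (just true)  b     = b
  fits (just false) b     = not b

  mem : ∀ {n} → Cube n → Point n → Bool
  mem []      []      = true
  mem (c ∷ T) (x ∷ p) = fits c x ∧ mem T p

  width : Maybe Bool → ℕ
  width nothing  = 2
  width (just _) = 1

  size : ∀ {n} → Cube n → ℕ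
  size []      = 1
  size (c ∷ T) = width c * size T

  ∑∈ : ∀ {n} → Cube n → (Point n → ℕ) → ℕ
  ∑∈ {n} T φ = ∑ (allPoints n) λ x → ⟦ mem T x ⟧ * φ x

  ∑∈-cong : ∀ {n} (T : Cube n) {φ ψ : Point n → ℕ} → (∀ x → φ x ≡ ψ x) → ∑∈ T φ ≡ ∑∈ T ψ
  ∑∈-cong {n} T e = ∑-cong (allPoints n) (λ x → cong (⟦ mem T x ⟧ *_) (e x))

  ∑∈-lin : ∀ {n} (T : Cube n) k l (φ ψ : Point n → ℕ) →
           ∑∈ T (λ x → k * φ x + l * ψ x) ≡ k * ∑∈ T φ + l * ∑∈ T ψ
  ∑∈-lin {n} T k l φ ψ =
    trans (∑-cong (allPoints n) (λ x → r ⟦ mem T x ⟧ k (φ x) l (ψ x)))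
    (trans (∑-+ (allPoints n) _ _) (cong₂ _+_ (∑-*ˡ (allPoints n) k _) (∑-*ˡ (allPoints n) l _)))
    where
    r : ∀ m k a l b → m * (k * a + l * b) ≡ k * (m * a) + l * (m * b)
    r = solve-∀

  ∑∈-+ : ∀ {n} (T : Cube n) (φ ψ : Point n → ℕ) → ∑∈ T (λ x → φ x + ψ x) ≡ ∑∈ T φ + ∑∈ T ψ
  ∑∈-+ {n} T φ ψ = trans (∑-cong (allPoints n) (λ x → *-distribˡ-+ ⟦ mem T x ⟧ (φ x) (ψ x))) (∑-+ (allPoints n) _ _)

  ∑∈-∷ : ∀ {n} c (T : Cube n) (φ : Point (suc n) → ℕ) →
         ∑∈ (c ∷ T) φ ≡ ⟦ fits c true ⟧ * ∑∈ T (λ p → φ (true ∷ p)) + ⟦ fits c false ⟧ * ∑∈ T (λ p → φ (false ∷ p))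
  ∑∈-∷ {n} c T φ = trans (∑-points n _) (cong₂ _+_ (h true) (h false))
    where
    h : ∀ b → ∑ (allPoints n) (λ p → ⟦ fits c b ∧ mem T p ⟧ * φ (b ∷ p)) ≡ ⟦ fits c b ⟧ * ∑∈ T (λ p → φ (b ∷ p))
    h b = trans (∑-cong (allPoints n) (λ p → trans (cong (_* φ (b ∷ p)) (⟦∧⟧ (fits c b) (mem T p))) (*-assoc ⟦ fits c b ⟧ _ _)))
                (∑-*ˡ (allPoints n) ⟦ fits c b ⟧ _)

  ∑∈-1 : ∀ {n} (T : Cube n) → ∑∈ T (λ _ → 1) ≡ size T
  ∑∈-1 []      = refl
  ∑∈-1 (c ∷ T) = trans (∑∈-∷ c T (λ _ → 1)) (trans (cong (λ z → ⟦ fits c true ⟧ * z + ⟦ fits c false ⟧ * z) (∑∈-1 T)) (h c (size T)))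
    where
    h : ∀ c z → ⟦ fits c true ⟧ * z + ⟦ fits c false ⟧ * z ≡ width c * z
    h nothing      z = sym (*-distribʳ-+ z 1 1)
    h (just true)  z = +-identityʳ (z + 0)
    h (just false) z = refl

  size-count : ∀ {n} (T : Cube n) → ∑ (allPoints n) (λ x → ⟦ mem T x ⟧) ≡ size T
  size-count {n} T = trans (∑-cong (allPoints n) (λ x → sym (*-identityʳ ⟦ mem T x ⟧))) (∑∈-1 T)

  size>0 : ∀ {n} (T : Cube n) → 0 < size T
  size>0 []             = s≤s z≤n
  size>0 (nothing ∷ T)  = *-mono-≤ {1} {2} (s≤s z≤n) (size>0 T)
  size>0 (just b ∷ T)   = *-mono-≤ {1} {1} (s≤s z≤n) (size>0 T)

  hullᵇ : Maybe Bool → Bool → Maybe Bool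
  hullᵇ nothing      _     = nothing
  hullᵇ (just true)  true  = just true
  hullᵇ (just false) false = just false
  hullᵇ (just true)  false = nothing
  hullᵇ (just false) true  = nothing

  hull : ∀ {n} → Cube n → Point n → Cube n
  hull []      []      = []
  hull (c ∷ T) (w ∷ p) = hullᵇ c w ∷ hull T p

  ∧-true : ∀ {a b} → a ∧ b ≡ true → (a ≡ true) × (b ≡ true)
  ∧-true {true} {true} e = refl , refl

  hull-⊇ : ∀ {n} (T : Cube n) w x → mem T x ≡ true → mem (hull T w) x ≡ true
  hull-⊇ []      []      []      e = refl
  hull-⊇ (c ∷ T) (w ∷ p) (x ∷ q) e with ∧-true e
  ... | e₁ , e₂ = cong₂ _∧_ (h c w x e₁) (hull-⊇ T p q e₂)
    where
    h : ∀ c w x → fits c x ≡ true → fits (hullᵇ c w) x ≡ true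
    h nothing      w     x     e = refl
    h (just true)  true  x     e = e
    h (just false) false x     e = e
    h (just true)  false x     e = refl
    h (just false) true  x     e = refl

  hull-mem : ∀ {n} (T : Cube n) w → mem T w ≡ true → hull T w ≡ T
  hull-mem []      []      e = refl
  hull-mem (c ∷ T) (w ∷ p) e with ∧-true e
  ... | e₁ , e₂ = cong₂ _∷_ (h c w e₁) (hull-mem T p e₂)
    where
    h : ∀ c w → fits c w ≡ true → hullᵇ c w ≡ c
    h nothing      w     e = refl
    h (just true)  true  e = refl
    h (just false) false e = refl

  hull-size-≤ : ∀ {n} (T : Cube n) w → size T ≤ size (hull T w)
  hull-size-≤ []      []      = ≤-refl
  hull-size-≤ (c ∷ T) (w ∷ p) = *-mono-≤ (h c w) (hull-size-≤ T p)
    where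
    h : ∀ c w → width c ≤ width (hullᵇ c w)
    h nothing      w     = ≤-refl
    h (just true)  true  = ≤-refl
    h (just false) false = ≤-refl
    h (just true)  false = s≤s z≤n
    h (just false) true  = s≤s z≤n

  -- One violated coordinate yields the factor 2 when it is freed; for the coordinates after it
  -- monotonicity is enough, hence the separate `hull-size-≤`.
  hull-size : ∀ {n} (T : Cube n) w → mem T w ≡ false → 2 * size T ≤ size (hull T w)
  hull-size []      []      ()
  hull-size (c ∷ T) (w ∷ p) e = h c w e
    where
    r : ∀ a → 2 * (1 * a) ≡ 2 * a
    r = solve-∀
    comm2 : ∀ k a → 2 * (k * a) ≡ k * (2 * a)
    comm2 = solve-∀
    h : ∀ c w → fits c w ∧ mem T p ≡ false → 2 * (width c * size T) ≤ width (hullᵇ c w) * size (hull T p)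
    h nothing      w     e = ≤-trans (≤-reflexive (comm2 2 (size T))) (*-monoʳ-≤ 2 (hull-size T p e))
    h (just true)  true  e = ≤-trans (≤-reflexive (comm2 1 (size T))) (*-monoʳ-≤ 1 (hull-size T p e))
    h (just false) false e = ≤-trans (≤-reflexive (comm2 1 (size T))) (*-monoʳ-≤ 1 (hull-size T p e))
    h (just true)  false e = ≤-trans (≤-reflexive (r (size T))) (*-monoʳ-≤ 2 (hull-size-≤ T p))
    h (just false) true  e = ≤-trans (≤-reflexive (r (size T))) (*-monoʳ-≤ 2 (hull-size-≤ T p))

  -- Splicing is uniform on the hull

  splices : ∀ {n} → Cube n → Point n → (Point n → ℕ) → ℕ
  splices {n} T w φ = ∑∈ T λ x → ∑∈ T λ y → ∑ (allPoints n) λ R → φ (splice x y w R)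

  spliceᵇ : Bool → Bool → Bool → Bool → Bool
  spliceᵇ x y w r = x ⊻ ((y ⊻ w) ∧ r)

  -- The share of one coordinate in a splice sum: `u b` stands for the sum over the other
  -- coordinates when the spliced bit is `b`, and the head bits of `x`, `y` and `R` decide how often
  -- each `b` arises.
  bitSplices : Maybe Bool → Bool → (Bool → ℕ) → ℕ
  bitSplices c w u = k true * branch true + k false * branch false
    where
    k : Bool → ℕ
    k b = ⟦ fits c b ⟧
    branch : Bool → ℕ
    branch x = k true * (u (spliceᵇ x true w true) + u (spliceᵇ x true w false)) + k false * (u (spliceᵇ x false w true) + u (spliceᵇ x false w false))

  splices-∷ : ∀ {n} c (T : Cube n) w₀ w φ → splices (c ∷ T) (w₀ ∷ w) φ ≡ bitSplices c w₀ λ b → splices T w λ p → φ (b ∷ p)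
  splices-∷ {n} c T w₀ w φ = trans (∑∈-∷ c T _) (cong₂ (λ a b → ⟦ fits c true ⟧ * a + ⟦ fits c false ⟧ * b) (outer true) (outer false))
    where
    P = allPoints n
    u : Bool → ℕ
    u b = splices T w (λ p → φ (b ∷ p))
    k : Bool → ℕ
    k b = ⟦ fits c b ⟧
    z : Bool → Bool → Bool → Bool
    z x y = spliceᵇ x y w₀
    q : Bool → Bool → Bool → Point n → ℕ
    q x₀ y₀ r₀ x = ∑∈ T λ y → ∑ P λ R → φ (z x₀ y₀ r₀ ∷ splice x y w R)
    inner : ∀ x₀ x → (∑∈ (c ∷ T) λ y → ∑ (allPoints (suc n)) λ R → φ (splice (x₀ ∷ x) y (w₀ ∷ w) R))
          ≡ k true * (q x₀ true true x + q x₀ true false x) + k false * (q x₀ false true x + q x₀ false false x)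
    inner x₀ x = trans (∑∈-∷ c T _) (cong₂ (λ a b → k true * a + k false * b) (each true) (each false))
      where
      each : ∀ y₀ → (∑∈ T λ y → ∑ (allPoints (suc n)) λ R → φ (splice (x₀ ∷ x) (y₀ ∷ y) (w₀ ∷ w) R)) ≡ q x₀ y₀ true x + q x₀ y₀ false x
      each y₀ = trans (∑∈-cong T (λ y → ∑-points n _)) (∑∈-+ T _ _)
    outer : ∀ x₀ → (∑∈ T λ x → ∑∈ (c ∷ T) λ y → ∑ (allPoints (suc n)) λ R → φ (splice (x₀ ∷ x) y (w₀ ∷ w) R))
          ≡ k true * (u (z x₀ true true) + u (z x₀ true false)) + k false * (u (z x₀ false true) + u (z x₀ false false))
    outer x₀ = trans (∑∈-cong T (inner x₀)) (trans (∑∈-lin T (k true) (k false) _ _)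
      (cong₂ (λ a b → k true * a + k false * b) (∑∈-+ T (q x₀ true true) _) (∑∈-+ T (q x₀ false true) _)))

  -- For x, y, R uniform the splice is uniform on hull T w: x keeps the free coordinates of T uniform,
  -- and R re-randomises exactly the fixed coordinates that w violates.
  splices-uniform : ∀ {n} (T : Cube n) w φ →
    splices T w φ * size (hull T w) ≡ size T * size T * 2 ^ n * ∑∈ (hull T w) φ
  splices-uniform []      []      φ = r (φ [])
    where
    r : ∀ a → (1 * (1 * (a + 0) + 0) + 0) * 1 ≡ 1 * (1 * a + 0)
    r = solve-∀
  splices-uniform {suc n} (c ∷ T) (w₀ ∷ w) φ = begin
    splices (c ∷ T) (w₀ ∷ w) φ * (width (hullᵇ c w₀) * H) ≡⟨ cong (_* (width (hullᵇ c w₀) * H)) (splices-∷ c T w₀ w φ) ⟩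
    _ ≡⟨ case c w₀ ⟩
    width c * S * (width c * S) * 2 ^ suc n * (⟦ fits (hullᵇ c w₀) true ⟧ * h true + ⟦ fits (hullᵇ c w₀) false ⟧ * h false)
                                                            ≡⟨ cong (width c * S * (width c * S) * 2 ^ suc n *_) (sym (∑∈-∷ (hullᵇ c w₀) (hull T w) φ)) ⟩
    width c * S * (width c * S) * 2 ^ suc n * ∑∈ (hullᵇ c w₀ ∷ hull T w) φ ∎
    where
    open ≡-Reasoning
    S = size T
    H = size (hull T w)
    h u : Bool → ℕ
    h b = ∑∈ (hull T w) (λ p → φ (b ∷ p))
    u b = splices T w (λ p → φ (b ∷ p))
    IH : ∀ b → u b * H ≡ S * S * 2 ^ n * h b
    IH b = splices-uniform T w (λ p → φ (b ∷ p))
    single : ∀ b → (u b + u b) * (1 * H) ≡ S * S * (2 * 2 ^ n) * h b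
    single b = trans (r₁ (u b) H) (trans (cong (2 *_) (IH b)) (r₂ S (2 ^ n) (h b)))
      where
      r₁ : ∀ a H → (a + a) * (1 * H) ≡ 2 * (a * H)
      r₁ = solve-∀
      r₂ : ∀ S p h → 2 * (S * S * p * h) ≡ S * S * (2 * p) * h
      r₂ = solve-∀
    case : ∀ c w₀ → bitSplices c w₀ u * (width (hullᵇ c w₀) * H)
           ≡ width c * S * (width c * S) * 2 ^ suc n * (⟦ fits (hullᵇ c w₀) true ⟧ * h true + ⟦ fits (hullᵇ c w₀) false ⟧ * h false)
    case nothing true = trans (r₁ (u true) (u false) H) (trans (cong₂ (λ a b → 8 * (a + b)) (IH true) (IH false)) (r₂ S (2 ^ n) (h true) (h false)))
      where
      r₁ : ∀ a b H → (1 * (1 * (a + a) + 1 * (b + a)) + 1 * (1 * (b + b) + 1 * (a + b))) * (2 * H) ≡ 8 * (a * H + b * H)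
      r₁ = solve-∀
      r₂ : ∀ S p a b → 8 * (S * S * p * a + S * S * p * b) ≡ 2 * S * (2 * S) * (2 * p) * (1 * a + 1 * b)
      r₂ = solve-∀
    case nothing false = trans (r₁ (u true) (u false) H) (trans (cong₂ (λ a b → 8 * (a + b)) (IH true) (IH false)) (r₂ S (2 ^ n) (h true) (h false)))
      where
      r₁ : ∀ a b H → (1 * (1 * (b + a) + 1 * (a + a)) + 1 * (1 * (a + b) + 1 * (b + b))) * (2 * H) ≡ 8 * (a * H + b * H)
      r₁ = solve-∀
      r₂ : ∀ S p a b → 8 * (S * S * p * a + S * S * p * b) ≡ 2 * S * (2 * S) * (2 * p) * (1 * a + 1 * b)
      r₂ = solve-∀
    case (just true) true = trans (r₁ (u true) (u false) H) (trans (single true) (r₂ S (2 ^ n) (h true) (h false)))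
      where
      r₁ : ∀ a b H → (1 * (1 * (a + a) + 0 * (b + a)) + 0 * (1 * (b + b) + 0 * (a + b))) * (1 * H) ≡ (a + a) * (1 * H)
      r₁ = solve-∀
      r₂ : ∀ S p a b → S * S * (2 * p) * a ≡ 1 * S * (1 * S) * (2 * p) * (1 * a + 0 * b)
      r₂ = solve-∀
    case (just false) false = trans (r₁ (u true) (u false) H) (trans (single false) (r₂ S (2 ^ n) (h true) (h false)))
      where
      r₁ : ∀ a b H → (0 * (0 * (b + a) + 1 * (a + a)) + 1 * (0 * (a + b) + 1 * (b + b))) * (1 * H) ≡ (b + b) * (1 * H)
      r₁ = solve-∀
      r₂ : ∀ S p a b → S * S * (2 * p) * b ≡ 1 * S * (1 * S) * (2 * p) * (0 * a + 1 * b)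
      r₂ = solve-∀
    case (just true) false = trans (r₁ (u true) (u false) H) (trans (cong₂ (λ a b → 2 * (a + b)) (IH true) (IH false)) (r₂ S (2 ^ n) (h true) (h false)))
      where
      r₁ : ∀ a b H → (1 * (1 * (b + a) + 0 * (a + a)) + 0 * (1 * (a + b) + 0 * (b + b))) * (2 * H) ≡ 2 * (a * H + b * H)
      r₁ = solve-∀
      r₂ : ∀ S p a b → 2 * (S * S * p * a + S * S * p * b) ≡ 1 * S * (1 * S) * (2 * p) * (1 * a + 1 * b)
      r₂ = solve-∀
    case (just false) true = trans (r₁ (u true) (u false) H) (trans (cong₂ (λ a b → 2 * (a + b)) (IH true) (IH false)) (r₂ S (2 ^ n) (h true) (h false)))
      where
      r₁ : ∀ a b H → (0 * (0 * (a + a) + 1 * (b + a)) + 1 * (0 * (b + b) + 1 * (a + b))) * (2 * H) ≡ 2 * (a * H + b * H)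
      r₁ = solve-∀
      r₂ : ∀ S p a b → 2 * (S * S * p * a + S * S * p * b) ≡ 1 * S * (1 * S) * (2 * p) * (1 * a + 1 * b)
      r₂ = solve-∀

  mem-splice : ∀ {n} (T : Cube n) x y w R → mem T x ≡ true → mem T y ≡ true → mem T w ≡ true →
               mem T (splice x y w R) ≡ true
  mem-splice []      []      []      []      []      _ _ _ = refl
  mem-splice (c ∷ T) (x ∷ p) (y ∷ q) (w ∷ r) (b ∷ R) e₁ e₂ e₃ with ∧-true e₁ | ∧-true e₂ | ∧-true e₃
  ... | f₁ , g₁ | f₂ , g₂ | f₃ , g₃ = cong₂ _∧_ (h c x y w b f₁ f₂ f₃) (mem-splice T p q r R g₁ g₂ g₃)
    where
    h : ∀ c x y w b → fits c x ≡ true → fits c y ≡ true → fits c w ≡ true → fits c (x ⊻ ((y ⊻ w) ∧ b)) ≡ true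
    h nothing      _     _     _     _ _ _ _ = refl
    h (just true)  true  true  true  b _ _ _ = refl
    h (just false) false false false b _ _ _ = refl

  evalLit-fits : ∀ {n} (i : Fin n) b y → evalLit (i , b) y ≡ fits (just b) (lookup y i)
  evalLit-fits i true  y = refl
  evalLit-fits i false y with lookup y i
  ... | true  = refl
  ... | false = refl

  -- The witness `x` lies in `T` and satisfies the new literal, so coordinate `i` cannot be fixed to
  -- the opposite value; only therefore is overwriting the same as intersecting.
  mem-≔ : ∀ {n} (T : Cube n) i b x y → mem T x ≡ true → fits (just b) (lookup x i) ≡ true →
          mem (T [ i ]≔ just b) y ≡ fits (just b) (lookup y i) ∧ mem T y
  mem-≔ (c ∷ T) zero b (x ∷ p) (y ∷ q) e f = h c b x y (proj₁ (∧-true e)) f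
    where
    h : ∀ c b x y → fits c x ≡ true → fits (just b) x ≡ true →
        fits (just b) y ∧ mem T q ≡ fits (just b) y ∧ (fits c y ∧ mem T q)
    h nothing      b     x     y     _ _ = refl
    h (just true)  true  x     true  _ _ = refl
    h (just true)  true  x     false _ _ = refl
    h (just false) false x     true  _ _ = refl
    h (just false) false x     false _ _ = refl
    h (just true)  false true  y     _ ()
    h (just true)  false false y     () _
    h (just false) true  true  y     () _
    h (just false) true  false y     _ ()
  mem-≔ (c ∷ T) (suc i) b (x ∷ p) (y ∷ q) e f = begin
    fits c y ∧ mem (T [ i ]≔ just b) q ≡⟨ cong (fits c y ∧_) (mem-≔ T i b p q (proj₂ (∧-true e)) f) ⟩
    fits c y ∧ (fits (just b) (lookup q i) ∧ mem T q) ≡⟨ sym (∧-assoc (fits c y) _ _) ⟩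
    (fits c y ∧ fits (just b) (lookup q i)) ∧ mem T q ≡⟨ cong (_∧ mem T q) (∧-comm (fits c y) _) ⟩
    (fits (just b) (lookup q i) ∧ fits c y) ∧ mem T q ≡⟨ ∧-assoc (fits (just b) (lookup q i)) _ _ ⟩
    fits (just b) (lookup q i) ∧ (fits c y ∧ mem T q) ∎
    where open ≡-Reasoning

  termCube : ∀ {n} → Term n → Cube n
  termCube []            = replicate _ nothing
  termCube ((i , b) ∷ t) = termCube t [ i ]≔ just b

  -- Only for satisfiable terms: on a contradictory term the last write wins.
  mem-termCube : ∀ {n} (t : Term n) x → evalTerm t x ≡ true → ∀ y → mem (termCube t) y ≡ evalTerm t y
  mem-termCube []            x e y = all y
    where
    all : ∀ {n} (y : Point n) → mem (replicate n nothing) y ≡ true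
    all []      = refl
    all (_ ∷ y) = all y
  mem-termCube ((i , b) ∷ t) x e y with ∧-true {evalLit (i , b) x} e
  ... | e₁ , e₂ = trans (mem-≔ (termCube t) i b x y (trans (mem-termCube t x e₂ x) e₂) (trans (sym (evalLit-fits i b x)) e₁))
                        (cong₂ _∧_ (sym (evalLit-fits i b y)) (mem-termCube t x e₂ y))

  shiftLit : ∀ {n} → Literal n → Literal (suc n)
  shiftLit (i , b) = suc i , b

  cubeTerm : ∀ {n} → Cube n → Term n
  cubeTerm []            = []
  cubeTerm (nothing ∷ T) = map shiftLit (cubeTerm T)
  cubeTerm (just b ∷ T)  = (zero , b) ∷ map shiftLit (cubeTerm T)

  evalTerm-shift : ∀ {n} (t : Term n) x (p : Point n) → evalTerm (map shiftLit t) (x ∷ p) ≡ evalTerm t p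
  evalTerm-shift []                x p = refl
  evalTerm-shift ((i , true) ∷ t)  x p = cong (lookup p i ∧_) (evalTerm-shift t x p)
  evalTerm-shift ((i , false) ∷ t) x p = cong ((if lookup p i then false else true) ∧_) (evalTerm-shift t x p)

  evalTerm-cubeTerm : ∀ {n} (T : Cube n) x → evalTerm (cubeTerm T) x ≡ mem T x
  evalTerm-cubeTerm []            []      = refl
  evalTerm-cubeTerm (nothing ∷ T) (x ∷ p) = trans (evalTerm-shift (cubeTerm T) x p) (evalTerm-cubeTerm T p)
  evalTerm-cubeTerm (just b ∷ T)  (x ∷ p) = cong₂ _∧_ (evalLit-fits zero b (x ∷ p)) (trans (evalTerm-shift (cubeTerm T) x p) (evalTerm-cubeTerm T p))

  -- Sets almost closed under splicing are almost subcubes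

  ≤ᵇ-true : ∀ {m n} → m ≤ n → (m ≤ᵇ n) ≡ true
  ≤ᵇ-true {m} {n} p with m ≤ᵇ n in eq
  ... | true  = refl
  ... | false = ⊥-elim (subst IsTrue eq (≤⇒≤ᵇ p))

  ≤ᵇ-true⁻¹ : ∀ {m n} → (m ≤ᵇ n) ≡ true → m ≤ n
  ≤ᵇ-true⁻¹ {m} {n} e = ≤ᵇ⇒≤ m n (subst IsTrue (sym e) _)

  ≤ᵇ-false : ∀ {m n} → n < m → (m ≤ᵇ n) ≡ false
  ≤ᵇ-false {m} {n} p with m ≤ᵇ n in eq
  ... | true  = ⊥-elim (<⇒≱ p (≤ᵇ-true⁻¹ {m} eq))
  ... | false = refl

  ≤ᵇ-false⁻¹ : ∀ {m n} → (m ≤ᵇ n) ≡ false → n < m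
  ≤ᵇ-false⁻¹ {m} {n} e = ≰⇒> (λ p → false≢true (trans (sym e) (≤ᵇ-true p)))

  bool-≡ : ∀ {a b} → (a ≡ true → b ≡ true) → (b ≡ true → a ≡ true) → a ≡ b
  bool-≡ {true}  {b}     f g = sym (f refl)
  bool-≡ {false} {false} f g = refl
  bool-≡ {false} {true}  f g = g refl

  ⊕-triangle : ∀ {n} (y y′ u : Point n) → (y ⊕ y′) ⊕ (y ⊕ u ⊕ y′) ≡ u
  ⊕-triangle []       []       []      = refl
  ⊕-triangle (a ∷ y) (b ∷ y′) (c ∷ u) = cong₂ _∷_ (h a b c) (⊕-triangle y y′ u)
    where
    h : ∀ a b c → (a ⊻ b) ⊻ ((a ⊻ c) ⊻ b) ≡ c
    h true  true  true  = refl
    h true  true  false = refl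
    h true  false true  = refl
    h true  false false = refl
    h false true  true  = refl
    h false true  false = refl
    h false false true  = refl
    h false false false = refl

  cosetCube : ∀ {n} → (Point n → Bool) → Point n → Cube n
  cosetCube {zero}  Q []       = []
  cosetCube {suc n} Q (b ∷ x₀) = (if Q (true ∷ 𝟎) then nothing else just b) ∷ cosetCube (λ v → Q (false ∷ v)) x₀

  -- A linear subspace closed under restriction of the support is spanned by unit vectors,
  -- so its cosets are subcubes.
  mem-cosetCube : ∀ {n} (Q : Point n → Bool) → Q 𝟎 ≡ true →
    (∀ u v → Q u ≡ true → Q v ≡ true → Q (u ⊕ v) ≡ true) → (∀ u S → Q u ≡ true → Q (u ⊓ S) ≡ true) →
    ∀ x₀ y → mem (cosetCube Q x₀) y ≡ Q (y ⊕ x₀)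
  mem-cosetCube {zero}  Q Q0 Q⊕ Q⊓ []       []      = sym Q0
  mem-cosetCube {suc n} Q Q0 Q⊕ Q⊓ (b ∷ x₀) (a ∷ y) =
    trans (cong (fits (if Q (true ∷ 𝟎) then nothing else just b) a ∧_) (mem-cosetCube (λ v → Q (false ∷ v)) Q0 (λ u v → Q⊕ (false ∷ u) (false ∷ v)) (λ u S → Q⊓ (false ∷ u) (false ∷ S)) x₀ y)) (h b a)
    where
    v = y ⊕ x₀
    split : Q (true ∷ v) ≡ Q (true ∷ 𝟎) ∧ Q (false ∷ v)
    split = bool-≡
      (λ e → cong₂ _∧_ (trans (cong (λ w → Q (true ∷ w)) (sym (⊓-𝟎 v))) (Q⊓ (true ∷ v) (true ∷ 𝟎) e))
                       (trans (cong (λ w → Q (false ∷ w)) (sym (⊓-𝟏 v))) (Q⊓ (true ∷ v) (false ∷ 𝟏) e)))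
      (λ e → trans (cong (λ w → Q (true ∷ w)) (sym (𝟎-⊕ v))) (Q⊕ (true ∷ 𝟎) (false ∷ v) (proj₁ (∧-true e)) (proj₂ (∧-true {Q (true ∷ 𝟎)} e))))
    h : ∀ b a → fits (if Q (true ∷ 𝟎) then nothing else just b) a ∧ Q (false ∷ v) ≡ Q ((a ⊻ b) ∷ v)
    h b a with Q (true ∷ 𝟎) in eq
    h true  true  | true  = refl
    h true  false | true  = sym (trans split (cong (_∧ Q (false ∷ v)) eq))
    h false true  | true  = sym (trans split (cong (_∧ Q (false ∷ v)) eq))
    h false false | true  = refl
    h true  true  | false = refl
    h true  false | false = sym (trans split (cong (_∧ Q (false ∷ v)) eq))
    h false true  | false = sym (trans split (cong (_∧ Q (false ∷ v)) eq))
    h false false | false = refl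

  module Rigidity {n : ℕ} (C : Point n → Bool) where
    P = allPoints n

    c : ℕ
    c = ∑ P λ x → ⟦ C x ⟧

    escape : Point n → ℕ
    escape u = ∑ P λ x → ⟦ C x ⟧ * ⟦ not (C (x ⊕ u)) ⟧

    -- A point lost under `u ⊕ v` is lost under `u`, or survives `u` and is lost under `v`
    -- afterwards; translation by `u` identifies the second count with `escape v`.
    escape-⊕ : ∀ u v → escape (u ⊕ v) ≤ escape u + escape v
    escape-⊕ u v = begin
      escape (u ⊕ v)
        ≤⟨ ∑-mono P (λ x → subst (λ w → ⟦ C x ⟧ * ⟦ not (C w) ⟧ ≤ ⟦ C x ⟧ * ⟦ not (C (x ⊕ u)) ⟧ + ⟦ C (x ⊕ u) ⟧ * ⟦ not (C (x ⊕ u ⊕ v)) ⟧)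
                       (⊕-assoc x u v) (h (C x) (C (x ⊕ u)) (C (x ⊕ u ⊕ v)))) ⟩
      (∑ P λ x → ⟦ C x ⟧ * ⟦ not (C (x ⊕ u)) ⟧ + ⟦ C (x ⊕ u) ⟧ * ⟦ not (C (x ⊕ u ⊕ v)) ⟧)
        ≡⟨ ∑-+ P _ _ ⟩
      escape u + (∑ P λ x → ⟦ C (x ⊕ u) ⟧ * ⟦ not (C (x ⊕ u ⊕ v)) ⟧)
        ≡⟨ cong (escape u +_) (∑-shift u (λ x → ⟦ C x ⟧ * ⟦ not (C (x ⊕ v)) ⟧)) ⟩
      escape u + escape v ∎
      where
      open ≤-Reasoning
      h : ∀ a b d → ⟦ a ⟧ * ⟦ not d ⟧ ≤ ⟦ a ⟧ * ⟦ not b ⟧ + ⟦ b ⟧ * ⟦ not d ⟧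
      h false b     d = z≤n
      h true  true  d = ≤-refl
      h true  false d = ≤-trans (≤-reflexive (+-identityʳ ⟦ not d ⟧)) (⟦⟧≤1 (not d))

    total : Point n → ℕ
    total d = ∑ P λ R → escape (d ⊓ R)

    restricted : ∀ d S → 2 ^ n * escape (d ⊓ S) ≤ 2 * total d
    restricted d S = begin
      2 ^ n * escape (d ⊓ S) ≡⟨ cong (_* escape (d ⊓ S)) (sym (length-points n)) ⟩
      length P * escape (d ⊓ S) ≡⟨ sym (∑-const P _) ⟩
      (∑ P λ R → escape (d ⊓ S)) ≤⟨ ∑-mono P (λ R → subst (λ w → escape w ≤ escape (d ⊓ R) + escape (d ⊓ (R ⊕ S))) (e R) (escape-⊕ (d ⊓ R) (d ⊓ (R ⊕ S)))) ⟩
      (∑ P λ R → escape (d ⊓ R) + escape (d ⊓ (R ⊕ S))) ≡⟨ ∑-+ P _ _ ⟩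
      total d + (∑ P λ R → escape (d ⊓ (R ⊕ S))) ≡⟨ cong (total d +_) (∑-shift S (λ R → escape (d ⊓ R))) ⟩
      total d + total d ≡⟨ cong (total d +_) (sym (+-identityʳ (total d))) ⟩
      2 * total d ∎
      where
      open ≤-Reasoning
      e : ∀ R → d ⊓ R ⊕ d ⊓ (R ⊕ S) ≡ d ⊓ S
      e R = trans (cong (d ⊓ R ⊕_) (⊓-⊕ d R S)) (⊕-cancelˡ (d ⊓ R) (d ⊓ S))

    -- Since `splice x y y′ R` is `x` translated by `(y ⊕ y′) ⊓ R`, this counts the quadruples with
    -- `x`, `y`, `y′` in `C` whose splice leaves `C`.
    violations : ℕ
    violations = ∑ P λ y → ∑ P λ y′ → ⟦ C y ⟧ * ⟦ C y′ ⟧ * total (y ⊕ y′)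

    module _ (K : ℕ) (K≥64 : 64 ≤ K) (c>0 : 0 < c) (few : violations * (K * K) ≤ c * c * c * 2 ^ n) where
      2^n>0 : 0 < 2 ^ n
      2^n>0 = m^n>0 2 n

      bad : Point n → Point n → Bool
      bad y y′ = not (total (y ⊕ y′) * K ≤ᵇ c * 2 ^ n)

      badPairs : ℕ
      badPairs = ∑ P λ y → ∑ P λ y′ → ⟦ C y ⟧ * ⟦ C y′ ⟧ * ⟦ bad y y′ ⟧

      -- The square `K * K` in `few` is spent in two halves: by Markov's inequality at most a
      -- fraction `1/K` of the pairs is bad, and for every other pair the average of `escape` over
      -- the masks is at most `c / K`.
      badPairs-few : badPairs * K ≤ c * c
      badPairs-few = pos-cancel (*-mono-≤ c>0 2^n>0) (begin
        badPairs * K * (c * 2 ^ n) ≡⟨ r₁ badPairs K (c * 2 ^ n) ⟩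
        badPairs * (c * 2 ^ n) * K ≤⟨ *-monoˡ-≤ K markov ⟩
        violations * K * K ≡⟨ *-assoc violations K K ⟩
        violations * (K * K) ≤⟨ few ⟩
        c * c * c * 2 ^ n ≡⟨ *-assoc (c * c) c (2 ^ n) ⟩
        c * c * (c * 2 ^ n) ∎)
        where
        open ≤-Reasoning
        r₁ : ∀ a b c → a * b * c ≡ a * c * b
        r₁ = solve-∀
        pull : (ψ : Point n → Point n → ℕ) (k : ℕ) → (∑ P λ y → ∑ P λ y′ → ψ y y′ * k) ≡ (∑ P λ y → ∑ P λ y′ → ψ y y′) * k
        pull ψ k = trans (∑-cong P (λ y → ∑-*ʳ P k (ψ y))) (∑-*ʳ P k _)
        h : ∀ a m t → a * ⟦ not (t * K ≤ᵇ m) ⟧ * m ≤ a * t * K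
        h a m t with t * K ≤ᵇ m in eq
        ... | true  = ≤-trans (≤-reflexive (cong (_* m) (*-zeroʳ a))) z≤n
        ... | false = ≤-trans (≤-reflexive (cong (_* m) (*-identityʳ a))) (≤-trans (*-monoʳ-≤ a (<⇒≤ (≤ᵇ-false⁻¹ {t * K} eq))) (≤-reflexive (sym (*-assoc a t K))))
        markov : badPairs * (c * 2 ^ n) ≤ violations * K
        markov = ≤-trans (≤-reflexive (sym (pull _ (c * 2 ^ n))))
                 (≤-trans (∑-mono P (λ y → ∑-mono P (λ y′ → h (⟦ C y ⟧ * ⟦ C y′ ⟧) (c * 2 ^ n) (total (y ⊕ y′)))))
                          (≤-reflexive (pull _ K)))

      good-escape : ∀ y y′ S → bad y y′ ≡ false → escape ((y ⊕ y′) ⊓ S) * K ≤ 2 * c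
      good-escape y y′ S e = pos-cancel 2^n>0 (begin
        escape ((y ⊕ y′) ⊓ S) * K * 2 ^ n ≡⟨ r₁ _ K (2 ^ n) ⟩
        2 ^ n * escape ((y ⊕ y′) ⊓ S) * K ≤⟨ *-monoˡ-≤ K (restricted (y ⊕ y′) S) ⟩
        2 * total (y ⊕ y′) * K ≡⟨ *-assoc 2 (total (y ⊕ y′)) K ⟩
        2 * (total (y ⊕ y′) * K) ≤⟨ *-monoʳ-≤ 2 (≤ᵇ-true⁻¹ {total (y ⊕ y′) * K} (not-false e)) ⟩
        2 * (c * 2 ^ n) ≡⟨ sym (*-assoc 2 c (2 ^ n)) ⟩
        2 * c * 2 ^ n ∎)
        where
        open ≤-Reasoning
        r₁ : ∀ a b c → a * b * c ≡ c * a * b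
        r₁ = solve-∀

      -- A translation that keeps most of C is a sum of two differences of typical pairs,
      -- hence it and all its restrictions keep almost all of C.
      gap : ∀ u S → 4 * escape u ≤ c → escape (u ⊓ S) * K ≤ 4 * c
      gap u S small with escape (u ⊓ S) * K ≤? 4 * c
      ... | yes p = p
      -- If the bound failed, every pair of points of `C` would be charged: `u` moves `y` out of
      -- `C`, or `(y , y′)` is bad, or `(y ⊕ u , y′)` is bad. In units of `c * c / 64` these charges
      -- are at most 16, 1 and 1, so they cannot cover all 64.
      ... | no ¬p = ⊥-elim (<⇒≱ (*-monoʳ-< 46 {0} {c * c} (*-mono-≤ c>0 c>0)) (+-cancelˡ-≤ (18 * (c * c)) _ _ (begin
          18 * (c * c) + 46 * (c * c) ≡⟨ r₀ (c * c) ⟩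
          64 * (c * c) ≤⟨ *-monoʳ-≤ 64 covered ⟩
          64 * (escape u * c + badPairs + badPairs) ≡⟨ r₁ (escape u) c badPairs ⟩
          16 * (4 * escape u * c) + 2 * (badPairs * 64)
            ≤⟨ +-mono-≤ (*-monoʳ-≤ 16 (*-monoˡ-≤ c small)) (*-monoʳ-≤ 2 (≤-trans (*-monoʳ-≤ badPairs K≥64) badPairs-few)) ⟩
          16 * (c * c) + 2 * (c * c) ≡⟨ r₂ (c * c) ⟩
          18 * (c * c) + 46 * 0 ∎)))
        where
        open ≤-Reasoning
        r₀ : ∀ a → 18 * a + 46 * a ≡ 64 * a
        r₀ = solve-∀
        r₁ : ∀ e c b → 64 * (e * c + b + b) ≡ 16 * (4 * e * c) + 2 * (b * 64)
        r₁ = solve-∀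
        r₂ : ∀ a → 16 * a + 2 * a ≡ 18 * a + 46 * 0
        r₂ = solve-∀
        both-good : ∀ y y′ → bad y y′ ≡ false → bad (y ⊕ u) y′ ≡ false → ⊥
        both-good y y′ e₁ e₂ = ¬p (begin
          escape (u ⊓ S) * K
            ≡⟨ cong (λ w → escape (w ⊓ S) * K) (sym (⊕-triangle y y′ u)) ⟩
          escape (((y ⊕ y′) ⊕ (y ⊕ u ⊕ y′)) ⊓ S) * K
            ≡⟨ cong (λ w → escape w * K) (⊕-⊓ (y ⊕ y′) (y ⊕ u ⊕ y′) S) ⟩
          escape ((y ⊕ y′) ⊓ S ⊕ (y ⊕ u ⊕ y′) ⊓ S) * K
            ≤⟨ *-monoˡ-≤ K (escape-⊕ ((y ⊕ y′) ⊓ S) _) ⟩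
          (escape ((y ⊕ y′) ⊓ S) + escape ((y ⊕ u ⊕ y′) ⊓ S)) * K
            ≡⟨ *-distribʳ-+ K (escape ((y ⊕ y′) ⊓ S)) _ ⟩
          escape ((y ⊕ y′) ⊓ S) * K + escape ((y ⊕ u ⊕ y′) ⊓ S) * K
            ≤⟨ +-mono-≤ (good-escape y y′ S e₁) (good-escape (y ⊕ u) y′ S e₂) ⟩
          2 * c + 2 * c
            ≡⟨ sym (*-distribʳ-+ c 2 2) ⟩
          4 * c ∎)
        pointwise : ∀ y y′ → ⟦ C y ⟧ * ⟦ C y′ ⟧ ≤ ⟦ C y ⟧ * ⟦ not (C (y ⊕ u)) ⟧ * ⟦ C y′ ⟧
                    + ⟦ C y ⟧ * ⟦ C y′ ⟧ * ⟦ bad y y′ ⟧ + ⟦ C (y ⊕ u) ⟧ * ⟦ C y′ ⟧ * ⟦ bad (y ⊕ u) y′ ⟧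
        pointwise y y′ with C y | C y′ | C (y ⊕ u) | bad y y′ in e₁ | bad (y ⊕ u) y′ in e₂
        ... | false | _     | _     | _     | _     = z≤n
        ... | true  | false | _     | _     | _     = z≤n
        ... | true  | true  | false | _     | _     = s≤s z≤n
        ... | true  | true  | true  | true  | _     = s≤s z≤n
        ... | true  | true  | true  | false | true  = s≤s z≤n
        ... | true  | true  | true  | false | false = ⊥-elim (both-good y y′ e₁ e₂)
        prod : (φ ψ : Point n → ℕ) → (∑ P λ y → ∑ P λ y′ → φ y * ψ y′) ≡ ∑ P φ * ∑ P ψ
        prod φ ψ = trans (∑-cong P (λ y → ∑-*ˡ P (φ y) ψ)) (∑-*ʳ P _ φ)
        covered : c * c ≤ escape u * c + badPairs + badPairs
        covered = begin
          c * c ≡⟨ sym (prod _ _) ⟩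
          (∑ P λ y → ∑ P λ y′ → ⟦ C y ⟧ * ⟦ C y′ ⟧) ≤⟨ ∑-mono P (λ y → ∑-mono P (pointwise y)) ⟩
          (∑ P λ y → ∑ P λ y′ → A₁ y y′ + A₂ y y′ + A₃ y y′) ≡⟨ ∑-cong P (λ y → trans (∑-+ P _ (A₃ y)) (cong (_+ ∑ P (A₃ y)) (∑-+ P (A₁ y) (A₂ y)))) ⟩
          (∑ P λ y → ∑ P (A₁ y) + ∑ P (A₂ y) + ∑ P (A₃ y)) ≡⟨ trans (∑-+ P _ (λ y → ∑ P (A₃ y))) (cong (_+ (∑ P λ y → ∑ P (A₃ y))) (∑-+ P _ _)) ⟩
          (∑ P λ y → ∑ P (A₁ y)) + (∑ P λ y → ∑ P (A₂ y)) + (∑ P λ y → ∑ P (A₃ y))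
            ≡⟨ cong₂ (λ a b → a + badPairs + b) (prod (λ y → ⟦ C y ⟧ * ⟦ not (C (y ⊕ u)) ⟧) (λ y′ → ⟦ C y′ ⟧)) (∑-shift u (λ y → ∑ P λ y′ → ⟦ C y ⟧ * ⟦ C y′ ⟧ * ⟦ bad y y′ ⟧)) ⟩
          escape u * c + badPairs + badPairs ∎
          where
          A₁ A₂ A₃ : Point n → Point n → ℕ
          A₁ y y′ = ⟦ C y ⟧ * ⟦ not (C (y ⊕ u)) ⟧ * ⟦ C y′ ⟧
          A₂ y y′ = ⟦ C y ⟧ * ⟦ C y′ ⟧ * ⟦ bad y y′ ⟧
          A₃ y y′ = ⟦ C (y ⊕ u) ⟧ * ⟦ C y′ ⟧ * ⟦ bad (y ⊕ u) y′ ⟧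

      V : Point n → Bool
      V u = 4 * escape u ≤ᵇ c

      -- The self-improvement that makes `V` a subspace: membership asks for `1/4`, `gap` upgrades
      -- this to `1/16` for `u` and all its restrictions, and a sum of two such elements is back
      -- below `1/4`.
      16escape : ∀ u S → 4 * escape u ≤ c → 16 * escape (u ⊓ S) ≤ c
      16escape u S h = *-cancelˡ-≤ 4 (begin
        4 * (16 * escape (u ⊓ S)) ≡⟨ r (escape (u ⊓ S)) ⟩
        escape (u ⊓ S) * 64 ≤⟨ *-monoʳ-≤ (escape (u ⊓ S)) K≥64 ⟩
        escape (u ⊓ S) * K ≤⟨ gap u S h ⟩
        4 * c ∎)
        where
        open ≤-Reasoning
        r : ∀ a → 4 * (16 * a) ≡ a * 64
        r = solve-∀

      V-𝟎 : V 𝟎 ≡ true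
      V-𝟎 = ≤ᵇ-true (≤-trans (≤-reflexive (cong (4 *_) zero-escape)) z≤n)
        where
        zero-escape : escape 𝟎 ≡ 0
        zero-escape = trans (∑-cong P (λ x → trans (cong (λ w → ⟦ C x ⟧ * ⟦ not (C w) ⟧) (⊕-𝟎 x)) (⟦⟧*⟦not⟧ (C x)))) (trans (∑-const P 0) (*-zeroʳ (length P)))

      V-⊓ : ∀ u S → V u ≡ true → V (u ⊓ S) ≡ true
      V-⊓ u S e = ≤ᵇ-true (≤-trans (*-monoˡ-≤ (escape (u ⊓ S)) (s≤s (s≤s (s≤s (s≤s (z≤n {12})))))) (16escape u S (≤ᵇ-true⁻¹ {4 * escape u} e)))

      V-⊕ : ∀ u v → V u ≡ true → V v ≡ true → V (u ⊕ v) ≡ true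
      V-⊕ u v e₁ e₂ = ≤ᵇ-true {4 * escape (u ⊕ v)} {c} (*-cancelˡ-≤ 4 (begin
        4 * (4 * escape (u ⊕ v)) ≤⟨ *-monoʳ-≤ 4 (*-monoʳ-≤ 4 (escape-⊕ u v)) ⟩
        4 * (4 * (escape u + escape v)) ≡⟨ r (escape u) (escape v) ⟩
        16 * escape u + 16 * escape v ≤⟨ +-mono-≤ (h u e₁) (h v e₂) ⟩
        c + c ≤⟨ m≤m+n (c + c) (c + c) ⟩
        c + c + (c + c) ≡⟨ r₂ c ⟩
        4 * c ∎))
        where
        open ≤-Reasoning
        r : ∀ a b → 4 * (4 * (a + b)) ≡ 16 * a + 16 * b
        r = solve-∀
        r₂ : ∀ c → c + c + (c + c) ≡ 4 * c
        r₂ = solve-∀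
        h : ∀ u → V u ≡ true → 16 * escape u ≤ c
        h u e = subst (λ w → 16 * escape w ≤ c) (⊓-𝟏 u) (16escape u 𝟏 (≤ᵇ-true⁻¹ {4 * escape u} e))

      V-gap : ∀ u → V u ≡ true → escape u * K ≤ 4 * c
      V-gap u e = subst (λ w → escape w * K ≤ 4 * c) (⊓-𝟏 u) (gap u 𝟏 (≤ᵇ-true⁻¹ {4 * escape u} e))

      good-V : ∀ y y′ → bad y y′ ≡ false → V (y ⊕ y′) ≡ true
      good-V y y′ e = ≤ᵇ-true {4 * escape (y ⊕ y′)} {c} (*-cancelˡ-≤ 2 (begin
        2 * (4 * escape (y ⊕ y′)) ≡⟨ r (escape (y ⊕ y′)) ⟩
        escape (y ⊕ y′) * 8 ≤⟨ *-monoʳ-≤ (escape (y ⊕ y′)) (≤-trans (m≤m+n 8 56) K≥64) ⟩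
        escape (y ⊕ y′) * K ≤⟨ subst (λ w → escape w * K ≤ 2 * c) (⊓-𝟏 (y ⊕ y′)) (good-escape y y′ 𝟏 e) ⟩
        2 * c ∎))
        where
        open ≤-Reasoning
        r : ∀ a → 2 * (4 * a) ≡ a * 8
        r = solve-∀

      v : ℕ
      v = ∑ P λ u → ⟦ V u ⟧

      outside missing : Point n → ℕ
      outside x₀ = ∑ P λ y → ⟦ C y ⟧ * ⟦ not (V (y ⊕ x₀)) ⟧
      missing x₀ = ∑ P λ u → ⟦ V u ⟧ * ⟦ not (C (x₀ ⊕ u)) ⟧

      -- By `good-V`, a point `y` of `C` outside the coset of `x₀` makes `(y , x₀)` a bad pair, so
      -- all centres together lose at most `badPairs`.
      ∑-outside : (∑ P λ x₀ → ⟦ C x₀ ⟧ * outside x₀) * K ≤ c * c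
      ∑-outside = ≤-trans (*-monoˡ-≤ K (begin
        (∑ P λ x₀ → ⟦ C x₀ ⟧ * outside x₀) ≡⟨ ∑-cong P (λ x₀ → sym (∑-*ˡ P ⟦ C x₀ ⟧ _)) ⟩
        (∑ P λ x₀ → ∑ P λ y → ⟦ C x₀ ⟧ * (⟦ C y ⟧ * ⟦ not (V (y ⊕ x₀)) ⟧)) ≡⟨ ∑-swap P P _ ⟩
        (∑ P λ y → ∑ P λ x₀ → ⟦ C x₀ ⟧ * (⟦ C y ⟧ * ⟦ not (V (y ⊕ x₀)) ⟧)) ≤⟨ ∑-mono P (λ y → ∑-mono P (λ x₀ → ≤-trans (≤-reflexive (r ⟦ C x₀ ⟧ ⟦ C y ⟧ _)) (*-monoʳ-≤ (⟦ C y ⟧ * ⟦ C x₀ ⟧) (h y x₀)))) ⟩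
        badPairs ∎)) badPairs-few
        where
        open ≤-Reasoning
        r : ∀ a b c → a * (b * c) ≡ b * a * c
        r = solve-∀
        h : ∀ y x₀ → ⟦ not (V (y ⊕ x₀)) ⟧ ≤ ⟦ bad y x₀ ⟧
        h y x₀ with bad y x₀ in eq
        ... | true  = ⟦⟧≤1 _
        ... | false = ≤-reflexive (cong (λ b → ⟦ not b ⟧) (good-V y x₀ eq))

      -- Exchanging the sums turns the holes of all the cosets into the total escape of the elements
      -- of `V`, each of which is at most `4 * c / K`.
      ∑-missing : (∑ P λ x₀ → ⟦ C x₀ ⟧ * missing x₀) * K ≤ v * (4 * c)
      ∑-missing = begin
        (∑ P λ x₀ → ⟦ C x₀ ⟧ * missing x₀) * K ≡⟨ cong (_* K) (∑-cong P (λ x₀ → sym (∑-*ˡ P ⟦ C x₀ ⟧ _))) ⟩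
        (∑ P λ x₀ → ∑ P λ u → ⟦ C x₀ ⟧ * (⟦ V u ⟧ * ⟦ not (C (x₀ ⊕ u)) ⟧)) * K ≡⟨ cong (_* K) (∑-swap P P _) ⟩
        (∑ P λ u → ∑ P λ x₀ → ⟦ C x₀ ⟧ * (⟦ V u ⟧ * ⟦ not (C (x₀ ⊕ u)) ⟧)) * K ≡⟨ cong (_* K) (∑-cong P (λ u → trans (∑-cong P (λ x₀ → r ⟦ C x₀ ⟧ ⟦ V u ⟧ _)) (∑-*ˡ P ⟦ V u ⟧ _))) ⟩
        (∑ P λ u → ⟦ V u ⟧ * escape u) * K ≡⟨ sym (∑-*ʳ P K _) ⟩
        (∑ P λ u → ⟦ V u ⟧ * escape u * K) ≤⟨ ∑-mono P h ⟩
        (∑ P λ u → ⟦ V u ⟧ * (4 * c)) ≡⟨ ∑-*ʳ P (4 * c) _ ⟩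
        v * (4 * c) ∎
        where
        open ≤-Reasoning
        r : ∀ a b c → a * (b * c) ≡ b * (a * c)
        r = solve-∀
        h : ∀ u → ⟦ V u ⟧ * escape u * K ≤ ⟦ V u ⟧ * (4 * c)
        h u with V u in eq
        ... | false = z≤n
        ... | true  = ≤-trans (≤-reflexive (*-assoc 1 (escape u) K)) (*-monoʳ-≤ 1 (V-gap u eq))

      -- Averaging over centres in `C`. The two losses are normalised to `outside / c` and
      -- `missing / v`, whose averages are at most `1/K` and `4/K`; bounding their sum makes one
      -- centre good for both.
      centre : ∃ λ x₀ → (outside x₀ * v + missing x₀ * c) * K ≤ 5 * (c * v)
      centre = proj₁ w , h (C (proj₁ w)) (proj₂ w)
        where
        open ≤-Reasoning
        O = ∑ P λ x₀ → ⟦ C x₀ ⟧ * outside x₀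
        M = ∑ P λ x₀ → ⟦ C x₀ ⟧ * missing x₀
        r : ∀ a o v m c K → a * ((o * v + m * c) * K) ≡ a * o * (v * K) + a * m * (c * K)
        r = solve-∀
        r₂ : ∀ O v M c K → O * (v * K) + M * (c * K) ≡ O * K * v + M * K * c
        r₂ = solve-∀
        r₃ : ∀ c v → c * c * v + v * (4 * c) * c ≡ c * (5 * (c * v))
        r₃ = solve-∀
        -- The `+ 1` makes the comparison strict, as `∑-witness` requires; strictness at the witness
        -- then forces the witness to lie in `C`.
        lt : (∑ P λ x₀ → ⟦ C x₀ ⟧ * ((outside x₀ * v + missing x₀ * c) * K)) < (∑ P λ x₀ → ⟦ C x₀ ⟧ * (5 * (c * v) + 1))
        lt = begin-strict
          (∑ P λ x₀ → ⟦ C x₀ ⟧ * ((outside x₀ * v + missing x₀ * c) * K))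
            ≡⟨ ∑-cong P (λ x₀ → r ⟦ C x₀ ⟧ (outside x₀) v (missing x₀) c K) ⟩
          (∑ P λ x₀ → ⟦ C x₀ ⟧ * outside x₀ * (v * K) + ⟦ C x₀ ⟧ * missing x₀ * (c * K))
            ≡⟨ trans (∑-+ P _ _) (cong₂ _+_ (∑-*ʳ P (v * K) _) (∑-*ʳ P (c * K) _)) ⟩
          O * (v * K) + M * (c * K) ≡⟨ r₂ O v M c K ⟩
          O * K * v + M * K * c ≤⟨ +-mono-≤ (*-monoˡ-≤ v ∑-outside) (*-monoˡ-≤ c ∑-missing) ⟩
          c * c * v + v * (4 * c) * c ≡⟨ r₃ c v ⟩
          c * (5 * (c * v)) <⟨ *-monoʳ-< c ⦃ >-nonZero c>0 ⦄ (m<m+n (5 * (c * v)) (s≤s z≤n)) ⟩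
          c * (5 * (c * v) + 1) ≡⟨ sym (∑-*ʳ P (5 * (c * v) + 1) _) ⟩
          (∑ P λ x₀ → ⟦ C x₀ ⟧ * (5 * (c * v) + 1)) ∎
        w = ∑-witness P (λ x₀ → ⟦ C x₀ ⟧ * ((outside x₀ * v + missing x₀ * c) * K)) (λ x₀ → ⟦ C x₀ ⟧ * (5 * (c * v) + 1)) lt
        h : ∀ {a b} p → ⟦ p ⟧ * a < ⟦ p ⟧ * (b + 1) → a ≤ b
        h {a} {b} true lt = ≤-pred (≤-trans (s≤s (≤-reflexive (sym (*-identityˡ a)))) (≤-trans lt (≤-reflexive (trans (*-identityˡ _) (+-comm b 1)))))

      rigidity : ∃ λ T → ((∑ P λ x → ⟦ C x ⟧ * ⟦ not (mem T x) ⟧) * K ≤ 5 * c) × ((∑ P λ x → ⟦ mem T x ⟧ * ⟦ not (C x) ⟧) * K ≤ 10 * c)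
      rigidity = T , outside-few , missing-few
        where
        x₀ = proj₁ centre
        bound = proj₂ centre
        open ≤-Reasoning
        T : Cube n
        T = cosetCube V x₀
        memT : ∀ y → mem T y ≡ V (y ⊕ x₀)
        memT = mem-cosetCube V V-𝟎 V-⊕ V-⊓ x₀
        O = outside x₀
        M = missing x₀
        v>0 : 0 < v
        v>0 = ≤-trans (size>0 T) (≤-reflexive (trans (sym (size-count T)) (trans (∑-cong P (λ y → cong ⟦_⟧ (memT y))) (∑-shift x₀ (λ u → ⟦ V u ⟧)))))
        r₁ : ∀ o K v → o * K * v ≡ o * v * K
        r₁ = solve-∀
        r₂ : ∀ m K c → m * K * c ≡ m * c * K
        r₂ = solve-∀
        r₃ : ∀ c v → 5 * (c * v) ≡ 5 * v * c
        r₃ = solve-∀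
        OK : O * K ≤ 5 * c
        OK = pos-cancel v>0 (begin
          O * K * v ≡⟨ r₁ O K v ⟩
          O * v * K ≤⟨ *-monoˡ-≤ K (m≤m+n (O * v) (M * c)) ⟩
          (O * v + M * c) * K ≤⟨ bound ⟩
          5 * (c * v) ≡⟨ sym (*-assoc 5 c v) ⟩
          5 * c * v ∎)
        MK : M * K ≤ 5 * v
        MK = pos-cancel c>0 (begin
          M * K * c ≡⟨ r₂ M K c ⟩
          M * c * K ≤⟨ *-monoˡ-≤ K (m≤n+m (M * c) (O * v)) ⟩
          (O * v + M * c) * K ≤⟨ bound ⟩
          5 * (c * v) ≡⟨ r₃ c v ⟩
          5 * v * c ∎)
        T-missing : (∑ P λ x → ⟦ mem T x ⟧ * ⟦ not (C x) ⟧) ≡ M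
        T-missing = trans (∑-cong P (λ y → cong₂ (λ a b → ⟦ a ⟧ * ⟦ not (C b) ⟧) (memT y) (trans (sym (⊕-cancelˡ x₀ y)) (cong (x₀ ⊕_) (⊕-comm x₀ y)))))
                          (∑-shift x₀ (λ u → ⟦ V u ⟧ * ⟦ not (C (x₀ ⊕ u)) ⟧))
        v≤c+M : v ≤ c + M
        v≤c+M = begin
          v ≡⟨ sym (∑-shift x₀ (λ u → ⟦ V u ⟧)) ⟩
          (∑ P λ y → ⟦ V (y ⊕ x₀) ⟧) ≡⟨ ∑-cong P (λ y → cong ⟦_⟧ (sym (memT y))) ⟩
          (∑ P λ y → ⟦ mem T y ⟧) ≤⟨ ∑-mono P (λ y → h (mem T y) (C y)) ⟩
          (∑ P λ y → ⟦ C y ⟧ + ⟦ mem T y ⟧ * ⟦ not (C y) ⟧) ≡⟨ ∑-+ P _ _ ⟩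
          c + (∑ P λ y → ⟦ mem T y ⟧ * ⟦ not (C y) ⟧) ≡⟨ cong (c +_) T-missing ⟩
          c + M ∎
          where
          h : ∀ a b → ⟦ a ⟧ ≤ ⟦ b ⟧ + ⟦ a ⟧ * ⟦ not b ⟧
          h false b     = z≤n
          h true  true  = ≤-refl
          h true  false = ≤-refl
        -- Converts the loss relative to `v` into one relative to `c`: the coset has at most
        -- `5 * v / K` holes, less than half of its points.
        v≤2c : v ≤ 2 * c
        v≤2c = pos-cancel (≤-trans (s≤s z≤n) K≥64) (+-cancelʳ-≤ (v * K) _ _ (begin
          v * K + v * K ≡⟨ q₁ v K ⟩
          2 * (v * K) ≤⟨ *-monoʳ-≤ 2 (*-monoˡ-≤ K v≤c+M) ⟩
          2 * ((c + M) * K) ≡⟨ q₂ c M K ⟩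
          2 * c * K + 2 * (M * K) ≤⟨ +-monoʳ-≤ (2 * c * K) (*-monoʳ-≤ 2 MK) ⟩
          2 * c * K + 2 * (5 * v) ≡⟨ cong (2 * c * K +_) (q₃ v) ⟩
          2 * c * K + v * 10 ≤⟨ +-monoʳ-≤ (2 * c * K) (*-monoʳ-≤ v (≤-trans (m≤m+n 10 54) K≥64)) ⟩
          2 * c * K + v * K ∎))
          where
          q₁ : ∀ v K → v * K + v * K ≡ 2 * (v * K)
          q₁ = solve-∀
          q₂ : ∀ c M K → 2 * ((c + M) * K) ≡ 2 * c * K + 2 * (M * K)
          q₂ = solve-∀
          q₃ : ∀ v → 2 * (5 * v) ≡ v * 10
          q₃ = solve-∀
        outside-few : (∑ P λ x → ⟦ C x ⟧ * ⟦ not (mem T x) ⟧) * K ≤ 5 * c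
        outside-few = ≤-trans (≤-reflexive (cong (_* K) (∑-cong P (λ x → cong (λ b → ⟦ C x ⟧ * ⟦ not b ⟧) (memT x))))) OK
        missing-few : (∑ P λ x → ⟦ mem T x ⟧ * ⟦ not (C x) ⟧) * K ≤ 10 * c
        missing-few = begin
          (∑ P λ x → ⟦ mem T x ⟧ * ⟦ not (C x) ⟧) * K ≡⟨ cong (_* K) T-missing ⟩
          M * K ≤⟨ MK ⟩
          5 * v ≤⟨ *-monoʳ-≤ 5 v≤2c ⟩
          5 * (2 * c) ≡⟨ sym (*-assoc 5 2 c) ⟩
          10 * c ∎

  -- The tester and its acceptance probability

  anyᵇ : {X : Set} → (X → Bool) → List X → Bool
  anyᵇ p []       = false
  anyᵇ p (x ∷ xs) = p x ∨ anyᵇ p xs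

  listsUpTo : {X : Set} → List X → ℕ → List (List X)
  listsUpTo L zero    = [] ∷ []
  listsUpTo L (suc s) = [] ∷ map (λ p → proj₁ p ∷ proj₂ p) (L ⊗ listsUpTo L s)

  -- Seeds and trials share one sample space, so the same counting lemmas serve both phases.
  Draw : ℕ → Set
  Draw n = Point n × Point n × Point n × Point n

  Ω : ∀ {n} → BoolFun n → List (Draw n)
  Ω {n} f = ones f ⊗ ones f ⊗ ones f ⊗ allPoints n

  coins : ∀ {n} k → (Vec Bool k → Alg n) → Alg n
  coins zero    K = K []
  coins (suc k) K = coin λ b → coins k λ v → K (b ∷ v)

  draw : ∀ {n} → (Draw n → Alg n) → Alg n
  draw {n} K = samp λ x → samp λ y → samp λ y′ → coins n λ R → K (x , y , y′ , R)

  draws : ∀ {n} k → (Vec (Draw n) k → Alg n) → Alg n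
  draws zero    K = K []
  draws (suc k) K = draw λ ω → draws k λ v → K (ω ∷ v)

  ask : ∀ {n k} → Vec (Point n) k → (Vec Bool k → Alg n) → Alg n
  ask []       K = K []
  ask (p ∷ ps) K = mq p λ b → ask ps λ bs → K (b ∷ bs)

  probe : ∀ {n M} → Vec (Draw n) M → Point n → Vec (Point n) (suc M)
  probe 𝒬 w = w ∷ Vec.map (λ (x , y , _ , R) → splice x y w R) 𝒬

  Obs : ℕ → Set
  Obs M = Vec Bool (suc M)

  Trial : ℕ → Set
  Trial M = Obs M × Obs M × Obs M × Obs M

  askTrial : ∀ {n M} → Vec (Draw n) M → Draw n → (Trial M → Alg n) → Alg n
  askTrial 𝒬 (x , y , y′ , R) K =
    ask (probe 𝒬 x) λ o₁ → ask (probe 𝒬 y) λ o₂ → ask (probe 𝒬 y′) λ o₃ → ask (probe 𝒬 (splice x y y′ R)) λ o₄ →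
    K (o₁ , o₂ , o₃ , o₄)

  askTrials : ∀ {n M k} → Vec (Draw n) M → Vec (Draw n) k → (Vec (Trial M) k → Alg n) → Alg n
  askTrials 𝒬 []       K = K []
  askTrials 𝒬 (ω ∷ ωs) K = askTrial 𝒬 ω λ t → askTrials 𝒬 ωs λ ts → K (t ∷ ts)

  misses : ∀ {M} → Vec Bool M → Vec Bool M → ℕ
  misses []       []       = 0
  misses (θ ∷ Θ) (b ∷ bs) = ⟦ θ ∧ not b ⟧ + misses Θ bs

  passes : ∀ {M} → ℕ → Vec Bool M → Vec Bool M → Bool
  passes K₀ Θ bs = misses Θ bs ≤ᵇ K₀

  -- Bit 0 of an observation of w is f w, the others are the values of f on the splices of w with the seeds.
  label : ∀ {M} → ℕ → Vec Bool M → Obs M → Bool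
  label K₀ Θ (b ∷ bs) = b ∧ passes K₀ Θ bs

  badTrial : ∀ {M} → ℕ → List (Vec Bool M) → Trial M → Bool
  badTrial K₀ H (o₁ , o₂ , o₃ , o₄) =
    not (anyᵇ (λ Θ → label K₀ Θ o₁) H)
    ∨ anyᵇ (λ Θ → label K₀ Θ o₁ ∧ label K₀ Θ o₂ ∧ label K₀ Θ o₃ ∧ not (label K₀ Θ o₄)) H

  -- The search over hypotheses reads recorded answers only. Its size affects the number of trials
  -- through the union bound but adds no queries of its own.
  decide : ∀ {M N} → (s K₀ k₁ : ℕ) → Vec (Trial M) N → Bool
  decide {M} s K₀ k₁ ts = anyᵇ (λ H → hits (badTrial K₀ H) 𝟏 ts ≤ᵇ k₁) (listsUpTo (allPoints M) s)

  verdict : ∀ {n} → Bool → Alg n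
  verdict true  = accept
  verdict false = reject

  tester : ∀ n (M N s K₀ k₁ : ℕ) → Alg n
  tester n M N s K₀ k₁ = draws M λ 𝒬 → draws N λ ωs → askTrials 𝒬 ωs λ ts → verdict (decide s K₀ k₁ ts)

  -- Query count

  coins-queries : ∀ {n q} k {K : Vec Bool k → Alg n} → (∀ v → QueriesAtMost (K v) q) → QueriesAtMost (coins k K) q
  coins-queries zero    h = h []
  coins-queries (suc k) h = coin≤ λ b → coins-queries k λ v → h (b ∷ v)

  -- A draw costs its three samples; the `n` coin tosses for the mask are free, which is why `n`
  -- drops out of the bound.
  draws-queries : ∀ {n q} k {K : Vec (Draw n) k → Alg n} → (∀ v → QueriesAtMost (K v) q) → QueriesAtMost (draws k K) (k * 3 + q)
  draws-queries         zero    h = h []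
  draws-queries {n = n} (suc k) h = samp≤ λ x → samp≤ λ y → samp≤ λ y′ → coins-queries n λ R → draws-queries k λ v → h ((x , y , y′ , R) ∷ v)

  ask-queries : ∀ {n k q} (ps : Vec (Point n) k) {K : Vec Bool k → Alg n} → (∀ v → QueriesAtMost (K v) q) → QueriesAtMost (ask ps K) (k + q)
  ask-queries []       h = h []
  ask-queries (p ∷ ps) h = mq≤ λ b → ask-queries ps λ v → h (b ∷ v)

  askTrials-queries : ∀ {n M k q} (𝒬 : Vec (Draw n) M) (ωs : Vec (Draw n) k) {K : Vec (Trial M) k → Alg n} →
                      (∀ v → QueriesAtMost (K v) q) → QueriesAtMost (askTrials 𝒬 ωs K) (k * (4 * suc M) + q)
  askTrials-queries 𝒬 [] h = h []
  askTrials-queries {M = M} {suc k} {q} 𝒬 ((x , y , y′ , R) ∷ ωs) {K} h =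
    subst (QueriesAtMost (askTrials 𝒬 ((x , y , y′ , R) ∷ ωs) K)) (r (suc M) (k * (4 * suc M)) q)
      (ask-queries (probe 𝒬 x) λ o₁ → ask-queries (probe 𝒬 y) λ o₂ → ask-queries (probe 𝒬 y′) λ o₃ →
       ask-queries (probe 𝒬 (splice x y y′ R)) λ o₄ → askTrials-queries 𝒬 ωs λ v → h ((o₁ , o₂ , o₃ , o₄) ∷ v))
    where
    r : ∀ m a q → m + (m + (m + (m + (a + q)))) ≡ 4 * m + a + q
    r = solve-∀

  tester-queries : ∀ n M N s K₀ k₁ → QueriesAtMost (tester n M N s K₀ k₁) (M * 3 + (N * 3 + (N * (4 * suc M) + 0)))
  tester-queries n M N s K₀ k₁ = draws-queries M λ 𝒬 → draws-queries N λ ωs → askTrials-queries 𝒬 ωs λ ts → h (decide s K₀ k₁ ts)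
    where
    h : ∀ b → QueriesAtMost (verdict b) 0
    h true  = acc≤
    h false = rej≤

  -- Acceptance probabilities as ratios of counts

  toℚᵘ-/ : ∀ m d .{{_ : NonZero d}} → ℚ.toℚᵘ ((ℤ.+ m) ℚ./ d) ℚᵘ.≃ ((ℤ.+ m) ℚᵘ./ d)
  toℚᵘ-/ m (suc d) = ℚₚ.toℚᵘ-fromℚᵘ (ℚᵘ.mkℚᵘ (ℤ.+ m) d)

  ℕtoℚ-+ : ∀ a b → ℕtoℚ (a + b) ≡ ℕtoℚ a ℚ.+ ℕtoℚ b
  ℕtoℚ-+ a b = ℚₚ.toℚᵘ-injective (begin
    ℚ.toℚᵘ (ℕtoℚ (a + b))                      ≈⟨ toℚᵘ-/ (a + b) 1 ⟩
    (ℤ.+ (a + b)) ℚᵘ./ 1                       ≈⟨ ℚᵘ.*≡* (trans (ℤₚ.*-identityʳ (ℤ.+ (a + b))) (sym (trans (ℤₚ.*-identityʳ _) (cong₂ ℤ._+_ (ℤₚ.*-identityʳ (ℤ.+ a)) (ℤₚ.*-identityʳ (ℤ.+ b)))))) ⟩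
    (ℤ.+ a) ℚᵘ./ 1 ℚᵘ.+ (ℤ.+ b) ℚᵘ./ 1         ≈⟨ ℚᵘₚ.+-cong (ℚᵘₚ.≃-sym (toℚᵘ-/ a 1)) (ℚᵘₚ.≃-sym (toℚᵘ-/ b 1)) ⟩
    ℚ.toℚᵘ (ℕtoℚ a) ℚᵘ.+ ℚ.toℚᵘ (ℕtoℚ b)       ≈⟨ ℚᵘₚ.≃-sym (ℚₚ.toℚᵘ-homo-+ (ℕtoℚ a) (ℕtoℚ b)) ⟩
    ℚ.toℚᵘ (ℕtoℚ a ℚ.+ ℕtoℚ b) ∎)
    where
    open import Relation.Binary.Reasoning.Setoid ℚᵘₚ.≃-setoid

  ℕtoℚ-* : ∀ a b → ℕtoℚ (a * b) ≡ ℕtoℚ a ℚ.* ℕtoℚ b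
  ℕtoℚ-* a b = ℚₚ.toℚᵘ-injective (begin
    ℚ.toℚᵘ (ℕtoℚ (a * b))                      ≈⟨ toℚᵘ-/ (a * b) 1 ⟩
    (ℤ.+ (a * b)) ℚᵘ./ 1                       ≈⟨ ℚᵘ.*≡* (cong (ℤ._* ℤ.+ 1) (ℤₚ.pos-* a b)) ⟩
    ((ℤ.+ a) ℚᵘ./ 1) ℚᵘ.* ((ℤ.+ b) ℚᵘ./ 1)         ≈⟨ ℚᵘₚ.*-cong (ℚᵘₚ.≃-sym (toℚᵘ-/ a 1)) (ℚᵘₚ.≃-sym (toℚᵘ-/ b 1)) ⟩
    ℚ.toℚᵘ (ℕtoℚ a) ℚᵘ.* ℚ.toℚᵘ (ℕtoℚ b)       ≈⟨ ℚᵘₚ.≃-sym (ℚₚ.toℚᵘ-homo-* (ℕtoℚ a) (ℕtoℚ b)) ⟩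
    ℚ.toℚᵘ (ℕtoℚ a ℚ.* ℕtoℚ b) ∎)
    where open import Relation.Binary.Reasoning.Setoid ℚᵘₚ.≃-setoid

  /-*-cancel : ∀ m d .{{_ : NonZero d}} → ((ℤ.+ m) ℚ./ d) ℚ.* ℕtoℚ d ≡ ℕtoℚ m
  /-*-cancel m (suc d) = ℚₚ.toℚᵘ-injective (begin
    ℚ.toℚᵘ (((ℤ.+ m) ℚ./ suc d) ℚ.* ℕtoℚ (suc d))          ≈⟨ ℚₚ.toℚᵘ-homo-* ((ℤ.+ m) ℚ./ suc d) (ℕtoℚ (suc d)) ⟩
    ℚ.toℚᵘ ((ℤ.+ m) ℚ./ suc d) ℚᵘ.* ℚ.toℚᵘ (ℕtoℚ (suc d))  ≈⟨ ℚᵘₚ.*-cong (toℚᵘ-/ m (suc d)) (toℚᵘ-/ (suc d) 1) ⟩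
    ((ℤ.+ m) ℚᵘ./ suc d) ℚᵘ.* ((ℤ.+ suc d) ℚᵘ./ 1)             ≈⟨ ℚᵘ.*≡* (trans (ℤₚ.*-identityʳ _) (sym (cong₂ ℤ._*_ (ℤₚ.*-identityʳ (ℤ.+ m)) (cong ℤ.+_ (*-identityʳ (suc d)))))) ⟩
    ((ℤ.+ m) ℚᵘ./ 1) ℚᵘ.* ℚᵘ.1ℚᵘ                           ≈⟨ ℚᵘₚ.*-identityʳ _ ⟩
    (ℤ.+ m) ℚᵘ./ 1                                         ≈⟨ ℚᵘₚ.≃-sym (toℚᵘ-/ m 1) ⟩
    ℚ.toℚᵘ (ℕtoℚ m) ∎)
    where open import Relation.Binary.Reasoning.Setoid ℚᵘₚ.≃-setoid

  -- The acceptance probability is `g / Z` with `Z` the size of the sample space and `g` the number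
  -- of accepting outcomes. The ratio is left unreduced and cleared of its denominator, so that
  -- consecutive random choices just multiply `Z` and sum `g`.
  record Value {n} (f : BoolFun n) (A : Alg n) (g Z : ℕ) : Set where
    constructor value
    field fraction : accProb f A ℚ.* ℕtoℚ Z ≡ ℕtoℚ g
  open Value

  samp-value : ∀ {n} {f : BoolFun n} {k : Point n → Alg n} {g : Point n → ℕ} {Z} →
               (∀ y → Value f (k y) (g y) Z) → Value f (samp k) (∑ (ones f) g) (count1 f * Z)
  samp-value {f = f} {k} {g} {Z} h = value (avg (ones f))
    where
    open ≡-Reasoning
    sums : ∀ L → sumOver f k L ℚ.* ℕtoℚ Z ≡ ℕtoℚ (∑ L g)
    sums []      = ℚₚ.*-zeroˡ (ℕtoℚ Z)
    sums (y ∷ L) = begin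
      (accProb f (k y) ℚ.+ sumOver f k L) ℚ.* ℕtoℚ Z ≡⟨ ℚₚ.*-distribʳ-+ (ℕtoℚ Z) (accProb f (k y)) (sumOver f k L) ⟩
      accProb f (k y) ℚ.* ℕtoℚ Z ℚ.+ sumOver f k L ℚ.* ℕtoℚ Z ≡⟨ cong₂ ℚ._+_ (fraction (h y)) (sums L) ⟩
      ℕtoℚ (g y) ℚ.+ ℕtoℚ (∑ L g) ≡⟨ sym (ℕtoℚ-+ (g y) (∑ L g)) ⟩
      ℕtoℚ (g y + ∑ L g) ∎
    avg : ∀ L → avgOver f k L ℚ.* ℕtoℚ (length L * Z) ≡ ℕtoℚ (∑ L g)
    avg []      = refl
    avg (y ∷ L) = begin
      (i ℚ.* S) ℚ.* ℕtoℚ (l * Z) ≡⟨ cong ((i ℚ.* S) ℚ.*_) (ℕtoℚ-* l Z) ⟩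
      (i ℚ.* S) ℚ.* (ℕtoℚ l ℚ.* ℕtoℚ Z) ≡⟨ swap4 i S (ℕtoℚ l) (ℕtoℚ Z) ⟩
      (i ℚ.* ℕtoℚ l) ℚ.* (S ℚ.* ℕtoℚ Z) ≡⟨ cong₂ ℚ._*_ (/-*-cancel 1 l) (sums (y ∷ L)) ⟩
      ℚ.1ℚ ℚ.* ℕtoℚ (∑ (y ∷ L) g) ≡⟨ ℚₚ.*-identityˡ _ ⟩
      ℕtoℚ (∑ (y ∷ L) g) ∎
      where
      l = suc (length L)
      i = (ℤ.+ 1) ℚ./ l
      S = sumOver f k (y ∷ L)
      swap4 : ∀ a b c d → (a ℚ.* b) ℚ.* (c ℚ.* d) ≡ (a ℚ.* c) ℚ.* (b ℚ.* d)
      swap4 a b c d = begin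
        (a ℚ.* b) ℚ.* (c ℚ.* d) ≡⟨ ℚₚ.*-assoc a b (c ℚ.* d) ⟩
        a ℚ.* (b ℚ.* (c ℚ.* d)) ≡⟨ cong (a ℚ.*_) (sym (ℚₚ.*-assoc b c d)) ⟩
        a ℚ.* ((b ℚ.* c) ℚ.* d) ≡⟨ cong (λ z → a ℚ.* (z ℚ.* d)) (ℚₚ.*-comm b c) ⟩
        a ℚ.* ((c ℚ.* b) ℚ.* d) ≡⟨ cong (a ℚ.*_) (ℚₚ.*-assoc c b d) ⟩
        a ℚ.* (c ℚ.* (b ℚ.* d)) ≡⟨ sym (ℚₚ.*-assoc a c (b ℚ.* d)) ⟩
        (a ℚ.* c) ℚ.* (b ℚ.* d) ∎

  coin-value : ∀ {n} {f : BoolFun n} {k : Bool → Alg n} {g₁ g₂ Z} →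
               Value f (k true) g₁ Z → Value f (k false) g₂ Z → Value f (coin k) (g₁ + g₂) (2 * Z)
  coin-value {f = f} {k} {g₁} {g₂} {Z} (value h₁) (value h₂) = value (begin
    (ℚ.½ ℚ.* (p ℚ.+ q)) ℚ.* ℕtoℚ (2 * Z) ≡⟨ cong₂ ℚ._*_ (ℚₚ.*-comm ℚ.½ (p ℚ.+ q)) (ℕtoℚ-* 2 Z) ⟩
    ((p ℚ.+ q) ℚ.* ℚ.½) ℚ.* (ℕtoℚ 2 ℚ.* ℕtoℚ Z) ≡⟨ ℚₚ.*-assoc (p ℚ.+ q) ℚ.½ _ ⟩
    (p ℚ.+ q) ℚ.* (ℚ.½ ℚ.* (ℕtoℚ 2 ℚ.* ℕtoℚ Z)) ≡⟨ cong ((p ℚ.+ q) ℚ.*_) (sym (ℚₚ.*-assoc ℚ.½ (ℕtoℚ 2) (ℕtoℚ Z))) ⟩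
    (p ℚ.+ q) ℚ.* (ℚ.1ℚ ℚ.* ℕtoℚ Z) ≡⟨ cong ((p ℚ.+ q) ℚ.*_) (ℚₚ.*-identityˡ (ℕtoℚ Z)) ⟩
    (p ℚ.+ q) ℚ.* ℕtoℚ Z ≡⟨ ℚₚ.*-distribʳ-+ (ℕtoℚ Z) p q ⟩
    p ℚ.* ℕtoℚ Z ℚ.+ q ℚ.* ℕtoℚ Z ≡⟨ cong₂ ℚ._+_ h₁ h₂ ⟩
    ℕtoℚ g₁ ℚ.+ ℕtoℚ g₂ ≡⟨ sym (ℕtoℚ-+ g₁ g₂) ⟩
    ℕtoℚ (g₁ + g₂) ∎)
    where
    open ≡-Reasoning
    p = accProb f (k true)
    q = accProb f (k false)

  coins-value : ∀ {n} {f : BoolFun n} k {K : Vec Bool k → Alg n} {g : Vec Bool k → ℕ} {Z} →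
                (∀ v → Value f (K v) (g v) Z) → Value f (coins k K) (∑ (allPoints k) g) (2 ^ k * Z)
  coins-value {f = f} zero {K} {g} {Z} h = subst₂ (Value f (K [])) (sym (+-identityʳ (g []))) (sym (+-identityʳ Z)) (h [])
  coins-value {f = f} (suc k) {K} {g} {Z} h =
    subst₂ (Value f (coins (suc k) K)) (sym (∑-points k g)) (sym (*-assoc 2 (2 ^ k) Z))
      (coin-value (coins-value k λ v → h (true ∷ v)) (coins-value k λ v → h (false ∷ v)))

  ∑-Ω : ∀ {n} (f : BoolFun n) (φ : Draw n → ℕ) →
        ∑ (Ω f) φ ≡ ∑ (ones f) λ x → ∑ (ones f) λ y → ∑ (ones f) λ y′ → ∑ (allPoints n) λ R → φ (x , y , y′ , R)
  ∑-Ω f φ = trans (∑-⊗ (ones f) _ φ) (∑-cong (ones f) λ x → trans (∑-⊗ (ones f) _ _) (∑-cong (ones f) λ y → ∑-⊗ (ones f) _ _))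

  length-Ω : ∀ {n} (f : BoolFun n) → length (Ω f) ≡ count1 f * (count1 f * (count1 f * 2 ^ n))
  length-Ω {n} f = trans (length-⊗ (ones f) _) (cong (count1 f *_) (trans (length-⊗ (ones f) _) (cong (count1 f *_)
                   (trans (length-⊗ (ones f) _) (cong (count1 f *_) (length-points n))))))

  draw-value : ∀ {n} {f : BoolFun n} {K : Draw n → Alg n} {g : Draw n → ℕ} {Z} →
               (∀ ω → Value f (K ω) (g ω) Z) → Value f (draw K) (∑ (Ω f) g) (length (Ω f) * Z)
  draw-value {n} {f} {K} {g} {Z} h =
    subst₂ (Value f (draw K)) (sym (∑-Ω f g)) (trans (r (count1 f) (2 ^ n) Z) (cong (_* Z) (sym (length-Ω f))))
      (samp-value λ x → samp-value λ y → samp-value λ y′ → coins-value n λ R → h (x , y , y′ , R))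
    where
    r : ∀ a p Z → a * (a * (a * (p * Z))) ≡ a * (a * (a * p)) * Z
    r = solve-∀

  draws-value : ∀ {n} {f : BoolFun n} k {K : Vec (Draw n) k → Alg n} {g : Vec (Draw n) k → ℕ} {Z} →
                (∀ v → Value f (K v) (g v) Z) → Value f (draws k K) (∑ (vecs (Ω f) k) g) (length (Ω f) ^ k * Z)
  draws-value {f = f} zero {K} {g} {Z} h = subst₂ (Value f (K [])) (sym (+-identityʳ (g []))) (sym (+-identityʳ Z)) (h [])
  draws-value {f = f} (suc k) {K} {g} {Z} h =
    subst₂ (Value f (draws (suc k) K)) (sym (∑-vecs (Ω f) k g)) (sym (*-assoc (length (Ω f)) _ Z))
      (draw-value λ ω → draws-value k λ v → h (ω ∷ v))

  observe : ∀ {n M} → BoolFun n → Vec (Draw n) M → Point n → Obs M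
  observe f 𝒬 w = Vec.map f (probe 𝒬 w)

  outcome : ∀ {n M} → BoolFun n → Vec (Draw n) M → Draw n → Trial M
  outcome f 𝒬 (x , y , y′ , R) = observe f 𝒬 x , observe f 𝒬 y , observe f 𝒬 y′ , observe f 𝒬 (splice x y y′ R)

  accProb-ask : ∀ {n k} (f : BoolFun n) (ps : Vec (Point n) k) (K : Vec Bool k → Alg n) →
                accProb f (ask ps K) ≡ accProb f (K (Vec.map f ps))
  accProb-ask f []       K = refl
  accProb-ask f (p ∷ ps) K = accProb-ask f ps (λ bs → K (f p ∷ bs))

  accProb-askTrials : ∀ {n M k} (f : BoolFun n) (𝒬 : Vec (Draw n) M) (ωs : Vec (Draw n) k) (K : Vec (Trial M) k → Alg n) →
                      accProb f (askTrials 𝒬 ωs K) ≡ accProb f (K (Vec.map (outcome f 𝒬) ωs))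
  accProb-askTrials f 𝒬 []                     K = refl
  accProb-askTrials f 𝒬 (ω@(x , y , y′ , R) ∷ ωs) K =
    trans (accProb-ask f (probe 𝒬 x) K₁) (trans (accProb-ask f (probe 𝒬 y) (K₂ _)) (trans (accProb-ask f (probe 𝒬 y′) (K₃ _ _))
    (trans (accProb-ask f (probe 𝒬 z) (K₄ _ _ _)) (accProb-askTrials f 𝒬 ωs (λ ts → K (outcome f 𝒬 ω ∷ ts))))))
    where
    z = splice x y y′ R
    K₄ = λ o₁ o₂ o₃ o₄ → askTrials 𝒬 ωs λ ts → K ((o₁ , o₂ , o₃ , o₄) ∷ ts)
    K₃ = λ o₁ o₂ o₃ → ask (probe 𝒬 z) (K₄ o₁ o₂ o₃)
    K₂ = λ o₁ o₂ → ask (probe 𝒬 y′) (K₃ o₁ o₂)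
    K₁ = λ o₁ → ask (probe 𝒬 y) (K₂ o₁)

  hits-map : ∀ {X Y : Set} {k} (ξ : Y → Bool) (g : X → Y) (bs : Vec Bool k) (v : Vec X k) →
             hits ξ bs (Vec.map g v) ≡ hits (λ x → ξ (g x)) bs v
  hits-map ξ g []       []      = refl
  hits-map ξ g (b ∷ bs) (x ∷ v) = cong (⟦ b ∧ ξ (g x) ⟧ +_) (hits-map ξ g bs v)

  badDraw : ∀ {n M} → BoolFun n → ℕ → Vec (Draw n) M → List (Vec Bool M) → Draw n → Bool
  badDraw f K₀ 𝒬 H ω = badTrial K₀ H (outcome f 𝒬 ω)

  verdictOn : ∀ {n M N} → BoolFun n → (s K₀ k₁ : ℕ) → Vec (Draw n) M → Vec (Draw n) N → Bool
  verdictOn {M = M} f s K₀ k₁ 𝒬 ωs = anyᵇ (λ H → hits (badDraw f K₀ 𝒬 H) 𝟏 ωs ≤ᵇ k₁) (listsUpTo (allPoints M) s)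

  anyᵇ-cong : {X : Set} {p q : X → Bool} → (∀ x → p x ≡ q x) → (L : List X) → anyᵇ p L ≡ anyᵇ q L
  anyᵇ-cong e []      = refl
  anyᵇ-cong e (x ∷ L) = cong₂ _∨_ (e x) (anyᵇ-cong e L)

  tester-value : ∀ {n} (f : BoolFun n) M N s K₀ k₁ →
    Value f (tester n M N s K₀ k₁) (∑ (vecs (Ω f) M) λ 𝒬 → ∑ (vecs (Ω f) N) λ ωs → ⟦ verdictOn f s K₀ k₁ 𝒬 ωs ⟧)
          (length (Ω f) ^ M * (length (Ω f) ^ N * 1))
  tester-value {n} f M N s K₀ k₁ = draws-value M λ 𝒬 → draws-value N λ ωs → value (trans (cong (ℚ._* ℕtoℚ 1) (simplify 𝒬 ωs)) (h (verdictOn f s K₀ k₁ 𝒬 ωs)))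
    where
    simplify : (𝒬 : Vec (Draw n) M) (ωs : Vec (Draw n) N) →
               accProb f (askTrials 𝒬 ωs λ ts → verdict (decide s K₀ k₁ ts)) ≡ accProb f (verdict (verdictOn f s K₀ k₁ 𝒬 ωs))
    simplify 𝒬 ωs = trans (accProb-askTrials f 𝒬 ωs _) (cong (λ b → accProb f (verdict b))
      (anyᵇ-cong (λ H → cong (_≤ᵇ k₁) (hits-map (badTrial K₀ H) (outcome f 𝒬) 𝟏 ωs)) (listsUpTo (allPoints M) s)))
    h : ∀ b → accProb f (verdict b) ℚ.* ℕtoℚ 1 ≡ ℕtoℚ ⟦ b ⟧
    h true  = refl
    h false = refl

  -- Soundness

  ∑-ones : ∀ {n} (f : BoolFun n) φ → ∑ (ones f) φ ≡ ∑ (allPoints n) λ x → ⟦ f x ⟧ * φ x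
  ∑-ones {n} f φ = ∑-filter f (allPoints n) φ

  count1-∑ : ∀ {n} (f : BoolFun n) → count1 f ≡ ∑ (allPoints n) λ x → ⟦ f x ⟧
  count1-∑ {n} f = trans (length-∑ (ones f)) (trans (∑-ones f (λ _ → 1)) (∑-cong (allPoints n) λ x → *-identityʳ ⟦ f x ⟧))

  union : ∀ {n} → List (Cube n) → Point n → Bool
  union Ts x = anyᵇ (λ T → mem T x) Ts

  evalDNF-cubes : ∀ {n} (Ts : List (Cube n)) x → evalDNF (map cubeTerm Ts) x ≡ union Ts x
  evalDNF-cubes []       x = refl
  evalDNF-cubes (T ∷ Ts) x = cong₂ _∨_ (evalTerm-cubeTerm T x) (evalDNF-cubes Ts x)

  Ω-nonempty : ∀ {n} (f : BoolFun n) → 0 < count1 f → 0 < length (Ω f)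
  Ω-nonempty {n} f a>0 = subst (0 <_) (sym (length-Ω f)) (*-mono-≤ a>0 (*-mono-≤ a>0 (*-mono-≤ a>0 (m^n>0 2 n))))

  ∑-Ω-first : ∀ {n} (f : BoolFun n) (φ : Point n → ℕ) →
              ∑ (Ω f) (λ ω → φ (proj₁ ω)) ≡ ∑ (ones f) φ * (count1 f * (count1 f * 2 ^ n))
  ∑-Ω-first {n} f φ = begin
    ∑ (Ω f) (λ ω → φ (proj₁ ω))
      ≡⟨ ∑-Ω f _ ⟩
    (∑ (ones f) λ x → ∑ (ones f) λ y → ∑ (ones f) λ y′ → ∑ (allPoints n) λ R → φ x)
      ≡⟨ ∑-cong (ones f) (λ x → trans (∑-const (ones f) _) (cong (count1 f *_) (trans (∑-const (ones f) _) (cong (count1 f *_) (trans (∑-const (allPoints n) _) (cong (_* φ x) (length-points n))))))) ⟩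
    (∑ (ones f) λ x → count1 f * (count1 f * (2 ^ n * φ x)))
      ≡⟨ ∑-cong (ones f) (λ x → r (count1 f) (2 ^ n) (φ x)) ⟩
    (∑ (ones f) λ x → φ x * (count1 f * (count1 f * 2 ^ n)))
      ≡⟨ ∑-*ʳ (ones f) _ φ ⟩
    ∑ (ones f) φ * (count1 f * (count1 f * 2 ^ n)) ∎
    where
    open ≡-Reasoning
    r : ∀ a p z → a * (a * (p * z)) ≡ z * (a * (a * p))
    r = solve-∀

  -- Label classes lie inside `f`, so restricting positive samples to a class is the same as summing
  -- over the class. This connects the samples with `Rigidity`, where `f` does not occur.
  ∑-Ω-supported : ∀ {n} (f C : Point n → Bool) → (∀ x → C x ≡ true → f x ≡ true) → (ψ : Draw n → ℕ) →
    ∑ (Ω f) (λ ω → ⟦ C (proj₁ ω) ⟧ * (⟦ C (proj₁ (proj₂ ω)) ⟧ * (⟦ C (proj₁ (proj₂ (proj₂ ω))) ⟧ * ψ ω)))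
    ≡ ∑ (allPoints n) λ x → ⟦ C x ⟧ * ∑ (allPoints n) λ y → ⟦ C y ⟧ * ∑ (allPoints n) λ y′ → ⟦ C y′ ⟧ * ∑ (allPoints n) λ R → ψ (x , y , y′ , R)
  ∑-Ω-supported {n} f C sub ψ =
    trans (∑-Ω f _)
    (trans (∑-cong (ones f) λ x → ∑-cong (ones f) λ y → ∑-cong (ones f) λ y′ → trans (∑-*ˡ P ⟦ C x ⟧ _) (cong (⟦ C x ⟧ *_) (trans (∑-*ˡ P ⟦ C y ⟧ _) (cong (⟦ C y ⟧ *_) (∑-*ˡ P ⟦ C y′ ⟧ _)))))
    (trans (∑-cong (ones f) λ x → ∑-cong (ones f) λ y → trans (∑-*ˡ (ones f) ⟦ C x ⟧ _) (cong (⟦ C x ⟧ *_) (trans (∑-*ˡ (ones f) ⟦ C y ⟧ _) (cong (⟦ C y ⟧ *_) (supp _)))))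
    (trans (∑-cong (ones f) λ x → trans (∑-*ˡ (ones f) ⟦ C x ⟧ _) (cong (⟦ C x ⟧ *_) (supp _)))
    (supp _))))
    where
    P = allPoints n
    h : ∀ x (z : ℕ) → ⟦ f x ⟧ * (⟦ C x ⟧ * z) ≡ ⟦ C x ⟧ * z
    h x z with C x in eq
    ... | false = *-zeroʳ ⟦ f x ⟧
    ... | true  = trans (cong (λ b → ⟦ b ⟧ * (1 * z)) (sub x eq)) (*-identityˡ (1 * z))
    supp : (φ : Point n → ℕ) → ∑ (ones f) (λ x → ⟦ C x ⟧ * φ x) ≡ ∑ P (λ x → ⟦ C x ⟧ * φ x)
    supp φ = trans (∑-ones f _) (∑-cong P λ x → h x (φ x))

  module Sound {n M : ℕ} (f : BoolFun n) (K₀ : ℕ) (𝒬 : Vec (Draw n) M)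
               (e₁ r K D : ℕ) (r>0 : 0 < r) (e₁≤r : e₁ ≤ r) (10e₁≤K : 10 * e₁ ≤ K) (64≤K : 64 ≤ K)
               (rK≤D : r * r * r * (K * K) ≤ D) (a>0 : 0 < count1 f) where
    P = allPoints n
    a = count1 f

    C : Vec Bool M → Point n → Bool
    C Θ w = label K₀ Θ (observe f 𝒬 w)

    C⊆f : ∀ Θ x → C Θ x ≡ true → f x ≡ true
    C⊆f Θ x e = proj₁ (∧-true e)

    violation : Vec Bool M → Draw n → Bool
    violation Θ (x , y , y′ , R) = C Θ x ∧ C Θ y ∧ C Θ y′ ∧ not (C Θ (splice x y y′ R))

    -- For fixed `y` and `y′` the sums over `x` and `R` form `total (y ⊕ y′)`; the work lies in
    -- moving `y` and `y′` outwards.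
    violations-∑ : ∀ Θ → ∑ (Ω f) (λ ω → ⟦ violation Θ ω ⟧) ≡ Rigidity.violations (C Θ)
    violations-∑ Θ = begin
      ∑ (Ω f) (λ ω → ⟦ violation Θ ω ⟧)
        ≡⟨ ∑-cong (Ω f) (λ (x , y , y′ , R) → trans (⟦∧⟧ (C Θ x) _) (cong (⟦ C Θ x ⟧ *_) (trans (⟦∧⟧ (C Θ y) _) (cong (⟦ C Θ y ⟧ *_) (⟦∧⟧ (C Θ y′) _))))) ⟩
      ∑ (Ω f) (λ ω → ⟦ C Θ (proj₁ ω) ⟧ * (⟦ C Θ (proj₁ (proj₂ ω)) ⟧ * (⟦ C Θ (proj₁ (proj₂ (proj₂ ω))) ⟧ * esc ω)))
        ≡⟨ ∑-Ω-supported f (C Θ) (C⊆f Θ) esc ⟩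
      (∑ P λ x → ⟦ C Θ x ⟧ * ∑ P λ y → ⟦ C Θ y ⟧ * ∑ P λ y′ → ⟦ C Θ y′ ⟧ * ∑ P λ R → esc (x , y , y′ , R))
        ≡⟨ pull (λ x → ⟦ C Θ x ⟧) (λ x y y′ → ∑ P λ R → esc (x , y , y′ , R)) ⟩
      (∑ P λ x → ∑ P λ y → ∑ P λ y′ → ⟦ C Θ y ⟧ * ⟦ C Θ y′ ⟧ * (⟦ C Θ x ⟧ * ∑ P λ R → esc (x , y , y′ , R)))
        ≡⟨ ∑-swap P P _ ⟩
      (∑ P λ y → ∑ P λ x → ∑ P λ y′ → ⟦ C Θ y ⟧ * ⟦ C Θ y′ ⟧ * (⟦ C Θ x ⟧ * ∑ P λ R → esc (x , y , y′ , R)))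
        ≡⟨ ∑-cong P (λ y → ∑-swap P P _) ⟩
      (∑ P λ y → ∑ P λ y′ → ∑ P λ x → ⟦ C Θ y ⟧ * ⟦ C Θ y′ ⟧ * (⟦ C Θ x ⟧ * ∑ P λ R → esc (x , y , y′ , R)))
        ≡⟨ ∑-cong P (λ y → ∑-cong P λ y′ → trans (∑-*ˡ P (⟦ C Θ y ⟧ * ⟦ C Θ y′ ⟧) _) (cong (⟦ C Θ y ⟧ * ⟦ C Θ y′ ⟧ *_) (inner y y′))) ⟩
      Rigidity.violations (C Θ) ∎
      where
      open ≡-Reasoning
      esc : Draw n → ℕ
      esc (x , y , y′ , R) = ⟦ not (C Θ (splice x y y′ R)) ⟧
      q : ∀ a b c d → a * (b * (c * d)) ≡ b * c * (a * d)
      q = solve-∀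
      pull : (c : Point n → ℕ) (ψ : Point n → Point n → Point n → ℕ) →
             (∑ P λ x → c x * ∑ P λ y → c y * ∑ P λ y′ → c y′ * ψ x y y′) ≡ (∑ P λ x → ∑ P λ y → ∑ P λ y′ → c y * c y′ * (c x * ψ x y y′))
      pull c ψ = ∑-cong P λ x →
        trans (sym (∑-*ˡ P (c x) (λ y → c y * ∑ P λ y′ → c y′ * ψ x y y′))) (∑-cong P λ y →
        trans (cong (c x *_) (sym (∑-*ˡ P (c y) (λ y′ → c y′ * ψ x y y′))))
        (trans (sym (∑-*ˡ P (c x) (λ y′ → c y * (c y′ * ψ x y y′)))) (∑-cong P λ y′ → q (c x) (c y) (c y′) (ψ x y y′))))
      inner : ∀ y y′ → (∑ P λ x → ⟦ C Θ x ⟧ * ∑ P λ R → esc (x , y , y′ , R)) ≡ Rigidity.total (C Θ) (y ⊕ y′)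
      inner y y′ = trans (∑-cong P λ x → sym (∑-*ˡ P ⟦ C Θ x ⟧ _)) (∑-swap P P _)

    module _ (B : Draw n → Bool) (B-few : ∑ (Ω f) (λ ω → ⟦ B ω ⟧) * D ≤ length (Ω f)) where

      -- The invariant under which cubes are collected label by label: each label adds at most
      -- `a / e₁` to each error. The excess is measured against `f` rather than `A`, since this is
      -- what the distance to `f` needs.
      record Approximation (A : Point n → Bool) (l : ℕ) : Set where
        field
          cubes   : List (Cube n)
          number  : length cubes ≤ l
          lost    : (∑ P λ x → ⟦ A x ⟧ * ⟦ not (union cubes x) ⟧) * e₁ ≤ l * a
          extra   : (∑ P λ x → ⟦ union cubes x ⟧ * ⟦ not (f x) ⟧) * e₁ ≤ l * a
      open Approximation

      -- A class with fewer than `a / r` points is dropped and charged to `lost`. For any other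
      -- class, draws with all three points in it form at least a fraction `1 / (r * r * r)` of all
      -- draws, so a violation rate of `1 / D` overall is at most `1 / (K * K)` inside the class,
      -- and `rigidity` applies.
      extend : ∀ Θ {A l} → (∀ ω → ⟦ violation Θ ω ⟧ ≤ ⟦ B ω ⟧) → Approximation A l → Approximation (λ x → C Θ x ∨ A x) (suc l)
      extend Θ {A} {l} v≤B rest with a ≤? r * Rigidity.c (C Θ)
      ... | no sparse = record
        { cubes  = cubes rest
        ; number = m≤n⇒m≤1+n (number rest)
        ; lost   = ≤-trans (*-monoˡ-≤ e₁ (≤-trans (∑-mono P (λ x → ∨-∖ (C Θ x) (A x) (union (cubes rest) x))) (≤-reflexive (∑-+ P _ _))))
                   (≤-trans (≤-reflexive (*-distribʳ-+ e₁ c _)) (+-mono-≤ c-small (lost rest)))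
        ; extra  = ≤-trans (extra rest) (m≤n+m (l * a) a)
        }
        where
        c = Rigidity.c (C Θ)
        c-small : c * e₁ ≤ a
        c-small = ≤-trans (*-monoʳ-≤ c e₁≤r) (≤-trans (≤-reflexive (*-comm c r)) (<⇒≤ (≰⇒> sparse)))
      ... | yes dense = record
        { cubes  = T ∷ cubes rest
        ; number = s≤s (number rest)
        ; lost   = ≤-trans (*-monoˡ-≤ e₁ (≤-trans (∑-mono P (λ x → ∨-∖-∨ (C Θ x) (A x) (mem T x) (union (cubes rest) x))) (≤-reflexive (∑-+ P _ _))))
                   (≤-trans (≤-reflexive (*-distribʳ-+ e₁ O _)) (+-mono-≤ O-small (lost rest)))
        ; extra  = ≤-trans (*-monoˡ-≤ e₁ (≤-trans (∑-mono P (λ x → h₂ (C Θ x) (f x) (mem T x) (union (cubes rest) x) (C⊆f Θ x))) (≤-reflexive (∑-+ P _ _))))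
                   (≤-trans (≤-reflexive (*-distribʳ-+ e₁ N _)) (+-mono-≤ N-small (extra rest)))
        }
        where
        open ≤-Reasoning
        c = Rigidity.c (C Θ)
        c≤a : c ≤ a
        c≤a = ≤-trans (∑-mono P (λ x → ⟦⟧-mono (C Θ x) (f x) (C⊆f Θ x))) (≤-reflexive (sym (count1-∑ f)))
        c>0 : 0 < c
        c>0 = n≢0⇒n>0 λ e → <⇒≱ a>0 (≤-trans dense (≤-reflexive (trans (cong (r *_) e) (*-zeroʳ r))))
        V = Rigidity.violations (C Θ)
        few : V * (K * K) ≤ c * c * c * 2 ^ n
        few = pos-cancel (*-mono-≤ (*-mono-≤ r>0 r>0) r>0) (begin
          V * (K * K) * (r * r * r) ≡⟨ r₁ V (K * K) (r * r * r) ⟩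
          V * (r * r * r * (K * K)) ≤⟨ *-monoʳ-≤ V rK≤D ⟩
          V * D ≤⟨ *-monoˡ-≤ D (≤-trans (≤-reflexive (sym (violations-∑ Θ))) (∑-mono (Ω f) v≤B)) ⟩
          ∑ (Ω f) (λ ω → ⟦ B ω ⟧) * D ≤⟨ B-few ⟩
          length (Ω f) ≡⟨ length-Ω f ⟩
          a * (a * (a * 2 ^ n)) ≤⟨ *-mono-≤ dense (*-mono-≤ dense (*-monoˡ-≤ (2 ^ n) dense)) ⟩
          r * c * (r * c * (r * c * 2 ^ n)) ≡⟨ r₂ r c (2 ^ n) ⟩
          c * c * c * 2 ^ n * (r * r * r) ∎)
          where
          r₁ : ∀ a b c → a * b * c ≡ a * (c * b)
          r₁ = solve-∀
          r₂ : ∀ r c p → r * c * (r * c * (r * c * p)) ≡ c * c * c * p * (r * r * r)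
          r₂ = solve-∀
        rigid = Rigidity.rigidity (C Θ) K 64≤K c>0 few
        T = proj₁ rigid
        O = ∑ P λ x → ⟦ C Θ x ⟧ * ⟦ not (mem T x) ⟧
        N = ∑ P λ x → ⟦ mem T x ⟧ * ⟦ not (C Θ x) ⟧
        small : ∀ {z k} → k ≤ 10 → z * K ≤ k * c → z * e₁ ≤ a
        small {z} {k} k≤10 h = *-cancelˡ-≤ 10 (begin
          10 * (z * e₁) ≡⟨ q z e₁ ⟩
          z * (10 * e₁) ≤⟨ *-monoʳ-≤ z 10e₁≤K ⟩
          z * K ≤⟨ h ⟩
          k * c ≤⟨ *-mono-≤ k≤10 c≤a ⟩
          10 * a ∎)
          where
          q : ∀ z e → 10 * (z * e) ≡ z * (10 * e)
          q = solve-∀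
        O-small : O * e₁ ≤ a
        O-small = small {O} {5} (m≤m+n 5 5) (proj₁ (proj₂ rigid))
        N-small : N * e₁ ≤ a
        N-small = small {N} {10} ≤-refl (proj₂ (proj₂ rigid))
        h₂ : ∀ p q t m → (p ≡ true → q ≡ true) → ⟦ t ∨ m ⟧ * ⟦ not q ⟧ ≤ ⟦ t ⟧ * ⟦ not p ⟧ + ⟦ m ⟧ * ⟦ not q ⟧
        h₂ p     q     false m i = ≤-refl
        h₂ p     true  true  m i = z≤n
        h₂ false false true  m i = s≤s z≤n
        h₂ true  false true  m i = ⊥-elim (false≢true (i refl))

      approximate : ∀ H → (∀ ω → ⟦ anyᵇ (λ Θ → violation Θ ω) H ⟧ ≤ ⟦ B ω ⟧) → Approximation (λ x → anyᵇ (λ Θ → C Θ x) H) (length H)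
      approximate []      h = record { cubes = [] ; number = z≤n ; lost = ≤-reflexive z ; extra = ≤-reflexive z }
        where
        z : (∑ P λ x → 0) * e₁ ≡ 0
        z = cong (_* e₁) (trans (∑-const P 0) (*-zeroʳ (length P)))
      approximate (Θ ∷ H) h = extend Θ {λ x → anyᵇ (λ Θ → C Θ x) H} {length H} (λ ω → ≤-trans (∨-⟦⟧ˡ (violation Θ ω) _) (h ω)) (approximate H (λ ω → ≤-trans (∨-⟦⟧ʳ (violation Θ ω) _) (h ω)))

    closeDNF : ∀ (s e : ℕ) → 0 < s → e₁ ≡ 4 * s * e → 4 * e ≤ D → ∀ H → length H ≤ s →
               ∑ (Ω f) (λ ω → ⟦ badDraw f K₀ 𝒬 H ω ⟧) * D < length (Ω f) →
               ∃ λ (d : DNF n) → (length d ≤ s) × (symDiff f (evalDNF d) * e < a)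
    closeDNF s e s>0 e₁≡ 4e≤D H |H|≤s few = d , d-short , close
      where
      open ≤-Reasoning
      B = badDraw f K₀ 𝒬 H
      covered : Point n → Bool
      covered x = anyᵇ (λ Θ → C Θ x) H
      approx = approximate B (<⇒≤ few) H (λ ω → ∨-⟦⟧ʳ (not (covered (proj₁ ω))) _)
      open Approximation approx
      d = map cubeTerm cubes
      d-short : length d ≤ s
      d-short = ≤-trans (≤-reflexive (length-map cubeTerm cubes)) (≤-trans number |H|≤s)
      U = ∑ (ones f) λ x → ⟦ not (covered x) ⟧
      L = ∑ P λ x → ⟦ covered x ⟧ * ⟦ not (union cubes x) ⟧
      E = ∑ P λ x → ⟦ union cubes x ⟧ * ⟦ not (f x) ⟧
      U-few : U * D < a
      U-few = *-cancelʳ-< (a * (a * 2 ^ n)) (U * D) a (begin-strict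
        U * D * (a * (a * 2 ^ n)) ≡⟨ r₁ U D (a * (a * 2 ^ n)) ⟩
        U * (a * (a * 2 ^ n)) * D ≡⟨ cong (_* D) (sym (∑-Ω-first f (λ x → ⟦ not (covered x) ⟧))) ⟩
        ∑ (Ω f) (λ ω → ⟦ not (covered (proj₁ ω)) ⟧) * D ≤⟨ *-monoˡ-≤ D (∑-mono (Ω f) (λ ω → ∨-⟦⟧ˡ (not (covered (proj₁ ω))) _)) ⟩
        ∑ (Ω f) (λ ω → ⟦ B ω ⟧) * D <⟨ few ⟩
        length (Ω f) ≡⟨ length-Ω f ⟩
        a * (a * (a * 2 ^ n)) ∎)
        where
        r₁ : ∀ u d z → u * d * z ≡ u * z * d
        r₁ = solve-∀
      scale : ∀ {z} → z * e₁ ≤ length H * a → z * (4 * e) ≤ a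
      scale {z} h = *-cancelˡ-≤ s ⦃ >-nonZero s>0 ⦄ (begin
        s * (z * (4 * e)) ≡⟨ q s z e ⟩
        z * (4 * s * e) ≡⟨ cong (z *_) (sym e₁≡) ⟩
        z * e₁ ≤⟨ h ⟩
        length H * a ≤⟨ *-monoˡ-≤ a |H|≤s ⟩
        s * a ∎)
        where
        q : ∀ s z e → s * (z * (4 * e)) ≡ z * (4 * s * e)
        q = solve-∀
      pointwise : ∀ x → ⟦ Defs.xor (f x) (evalDNF d x) ⟧ ≤ ⟦ f x ⟧ * ⟦ not (covered x) ⟧
                  + ⟦ covered x ⟧ * ⟦ not (union cubes x) ⟧ + ⟦ union cubes x ⟧ * ⟦ not (f x) ⟧
      pointwise x = ≤-trans (≤-reflexive (cong (λ b → ⟦ Defs.xor (f x) b ⟧) (evalDNF-cubes cubes x))) (h (f x) (covered x) (union cubes x))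
        where
        h : ∀ p c m → ⟦ Defs.xor p m ⟧ ≤ ⟦ p ⟧ * ⟦ not c ⟧ + ⟦ c ⟧ * ⟦ not m ⟧ + ⟦ m ⟧ * ⟦ not p ⟧
        h true  c     true  = z≤n
        h true  true  false = s≤s z≤n
        h true  false false = s≤s z≤n
        h false c     true  = m≤n+m 1 _
        h false c     false = z≤n
      close : symDiff f (evalDNF d) * e < a
      close = *-cancelˡ-< 4 _ _ (begin-strict
        4 * (symDiff f (evalDNF d) * e) ≤⟨ *-monoʳ-≤ 4 (*-monoˡ-≤ e (≤-trans (≤-reflexive (count1-∑ (λ x → Defs.xor (f x) (evalDNF d x)))) (≤-trans (∑-mono P pointwise)
                                                                 (≤-reflexive (trans (∑-+ P _ _) (cong (_+ E) (trans (∑-+ P _ _) (cong (_+ L) (sym (∑-ones f _)))))))))) ⟩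
        4 * ((U + L + E) * e) ≡⟨ q U L E e ⟩
        U * (4 * e) + L * (4 * e) + E * (4 * e) ≤⟨ +-mono-≤ (+-mono-≤ (≤-trans (*-monoʳ-≤ U 4e≤D) (<⇒≤ U-few)) (scale {L} lost)) (scale {E} extra) ⟩
        a + a + a <⟨ m<m+n (a + a + a) a>0 ⟩
        a + a + a + a ≡⟨ q₂ a ⟩
        4 * a ∎)
        where
        q : ∀ u l x e → 4 * ((u + l + x) * e) ≡ u * (4 * e) + l * (4 * e) + x * (4 * e)
        q = solve-∀
        q₂ : ∀ a → a + a + a + a ≡ 4 * a
        q₂ = solve-∀

  -- Union bound over the hypotheses

  ∑-listsUpTo : {X : Set} (L : List X) (s : ℕ) (φ : List X → ℕ) →
                ∑ (listsUpTo L (suc s)) φ ≡ φ [] + ∑ L λ x → ∑ (listsUpTo L s) λ H → φ (x ∷ H)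
  ∑-listsUpTo L s φ = cong (φ [] +_) (trans (∑-map _ (L ⊗ listsUpTo L s) φ) (∑-⊗ L (listsUpTo L s) _))

  ∑-listsUpTo-≤ : {X : Set} (L : List X) (s : ℕ) (φ : List X → ℕ) (z : ℕ) → (∀ H → length H ≤ s → φ H ≤ z) →
                  ∑ (listsUpTo L s) φ ≤ suc (length L) ^ s * z
  ∑-listsUpTo-≤ L zero    φ z h = ≤-trans (≤-reflexive (+-identityʳ (φ []))) (≤-trans (h [] z≤n) (≤-reflexive (sym (*-identityˡ z))))
  ∑-listsUpTo-≤ L (suc s) φ z h = begin
    ∑ (listsUpTo L (suc s)) φ ≡⟨ ∑-listsUpTo L s φ ⟩
    φ [] + (∑ L λ x → ∑ (listsUpTo L s) λ H → φ (x ∷ H)) ≤⟨ +-mono-≤ (h [] z≤n) (∑-mono L λ x → ∑-listsUpTo-≤ L s (λ H → φ (x ∷ H)) z λ H l → h (x ∷ H) (s≤s l)) ⟩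
    z + (∑ L λ x → suc (length L) ^ s * z) ≡⟨ cong (z +_) (∑-const L _) ⟩
    z + length L * (suc (length L) ^ s * z) ≤⟨ +-monoˡ-≤ _ (≤-trans (≤-reflexive (sym (*-identityˡ z))) (*-monoˡ-≤ z (m^n>0 (suc (length L)) s))) ⟩
    suc (length L) ^ s * z + length L * (suc (length L) ^ s * z) ≡⟨ r (length L) (suc (length L) ^ s) z ⟩
    suc (length L) ^ suc s * z ∎
    where
    open ≤-Reasoning
    r : ∀ l p z → p * z + l * (p * z) ≡ (1 + l) * p * z
    r = solve-∀

  anyᵇ-∑ : {X : Set} (p : X → Bool) (L : List X) → ⟦ anyᵇ p L ⟧ ≤ ∑ L (λ x → ⟦ p x ⟧)
  anyᵇ-∑ p []      = z≤n
  anyᵇ-∑ p (x ∷ L) = ≤-trans (∨-⟦⟧-+ (p x) _) (+-monoʳ-≤ ⟦ p x ⟧ (anyᵇ-∑ p L))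

  trues-𝟏 : ∀ k → trues (𝟏 {k}) ≡ k
  trues-𝟏 zero    = refl
  trues-𝟏 (suc k) = cong suc (trues-𝟏 k)

  -- For every fixed choice of seeds, a bad rate of at least `1 / D` gives `10 * k₁` expected bad
  -- trials, so a single hypothesis passes with probability at most `2 ^ (- k₁)`. There are at most
  -- `2 ^ (suc M * s)` hypotheses, and the additional 2 in `k₁` is the factor 4.
  rarely-accepts : ∀ {n} (f : BoolFun n) (M s K₀ D k₁ : ℕ) → 0 < length (Ω f) → suc M * s + 2 ≤ k₁ →
    (∀ (𝒬 : Vec (Draw n) M) H → length H ≤ s → length (Ω f) ≤ D * ∑ (Ω f) (λ ω → ⟦ badDraw f K₀ 𝒬 H ω ⟧)) →
    4 * (∑ (vecs (Ω f) M) λ 𝒬 → ∑ (vecs (Ω f) (10 * D * k₁)) λ ωs → ⟦ verdictOn f s K₀ k₁ 𝒬 ωs ⟧)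
    ≤ length (Ω f) ^ M * length (Ω f) ^ (10 * D * k₁)
  rarely-accepts {n} f M s K₀ D k₁ W>0 k₁-big far = begin
    4 * (∑ (vecs (Ω f) M) λ 𝒬 → acc 𝒬) ≡⟨ sym (∑-*ˡ (vecs (Ω f) M) 4 acc) ⟩
    (∑ (vecs (Ω f) M) λ 𝒬 → 4 * acc 𝒬) ≤⟨ ∑-mono (vecs (Ω f) M) each ⟩
    (∑ (vecs (Ω f) M) λ 𝒬 → W ^ N) ≡⟨ ∑-const (vecs (Ω f) M) (W ^ N) ⟩
    length (vecs (Ω f) M) * W ^ N ≡⟨ cong (_* W ^ N) (length-vecs (Ω f) M) ⟩
    W ^ M * W ^ N ∎
    where
    open ≤-Reasoning
    W = length (Ω f)
    N = 10 * D * k₁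
    Hs = listsUpTo (allPoints M) s
    acc : Vec (Draw n) M → ℕ
    acc 𝒬 = ∑ (vecs (Ω f) N) λ ωs → ⟦ verdictOn f s K₀ k₁ 𝒬 ωs ⟧
    passing : Vec (Draw n) M → List (Vec Bool M) → ℕ
    passing 𝒬 H = ∑ (vecs (Ω f) N) λ ωs → ⟦ hits (badDraw f K₀ 𝒬 H) 𝟏 ωs ≤ᵇ k₁ ⟧
    tail : ∀ 𝒬 H → length H ≤ s → passing 𝒬 H * 2 ^ k₁ ≤ W ^ N
    tail 𝒬 H l = lower-tail {M = N} (Ω f) (badDraw f K₀ 𝒬 H) 𝟏 (10 * D) k₁ W>0 (trues-𝟏 N)
      (≤-trans (*-monoʳ-≤ 10 (far 𝒬 H l)) (≤-reflexive (sym (*-assoc 10 D _))))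
    hypotheses : suc (length (allPoints M)) ^ s * 4 ≤ 2 ^ k₁
    hypotheses = begin
      suc (length (allPoints M)) ^ s * 4 ≡⟨ cong (λ l → suc l ^ s * 4) (length-points M) ⟩
      (1 + 2 ^ M) ^ s * 4 ≤⟨ *-monoˡ-≤ 4 (^-monoˡ-≤ s (+-mono-≤ (m^n>0 2 M) (≤-reflexive (sym (+-identityʳ (2 ^ M)))))) ⟩
      (2 ^ suc M) ^ s * 4 ≡⟨ cong (_* 4) (^-*-assoc 2 (suc M) s) ⟩
      2 ^ (suc M * s) * 2 ^ 2 ≡⟨ sym (^-distribˡ-+-* 2 (suc M * s) 2) ⟩
      2 ^ (suc M * s + 2) ≤⟨ ^-monoʳ-≤ 2 k₁-big ⟩
      2 ^ k₁ ∎
    each : ∀ 𝒬 → 4 * acc 𝒬 ≤ W ^ N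
    each 𝒬 = pos-cancel (m^n>0 2 k₁) (begin
      4 * acc 𝒬 * 2 ^ k₁ ≡⟨ q (acc 𝒬) (2 ^ k₁) ⟩
      acc 𝒬 * 2 ^ k₁ * 4 ≤⟨ *-monoˡ-≤ 4 (*-monoˡ-≤ (2 ^ k₁) (≤-trans (∑-mono (vecs (Ω f) N) (λ ωs → anyᵇ-∑ _ Hs)) (≤-reflexive (∑-swap (vecs (Ω f) N) Hs _)))) ⟩
      ∑ Hs (passing 𝒬) * 2 ^ k₁ * 4 ≡⟨ cong (_* 4) (sym (∑-*ʳ Hs (2 ^ k₁) (passing 𝒬))) ⟩
      ∑ Hs (λ H → passing 𝒬 H * 2 ^ k₁) * 4 ≤⟨ *-monoˡ-≤ 4 (∑-listsUpTo-≤ (allPoints M) s _ (W ^ N) (tail 𝒬)) ⟩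
      suc (length (allPoints M)) ^ s * W ^ N * 4 ≡⟨ q₂ (suc (length (allPoints M)) ^ s) (W ^ N) ⟩
      W ^ N * (suc (length (allPoints M)) ^ s * 4) ≤⟨ *-monoʳ-≤ (W ^ N) hypotheses ⟩
      W ^ N * 2 ^ k₁ ∎)
      where
      q : ∀ a p → 4 * a * p ≡ a * p * 4
      q = solve-∀
      q₂ : ∀ a w → a * w * 4 ≡ w * (a * 4)
      q₂ = solve-∀

  -- Robustly maximal implicants

  findPoint : ∀ {n} (p : Point n → Bool) → (∃ λ x → p x ≡ true) ⊎ (∀ x → p x ≡ false)
  findPoint {zero} p with p [] in eq
  ... | true  = inj₁ ([] , eq)
  ... | false = inj₂ λ { [] → eq }
  findPoint {suc n} p with findPoint (λ x → p (true ∷ x)) | findPoint (λ x → p (false ∷ x))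
  ... | inj₁ (x , e) | _            = inj₁ (true ∷ x , e)
  ... | inj₂ _       | inj₁ (x , e) = inj₁ (false ∷ x , e)
  ... | inj₂ g       | inj₂ h       = inj₂ λ { (true ∷ x) → g x ; (false ∷ x) → h x }

  -- The remainder is below `d`, hence below `m * d`, because `d ≤ x` makes the quotient positive.
  -- The constants elsewhere leave room for this factor 2.
  quotient : ∀ x d → 0 < d → d ≤ x → ∃ λ m → (m * d ≤ x) × (x ≤ 2 * (m * d))
  quotient x d@(suc _) _ d≤x = m , low , high
    where
    open ≤-Reasoning
    m = x / d
    split : x ≡ x % d + m * d
    split = m≡m%n+[m/n]*n x d
    low : m * d ≤ x
    low = ≤-trans (m≤n+m (m * d) (x % d)) (≤-reflexive (sym split))
    m>0 : 0 < m
    m>0 = n≢0⇒n>0 λ e → <⇒≱ (m%n<n x d) (≤-trans d≤x (≤-reflexive (trans split (trans (cong (λ z → x % d + z * d) e) (+-identityʳ _)))))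
    high : x ≤ 2 * (m * d)
    high = begin
      x ≡⟨ split ⟩
      x % d + m * d ≤⟨ +-monoˡ-≤ (m * d) (≤-trans (<⇒≤ (m%n<n x d)) (≤-trans (≤-reflexive (sym (*-identityˡ d))) (*-monoˡ-≤ d m>0))) ⟩
      m * d + m * d ≡⟨ cong (m * d +_) (sym (+-identityʳ (m * d))) ⟩
      2 * (m * d) ∎

  module Heavy {n : ℕ} (f : BoolFun n) (a>0 : 0 < count1 f) (t κ G K₀ M : ℕ) (G>0 : 0 < G)
               (κ-big : 32768 * G * t ^ 7 ≤ κ) (M-big : t * t * κ * K₀ ≤ M) where
    P = allPoints n
    a = count1 f
    W = length (Ω f)

    defect : Cube n → ℕ
    defect T = ∑∈ T λ x → ⟦ not (f x) ⟧

    size-defect : ∀ T → size T ≤ a + defect T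
    size-defect T = begin
      size T ≡⟨ sym (size-count T) ⟩
      (∑ P λ x → ⟦ mem T x ⟧) ≤⟨ ∑-mono P (λ x → h (mem T x) (f x)) ⟩
      (∑ P λ x → ⟦ f x ⟧ + ⟦ mem T x ⟧ * ⟦ not (f x) ⟧) ≡⟨ ∑-+ P _ _ ⟩
      (∑ P λ x → ⟦ f x ⟧) + defect T ≡⟨ cong (_+ defect T) (sym (count1-∑ f)) ⟩
      a + defect T ∎
      where
      open ≤-Reasoning
      h : ∀ m q → ⟦ m ⟧ ≤ ⟦ q ⟧ + ⟦ m ⟧ * ⟦ not q ⟧
      h false q     = z≤n
      h true  true  = s≤s z≤n
      h true  false = s≤s z≤n

    ξ : Cube n → Point n → Draw n → Bool
    ξ T w (x , y , _ , R) = mem T x ∧ (mem T y ∧ not (f (splice x y w R)))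

    missCount : Cube n → Point n → ℕ
    missCount T w = ∑ (Ω f) λ ω → ⟦ ξ T w ω ⟧

    escapes : Cube n → ℕ
    escapes T = ∑ (Ω f) λ (x , y , y′ , R) → ⟦ mem T x ∧ (mem T y ∧ (mem T y′ ∧ not (f (splice x y y′ R)))) ⟧

    -- `inside` and `outside` are the density hypotheses of `upper-tail` and `lower-tail` for
    -- `scale * K₀` seeds, so a single `scale` must fit both; `closed` says that splices of three
    -- points of the cube rarely leave `f`.
    record Implicant : Set where
      field
        cube     : Cube n
        scale    : ℕ
        scale-≤  : scale * K₀ ≤ M
        inside   : ∀ w → mem cube w ≡ true → 6 * (scale * missCount cube w) ≤ W
        outside  : ∀ w → mem cube w ≡ false → 10 * W ≤ scale * missCount cube w
        closed   : escapes cube * G ≤ W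

    module FromTerm (T₀ : Cube n) where
      τ₀ = size T₀
      Z = κ * τ₀ ^ 7

      -- A cube λ times larger than T₀ is allowed defect density λ⁷/κ. At a maximal good T, every cube
      -- that is at least twice as large therefore has at least 2⁷ times the density allowed for T; this
      -- constant-factor gap is what the label thresholds detect, while λ ≤ 2t keeps λ⁷/κ small.
      good : Cube n → Bool
      good T = (size T ≤ᵇ 2 * a) ∧ (defect T * Z ≤ᵇ size T * size T ^ 7)

      Grown : Set
      Grown = ∃ λ T → (∀ x → mem T₀ x ≡ true → mem T x ≡ true) × (good T ≡ true) × (∀ w → mem T w ≡ false → good (hull T w) ≡ false)

      -- The number `k` is fuel. Passing to the hull of an outside point at least doubles the size
      -- and so consumes at least one unit; once the fuel is spent, `size T` is at least `2 * a`,
      -- and every further hull violates the size bound in `good`.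
      grow : ∀ k T → 2 * a ≤ size T + k → (∀ x → mem T₀ x ≡ true → mem T x ≡ true) → good T ≡ true → Grown
      grow zero T full ⊆T gT = T , ⊆T , gT , λ w e → cong (_∧ (defect (hull T w) * Z ≤ᵇ size (hull T w) * size (hull T w) ^ 7)) (≤ᵇ-false (begin-strict
        2 * a <⟨ s≤s full ⟩
        suc (size T + 0) ≤⟨ +-mono-≤ (size>0 T) ≤-refl ⟩
        2 * size T ≤⟨ hull-size T w e ⟩
        size (hull T w) ∎))
        where open ≤-Reasoning
      grow (suc k) T full ⊆T gT with findPoint (λ w → not (mem T w) ∧ good (hull T w))
      ... | inj₂ none = T , ⊆T , gT , λ w e → trans (cong (λ b → not b ∧ good (hull T w)) (sym e)) (none w)
      ... | inj₁ (w , e) = grow k (hull T w) full′ (λ x m → hull-⊇ T w x (⊆T x m)) (proj₂ (∧-true {not (mem T w)} e))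
        where
        open ≤-Reasoning
        full′ : 2 * a ≤ size (hull T w) + k
        full′ = begin
          2 * a ≤⟨ full ⟩
          size T + suc k ≡⟨ +-suc (size T) k ⟩
          1 + size T + k ≤⟨ +-monoˡ-≤ k (+-mono-≤ (size>0 T) (≤-reflexive (sym (+-identityʳ (size T))))) ⟩
          2 * size T + k ≤⟨ +-monoˡ-≤ k (hull-size T w (not-true (proj₁ (∧-true e)))) ⟩
          size (hull T w) + k ∎

      grown : (∀ x → mem T₀ x ≡ true → f x ≡ true) → Grown
      grown T₀⊆f = grow (2 * a) T₀ (m≤n+m (2 * a) τ₀) (λ x e → e) (cong₂ _∧_ (≤ᵇ-true size-ok) (≤ᵇ-true (≤-trans (≤-reflexive (cong (_* Z) no-defect)) z≤n)))
        where
        h : ∀ m q → (m ≡ true → q ≡ true) → ⟦ m ⟧ * ⟦ not q ⟧ ≡ 0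
        h false q i = refl
        h true  q i = cong (λ b → 1 * ⟦ not b ⟧) (i refl)
        no-defect : defect T₀ ≡ 0
        no-defect = trans (∑-cong P λ x → h (mem T₀ x) (f x) (T₀⊆f x)) (trans (∑-const P 0) (*-zeroʳ (length P)))
        size-ok : τ₀ ≤ 2 * a
        size-ok = ≤-trans (size-defect T₀) (≤-trans (≤-reflexive (cong (a +_) no-defect)) (+-monoʳ-≤ a z≤n))

    module Scaled (T₀ T : Cube n) (heavy : a ≤ t * size T₀) (T⊇T₀ : ∀ x → mem T₀ x ≡ true → mem T x ≡ true)
                  (T-good : FromTerm.good T₀ T ≡ true)
                  (maximal : ∀ w → mem T w ≡ false → FromTerm.good T₀ (hull T w) ≡ false) where
      open FromTerm T₀ using (τ₀; Z)
      τ = size T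
      τ⁷ = τ ^ 7
      2ⁿ = 2 ^ n
      B = defect T

      τ≤2a : τ ≤ 2 * a
      τ≤2a = ≤ᵇ-true⁻¹ {τ} (proj₁ (∧-true T-good))

      BZ : B * Z ≤ τ * τ⁷
      BZ = ≤ᵇ-true⁻¹ {B * Z} (proj₂ (∧-true {τ ≤ᵇ 2 * a} T-good))

      τ>0 : 0 < τ
      τ>0 = size>0 T
      τ₀≤τ : τ₀ ≤ τ
      τ₀≤τ = ≤-trans (≤-reflexive (sym (size-count T₀))) (≤-trans (∑-mono P λ x → ⟦⟧-mono (mem T₀ x) (mem T x) (T⊇T₀ x)) (≤-reflexive (size-count T)))

      -- The constant is `32768 = 256 * 2 ^ 7`, where `2 ^ 7` comes from `τ ≤ 2 * a ≤ 2 * (t * τ₀)`.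
      -- The 256 is kept for hulls that are too large, the `G` for `closed`.
      Z-big : 256 * G * τ⁷ ≤ Z
      Z-big = begin
        256 * G * τ ^ 7 ≤⟨ *-monoʳ-≤ (256 * G) (^-monoˡ-≤ 7 (≤-trans τ≤2a (*-monoʳ-≤ 2 heavy))) ⟩
        256 * G * (2 * (t * τ₀)) ^ 7 ≡⟨ cong (256 * G *_) (trans (^-distribʳ-* 7 2 (t * τ₀)) (cong (128 *_) (^-distribʳ-* 7 t τ₀))) ⟩
        256 * G * (128 * (t ^ 7 * τ₀ ^ 7)) ≡⟨ r G (t ^ 7) (τ₀ ^ 7) ⟩
        32768 * G * t ^ 7 * τ₀ ^ 7 ≤⟨ *-monoˡ-≤ (τ₀ ^ 7) κ-big ⟩
        κ * τ₀ ^ 7 ∎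
        where
        open ≤-Reasoning
        r : ∀ G p q → 256 * G * (128 * (p * q)) ≡ 32768 * G * p * q
        r = solve-∀

      Z>0 : 0 < Z
      Z>0 = ≤-trans (*-mono-≤ (*-mono-≤ (s≤s (z≤n {255})) G>0) (m^n>0 τ ⦃ >-nonZero τ>0 ⦄ 7)) Z-big

      256τ⁷≤Z : 256 * τ⁷ ≤ Z
      256τ⁷≤Z = ≤-trans (*-monoˡ-≤ τ⁷ (≤-trans (≤-reflexive (sym (*-identityʳ 256))) (*-monoʳ-≤ 256 G>0))) Z-big

      unit = τ * (τ * τ⁷)

      unit>0 : 0 < unit
      unit>0 = *-mono-≤ τ>0 (*-mono-≤ τ>0 (m^n>0 τ ⦃ >-nonZero τ>0 ⦄ 7))

      -- A seed sends a point of `T` out of `f` with probability at most `unit / (a * a * Z)`. The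
      -- scale is the reciprocal of this bound divided by 6, the constant of `upper-tail`, and
      -- rounding at most halves it.
      scales : ∃ λ m → (m * (6 * unit) ≤ a * a * Z) × (a * a * Z ≤ 2 * (m * (6 * unit)))
      scales = quotient (a * a * Z) (6 * unit) (*-mono-≤ (s≤s (z≤n {5})) unit>0) (begin
        6 * (τ * (τ * τ⁷)) ≡⟨ r₁ τ τ⁷ ⟩
        τ * τ * (6 * τ⁷) ≤⟨ *-monoˡ-≤ (6 * τ⁷) (*-mono-≤ τ≤2a τ≤2a) ⟩
        2 * a * (2 * a) * (6 * τ⁷) ≡⟨ r₂ a τ⁷ ⟩
        a * a * (24 * τ⁷) ≤⟨ *-monoʳ-≤ (a * a) (≤-trans (*-monoˡ-≤ τ⁷ (m≤m+n 24 232)) 256τ⁷≤Z) ⟩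
        a * a * Z ∎)
        where
        open ≤-Reasoning
        r₁ : ∀ x y → 6 * (x * (x * y)) ≡ x * x * (6 * y)
        r₁ = solve-∀
        r₂ : ∀ a y → 2 * a * (2 * a) * (6 * y) ≡ a * a * (24 * y)
        r₂ = solve-∀

      m = proj₁ scales

      m-≤ : m ≤ t * t * κ
      m-≤ = pos-cancel unit>0 (begin
        m * unit ≤⟨ *-monoʳ-≤ m (m≤m+n unit (5 * unit)) ⟩
        m * (6 * unit) ≤⟨ proj₁ (proj₂ scales) ⟩
        a * a * (κ * τ₀ ^ 7) ≤⟨ *-mono-≤ (*-mono-≤ (≤-trans heavy (*-monoʳ-≤ t τ₀≤τ)) (≤-trans heavy (*-monoʳ-≤ t τ₀≤τ))) (*-monoʳ-≤ κ (^-monoˡ-≤ 7 τ₀≤τ)) ⟩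
        t * τ * (t * τ) * (κ * τ⁷) ≡⟨ r t τ κ τ⁷ ⟩
        t * t * κ * unit ∎)
        where
        open ≤-Reasoning
        r : ∀ t x k y → t * x * (t * x) * (k * y) ≡ t * t * k * (x * (x * y))
        r = solve-∀

      U : Point n → ℕ
      U w = splices T w λ z → ⟦ not (f z) ⟧

      -- Actual seeds have `x` and `y` in `f`; `U` ignores this because `splices-uniform` needs them
      -- uniform in the whole cube.
      U′ : Point n → ℕ
      U′ w = ∑∈ T λ x → ⟦ f x ⟧ * ∑∈ T λ y → ⟦ f y ⟧ * ∑ P λ R → ⟦ not (f (splice x y w R)) ⟧

      missCount-U′ : ∀ w → missCount T w ≡ a * U′ w
      missCount-U′ w = begin
        missCount T w
          ≡⟨ ∑-Ω f _ ⟩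
        (∑ (ones f) λ x → ∑ (ones f) λ y → ∑ (ones f) λ y′ → ∑ P λ R → ⟦ mem T x ∧ (mem T y ∧ not (f (splice x y w R))) ⟧)
          ≡⟨ ∑-cong (ones f) (λ x → ∑-cong (ones f) λ y → trans (∑-const (ones f) _) (cong (a *_) (split x y))) ⟩
        (∑ (ones f) λ x → ∑ (ones f) λ y → a * (⟦ mem T x ⟧ * (⟦ mem T y ⟧ * g x y)))
          ≡⟨ ∑-cong (ones f) (λ x → trans (∑-*ˡ (ones f) a (λ y → ⟦ mem T x ⟧ * (⟦ mem T y ⟧ * g x y))) (cong (a *_) (∑-*ˡ (ones f) ⟦ mem T x ⟧ (λ y → ⟦ mem T y ⟧ * g x y)))) ⟩
        (∑ (ones f) λ x → a * (⟦ mem T x ⟧ * ∑ (ones f) λ y → ⟦ mem T y ⟧ * g x y))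
          ≡⟨ ∑-*ˡ (ones f) a _ ⟩
        a * (∑ (ones f) λ x → ⟦ mem T x ⟧ * ∑ (ones f) λ y → ⟦ mem T y ⟧ * g x y)
          ≡⟨ cong (a *_) (trans (restrict _) (∑∈-cong T λ x → cong (⟦ f x ⟧ *_) (restrict (g x)))) ⟩
        a * U′ w ∎
        where
        open ≡-Reasoning
        g : Point n → Point n → ℕ
        g x y = ∑ P λ R → ⟦ not (f (splice x y w R)) ⟧
        split : ∀ x y → (∑ P λ R → ⟦ mem T x ∧ (mem T y ∧ not (f (splice x y w R))) ⟧) ≡ ⟦ mem T x ⟧ * (⟦ mem T y ⟧ * g x y)
        split x y = trans (∑-cong P λ R → trans (⟦∧⟧ (mem T x) _) (cong (⟦ mem T x ⟧ *_) (⟦∧⟧ (mem T y) _)))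
                          (trans (∑-*ˡ P ⟦ mem T x ⟧ _) (cong (⟦ mem T x ⟧ *_) (∑-*ˡ P ⟦ mem T y ⟧ _)))
        swap3 : ∀ a b c → a * (b * c) ≡ b * (a * c)
        swap3 = solve-∀
        restrict : (φ : Point n → ℕ) → ∑ (ones f) (λ x → ⟦ mem T x ⟧ * φ x) ≡ ∑∈ T λ x → ⟦ f x ⟧ * φ x
        restrict φ = trans (∑-ones f _) (∑-cong P λ x → swap3 ⟦ f x ⟧ ⟦ mem T x ⟧ (φ x))

      ∑∈-mono : {φ ψ : Point n → ℕ} → (∀ x → φ x ≤ ψ x) → ∑∈ T φ ≤ ∑∈ T ψ
      ∑∈-mono h = ∑-mono P λ x → *-monoʳ-≤ ⟦ mem T x ⟧ (h x)

      ∑∈-const : ∀ k → ∑∈ T (λ _ → k) ≡ τ * k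
      ∑∈-const k = trans (∑-*ʳ P k _) (cong (_* k) (size-count T))

      ∑∈-*ʳ : ∀ k (φ : Point n → ℕ) → ∑∈ T (λ x → φ x * k) ≡ ∑∈ T φ * k
      ∑∈-*ʳ k φ = trans (∑-cong P λ x → sym (*-assoc ⟦ mem T x ⟧ (φ x) k)) (∑-*ʳ P k _)

      inner-≤ : ∀ x y w → (∑ P λ R → ⟦ not (f (splice x y w R)) ⟧) ≤ 2ⁿ
      inner-≤ x y w = ≤-trans (∑-mono P λ R → ⟦⟧≤1 (not (f (splice x y w R)))) (≤-reflexive (trans (sym (length-∑ P)) (length-points n)))

      U′≤U : ∀ w → U′ w ≤ U w
      U′≤U w = ∑∈-mono λ x → ≤-trans (drop (f x) _) (∑∈-mono λ y → drop (f y) _)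
        where
        drop : ∀ b z → ⟦ b ⟧ * z ≤ z
        drop b z = ≤-trans (*-monoˡ-≤ z (⟦⟧≤1 b)) (≤-reflexive (*-identityˡ z))

      -- The discrepancy comes from pairs with `x` or `y` in the defect of `T`: at most `B * τ`
      -- pairs for either, with `2ⁿ` masks each.
      U≤U′ : ∀ w → U w ≤ U′ w + 2 * (B * τ * 2ⁿ)
      U≤U′ w = begin
        U w
          ≤⟨ ∑∈-mono outer ⟩
        (∑∈ T λ x → (⟦ f x ⟧ * ∑∈ T λ y → ⟦ f y ⟧ * g x y) + (B * 2ⁿ + ⟦ not (f x) ⟧ * (τ * 2ⁿ)))
          ≡⟨ trans (∑∈-+ T _ _) (cong (U′ w +_) (trans (∑∈-+ T _ _) (cong₂ _+_ (∑∈-const (B * 2ⁿ)) (∑∈-*ʳ (τ * 2ⁿ) _)))) ⟩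
        U′ w + (τ * (B * 2ⁿ) + B * (τ * 2ⁿ))
          ≡⟨ cong (U′ w +_) (r τ B 2ⁿ) ⟩
        U′ w + 2 * (B * τ * 2ⁿ) ∎
        where
        open ≤-Reasoning
        r : ∀ t b p → t * (b * p) + b * (t * p) ≡ 2 * (b * t * p)
        r = solve-∀
        g : Point n → Point n → ℕ
        g x y = ∑ P λ R → ⟦ not (f (splice x y w R)) ⟧
        inner : ∀ x y → g x y ≤ ⟦ f y ⟧ * g x y + ⟦ not (f y) ⟧ * 2ⁿ
        inner x y with f y
        ... | true  = ≤-trans (≤-reflexive (sym (*-identityˡ (g x y)))) (m≤m+n (1 * g x y) 0)
        ... | false = ≤-trans (inner-≤ x y w) (≤-reflexive (sym (*-identityˡ 2ⁿ)))
        row : ∀ x → ∑∈ T (g x) ≤ (∑∈ T λ y → ⟦ f y ⟧ * g x y) + B * 2ⁿ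
        row x = ≤-trans (∑∈-mono (inner x)) (≤-reflexive (trans (∑∈-+ T _ _) (cong ((∑∈ T λ y → ⟦ f y ⟧ * g x y) +_) (∑∈-*ʳ 2ⁿ _))))
        all : ∀ x → ∑∈ T (g x) ≤ τ * 2ⁿ
        all x = ≤-trans (∑∈-mono λ y → inner-≤ x y w) (≤-reflexive (∑∈-const 2ⁿ))
        outer : ∀ x → ∑∈ T (g x) ≤ (⟦ f x ⟧ * ∑∈ T λ y → ⟦ f y ⟧ * g x y) + (B * 2ⁿ + ⟦ not (f x) ⟧ * (τ * 2ⁿ))
        outer x with f x
        ... | true  = ≤-trans (row x) (≤-reflexive (cong₂ _+_ (sym (*-identityˡ _)) (sym (+-identityʳ (B * 2ⁿ)))))
        ... | false = ≤-trans (all x) (≤-trans (≤-reflexive (sym (*-identityˡ (τ * 2ⁿ)))) (m≤n+m (1 * (τ * 2ⁿ)) (B * 2ⁿ)))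

      U-inside : ∀ w → mem T w ≡ true → U w ≡ τ * 2ⁿ * B
      U-inside w e = *-cancelʳ-≡ (U w) (τ * 2ⁿ * B) τ ⦃ >-nonZero τ>0 ⦄ (begin
        U w * τ ≡⟨ cong (λ H → U w * size H) (sym (hull-mem T w e)) ⟩
        U w * size (hull T w) ≡⟨ splices-uniform T w _ ⟩
        τ * τ * 2ⁿ * defect (hull T w) ≡⟨ cong (λ H → τ * τ * 2ⁿ * defect H) (hull-mem T w e) ⟩
        τ * τ * 2ⁿ * B ≡⟨ r τ 2ⁿ B ⟩
        τ * 2ⁿ * B * τ ∎)
        where
        open ≡-Reasoning
        r : ∀ t p b → t * t * p * b ≡ t * p * b * t
        r = solve-∀

      -- If the hull respects the size bound, maximality says that its defect density exceeds its
      -- allowance, which is at least `2 ^ 7` times that of `T`. Otherwise it has more than `2 * a`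
      -- points, at least half of which lie outside `f`, and a density of `1/2` exceeds the same
      -- multiple because `256 * τ⁷ ≤ Z`.
      U-outside : ∀ w → mem T w ≡ false → 128 * (unit * 2ⁿ) ≤ U w * Z
      U-outside w e with h ≤? 2 * a
        where h = size (hull T w)
      ... | yes small = pos-cancel (size>0 (hull T w)) (begin
        128 * (τ * (τ * τ⁷) * 2ⁿ) * h ≡⟨ r₁ τ τ⁷ 2ⁿ h ⟩
        τ * τ * 2ⁿ * h * (128 * τ⁷) ≤⟨ *-monoʳ-≤ (τ * τ * 2ⁿ * h) (≤-trans (≤-reflexive (sym (^-distribʳ-* 7 2 τ))) (^-monoˡ-≤ 7 (hull-size T w e))) ⟩
        τ * τ * 2ⁿ * h * h ^ 7 ≡⟨ *-assoc (τ * τ * 2ⁿ) h (h ^ 7) ⟩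
        τ * τ * 2ⁿ * (h * h ^ 7) ≤⟨ *-monoʳ-≤ (τ * τ * 2ⁿ) (<⇒≤ bad) ⟩
        τ * τ * 2ⁿ * (defect (hull T w) * Z) ≡⟨ sym (*-assoc (τ * τ * 2ⁿ) _ Z) ⟩
        τ * τ * 2ⁿ * defect (hull T w) * Z ≡⟨ cong (_* Z) (sym (splices-uniform T w _)) ⟩
        U w * h * Z ≡⟨ r₂ (U w) h Z ⟩
        U w * Z * h ∎)
        where
        open ≤-Reasoning
        h = size (hull T w)
        bad : h * h ^ 7 < defect (hull T w) * Z
        bad = ≤ᵇ-false⁻¹ {defect (hull T w) * Z} (trans (sym (cong (_∧ (defect (hull T w) * Z ≤ᵇ h * h ^ 7)) (≤ᵇ-true small))) (maximal w e))
        r₁ : ∀ x y p h → 128 * (x * (x * y) * p) * h ≡ x * x * p * h * (128 * y)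
        r₁ = solve-∀
        r₂ : ∀ u h z → u * h * z ≡ u * z * h
        r₂ = solve-∀
      ... | no large = *-cancelˡ-≤ 2 (pos-cancel (size>0 (hull T w)) (begin
        2 * (128 * (τ * (τ * τ⁷) * 2ⁿ)) * h ≡⟨ r₁ τ τ⁷ 2ⁿ h ⟩
        τ * τ * 2ⁿ * (h * (256 * τ⁷)) ≤⟨ *-monoʳ-≤ (τ * τ * 2ⁿ) (*-mono-≤ half 256τ⁷≤Z) ⟩
        τ * τ * 2ⁿ * (2 * D * Z) ≡⟨ r₂ (τ * τ * 2ⁿ) D Z ⟩
        2 * (τ * τ * 2ⁿ * D * Z) ≡⟨ cong (λ z → 2 * (z * Z)) (sym (splices-uniform T w _)) ⟩
        2 * (U w * h * Z) ≡⟨ r₃ (U w) h Z ⟩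
        2 * (U w * Z) * h ∎))
        where
        open ≤-Reasoning
        h = size (hull T w)
        D = defect (hull T w)
        half : h ≤ 2 * D
        half = +-cancelˡ-≤ h _ _ (begin
          h + h ≤⟨ +-mono-≤ (size-defect (hull T w)) (size-defect (hull T w)) ⟩
          a + D + (a + D) ≡⟨ q a D ⟩
          2 * a + 2 * D ≤⟨ +-monoˡ-≤ (2 * D) (<⇒≤ (≰⇒> large)) ⟩
          h + 2 * D ∎)
          where
          q : ∀ a d → a + d + (a + d) ≡ 2 * a + 2 * d
          q = solve-∀
        r₁ : ∀ x y p h → 2 * (128 * (x * (x * y) * p)) * h ≡ x * x * p * (h * (256 * y))
        r₁ = solve-∀
        r₂ : ∀ x d z → x * (2 * d * z) ≡ 2 * (x * d * z)
        r₂ = solve-∀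
        r₃ : ∀ u h z → 2 * (u * h * z) ≡ 2 * (u * z) * h
        r₃ = solve-∀

      inside : ∀ w → mem T w ≡ true → 6 * (m * missCount T w) ≤ W
      inside w e = pos-cancel Z>0 (begin
        6 * (m * missCount T w) * Z ≡⟨ cong (λ z → 6 * (m * z) * Z) (missCount-U′ w) ⟩
        6 * (m * (a * U′ w)) * Z ≤⟨ *-monoˡ-≤ Z (*-monoʳ-≤ 6 (*-monoʳ-≤ m (*-monoʳ-≤ a (≤-trans (U′≤U w) (≤-reflexive (U-inside w e)))))) ⟩
        6 * (m * (a * (τ * 2ⁿ * B))) * Z ≡⟨ r₁ m a τ 2ⁿ B Z ⟩
        m * (6 * (τ * (B * Z))) * (a * 2ⁿ) ≤⟨ *-monoˡ-≤ (a * 2ⁿ) (≤-trans (*-monoʳ-≤ m (*-monoʳ-≤ 6 (*-monoʳ-≤ τ BZ))) (proj₁ (proj₂ scales))) ⟩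
        a * a * Z * (a * 2ⁿ) ≡⟨ r₂ a Z 2ⁿ ⟩
        a * (a * (a * 2ⁿ)) * Z ≡⟨ cong (_* Z) (sym (length-Ω f)) ⟩
        W * Z ∎)
        where
        open ≤-Reasoning
        r₁ : ∀ m a t p b z → 6 * (m * (a * (t * p * b))) * z ≡ m * (6 * (t * (b * z))) * (a * p)
        r₁ = solve-∀
        r₂ : ∀ a z p → a * a * z * (a * p) ≡ a * (a * (a * p)) * z
        r₂ = solve-∀

      -- Here the exponent 7 is decided: the tail constants 10 and 6 and the rounding of `m` require
      -- a gap of `10 * 6 * 2 = 120`, the passage from `U` to `U′` costs 2 more, and `2 ^ 7 = 128`
      -- suffices.
      outside : ∀ w → mem T w ≡ false → 10 * W ≤ m * missCount T w
      outside w e = pos-cancel Z>0 (begin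
        10 * W * Z ≡⟨ cong (λ z → 10 * z * Z) (length-Ω f) ⟩
        10 * (a * (a * (a * 2ⁿ))) * Z ≡⟨ r₁ a 2ⁿ Z ⟩
        10 * (a * a * Z) * (a * 2ⁿ) ≤⟨ *-monoˡ-≤ (a * 2ⁿ) (*-monoʳ-≤ 10 (proj₂ (proj₂ scales))) ⟩
        10 * (2 * (m * (6 * unit))) * (a * 2ⁿ) ≡⟨ r₂ m unit a 2ⁿ ⟩
        m * a * (120 * (unit * 2ⁿ)) ≤⟨ *-monoʳ-≤ (m * a) (≤-trans (*-monoˡ-≤ (unit * 2ⁿ) (m≤m+n 120 6)) U′Z) ⟩
        m * a * (U′ w * Z) ≡⟨ r₃ m a (U′ w) Z ⟩
        m * (a * U′ w) * Z ≡⟨ cong (λ z → m * z * Z) (sym (missCount-U′ w)) ⟩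
        m * missCount T w * Z ∎)
        where
        open ≤-Reasoning
        r₁ : ∀ a p z → 10 * (a * (a * (a * p))) * z ≡ 10 * (a * a * z) * (a * p)
        r₁ = solve-∀
        r₂ : ∀ m u a p → 10 * (2 * (m * (6 * u))) * (a * p) ≡ m * a * (120 * (u * p))
        r₂ = solve-∀
        r₃ : ∀ m a u z → m * a * (u * z) ≡ m * (a * u) * z
        r₃ = solve-∀
        r₄ : ∀ x → 126 * x + 2 * x ≡ 128 * x
        r₄ = solve-∀
        r₅ : ∀ u b t p z → (u + 2 * (b * t * p)) * z ≡ u * z + 2 * (t * (b * z) * p)
        r₅ = solve-∀
        U′Z : 126 * (unit * 2ⁿ) ≤ U′ w * Z
        U′Z = +-cancelʳ-≤ (2 * (unit * 2ⁿ)) _ _ (begin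
          126 * (unit * 2ⁿ) + 2 * (unit * 2ⁿ) ≡⟨ r₄ (unit * 2ⁿ) ⟩
          128 * (unit * 2ⁿ) ≤⟨ U-outside w e ⟩
          U w * Z ≤⟨ *-monoˡ-≤ Z (U≤U′ w) ⟩
          (U′ w + 2 * (B * τ * 2ⁿ)) * Z ≡⟨ r₅ (U′ w) B τ 2ⁿ Z ⟩
          U′ w * Z + 2 * (τ * (B * Z) * 2ⁿ) ≤⟨ +-monoʳ-≤ (U′ w * Z) (*-monoʳ-≤ 2 (*-monoˡ-≤ 2ⁿ (*-monoʳ-≤ τ BZ))) ⟩
          U′ w * Z + 2 * (unit * 2ⁿ) ∎)

      -- The third sample takes the role of `w`; as it lies in `T`, the hull is `T` itself and the
      -- splice is uniform there.
      escapes-≤ : escapes T ≤ τ * (τ * 2ⁿ * B)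
      escapes-≤ = begin
        escapes T
          ≡⟨ ∑-Ω f _ ⟩
        (∑ (ones f) λ x → ∑ (ones f) λ y → ∑ (ones f) λ y′ → ∑ P λ R → ⟦ mem T x ∧ (mem T y ∧ (mem T y′ ∧ not (f (splice x y y′ R)))) ⟧)
          ≤⟨ ≤-trans (ones≤ _) (∑-mono P λ x → ≤-trans (ones≤ _) (∑-mono P λ y → ones≤ _)) ⟩
        (∑ P λ x → ∑ P λ y → ∑ P λ w → ∑ P λ R → ⟦ mem T x ∧ (mem T y ∧ (mem T w ∧ not (f (splice x y w R)))) ⟧)
          ≡⟨ trans (∑-cong P λ x → ∑-swap P P _) (∑-swap P P _) ⟩
        (∑ P λ w → ∑ P λ x → ∑ P λ y → ∑ P λ R → ⟦ mem T x ∧ (mem T y ∧ (mem T w ∧ not (f (splice x y w R)))) ⟧)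
          ≡⟨ ∑-cong P pull ⟩
        (∑ P λ w → ⟦ mem T w ⟧ * U w)
          ≡⟨ ∑-cong P inU ⟩
        ∑∈ T (λ w → τ * 2ⁿ * B)
          ≡⟨ ∑∈-const (τ * 2ⁿ * B) ⟩
        τ * (τ * 2ⁿ * B) ∎
        where
        open ≤-Reasoning
        ones≤ : (φ : Point n → ℕ) → ∑ (ones f) φ ≤ ∑ P φ
        ones≤ φ = ≤-trans (≤-reflexive (∑-ones f φ)) (∑-mono P λ x → ≤-trans (*-monoˡ-≤ (φ x) (⟦⟧≤1 (f x))) (≤-reflexive (*-identityˡ (φ x))))
        inU : ∀ w → ⟦ mem T w ⟧ * U w ≡ ⟦ mem T w ⟧ * (τ * 2ⁿ * B)
        inU w with mem T w in e
        ... | false = refl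
        ... | true  = cong (1 *_) (U-inside w e)
        perm : ∀ a b c d → a * (b * (c * d)) ≡ c * (a * (b * d))
        perm = solve-∀
        pull : ∀ w → (∑ P λ x → ∑ P λ y → ∑ P λ R → ⟦ mem T x ∧ (mem T y ∧ (mem T w ∧ not (f (splice x y w R)))) ⟧) ≡ ⟦ mem T w ⟧ * U w
        pull w =
          trans (∑-cong P λ x → trans (∑-cong P λ y → trans (∑-cong P λ R →
                   trans (⟦∧⟧ (mem T x) _) (trans (cong (⟦ mem T x ⟧ *_) (trans (⟦∧⟧ (mem T y) _) (cong (⟦ mem T y ⟧ *_) (⟦∧⟧ (mem T w) _)))) (perm ⟦ mem T x ⟧ ⟦ mem T y ⟧ ⟦ mem T w ⟧ _)))
                   (trans (∑-*ˡ P ⟦ mem T w ⟧ _) (cong (⟦ mem T w ⟧ *_) (trans (∑-*ˡ P ⟦ mem T x ⟧ _) (cong (⟦ mem T x ⟧ *_) (∑-*ˡ P ⟦ mem T y ⟧ _))))))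
                   (trans (∑-*ˡ P ⟦ mem T w ⟧ _) (cong (⟦ mem T w ⟧ *_) (∑-*ˡ P ⟦ mem T x ⟧ _))))
          (∑-*ˡ P ⟦ mem T w ⟧ _)

      closed : escapes T * G ≤ W
      closed = pos-cancel Z>0 (begin
        escapes T * G * Z ≤⟨ *-monoˡ-≤ Z (*-monoˡ-≤ G escapes-≤) ⟩
        τ * (τ * 2ⁿ * B) * G * Z ≡⟨ r₁ τ 2ⁿ B G Z ⟩
        τ * τ * (2ⁿ * G) * (B * Z) ≤⟨ *-monoʳ-≤ (τ * τ * (2ⁿ * G)) BZ ⟩
        τ * τ * (2ⁿ * G) * (τ * τ⁷) ≡⟨ r₂ τ 2ⁿ G τ⁷ ⟩
        τ * τ * τ * (2ⁿ * (G * τ⁷)) ≤⟨ *-monoˡ-≤ (2ⁿ * (G * τ⁷)) (*-mono-≤ (*-mono-≤ τ≤2a τ≤2a) τ≤2a) ⟩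
        2 * a * (2 * a) * (2 * a) * (2ⁿ * (G * τ⁷)) ≡⟨ r₃ a 2ⁿ G τ⁷ ⟩
        a * (a * (a * 2ⁿ)) * (8 * G * τ⁷) ≤⟨ *-monoʳ-≤ (a * (a * (a * 2ⁿ))) (≤-trans (*-monoˡ-≤ τ⁷ (*-monoˡ-≤ G (m≤m+n 8 248))) Z-big) ⟩
        a * (a * (a * 2ⁿ)) * Z ≡⟨ cong (_* Z) (sym (length-Ω f)) ⟩
        W * Z ∎)
        where
        open ≤-Reasoning
        r₁ : ∀ t p b g z → t * (t * p * b) * g * z ≡ t * t * (p * g) * (b * z)
        r₁ = solve-∀
        r₂ : ∀ t p g y → t * t * (p * g) * (t * y) ≡ t * t * t * (p * (g * y))
        r₂ = solve-∀
        r₃ : ∀ a p g y → 2 * a * (2 * a) * (2 * a) * (p * (g * y)) ≡ a * (a * (a * p)) * (8 * g * y)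
        r₃ = solve-∀

      implicant : Implicant
      implicant = record
        { cube = T ; scale = m ; scale-≤ = ≤-trans (*-monoˡ-≤ K₀ m-≤) M-big
        ; inside = inside ; outside = outside ; closed = closed }

    fromTerm : ∀ T₀ → (∀ x → mem T₀ x ≡ true → f x ≡ true) → a ≤ t * size T₀ →
               Σ Implicant λ I → ∀ x → mem T₀ x ≡ true → mem (Implicant.cube I) x ≡ true
    fromTerm T₀ T₀⊆f heavy with FromTerm.grown T₀ T₀⊆f
    ... | T , T⊇T₀ , T-good , maximal = Scaled.implicant T₀ T heavy T⊇T₀ T-good maximal , T⊇T₀

  -- Completeness

  anyᵇ-∈ : {X : Set} (p : X → Bool) {L : List X} {x : X} → x ∈ L → p x ≡ true → anyᵇ p L ≡ true
  anyᵇ-∈ p {x ∷ L} (here refl) e = cong (_∨ anyᵇ p L) e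
  anyᵇ-∈ p {y ∷ L} (there i)   e = trans (cong (p y ∨_) (anyᵇ-∈ p i e)) (∨-zeroʳ (p y))

  ∈-⊗ : {X Y : Set} {L : List X} {K : List Y} {x : X} {y : Y} → x ∈ L → y ∈ K → (x , y) ∈ L ⊗ K
  ∈-⊗ {L = x ∷ L} {K} (here refl) j = ∈-++⁺ˡ (∈-map⁺ (x ,_) j)
  ∈-⊗ {L = x ∷ L} {K} (there i)   j = ∈-++⁺ʳ (map (x ,_) K) (∈-⊗ i j)

  ∈-allPoints : ∀ {n} (x : Point n) → x ∈ allPoints n
  ∈-allPoints []                  = here refl
  ∈-allPoints (true ∷ x)          = ∈-++⁺ˡ (∈-map⁺ (true ∷_) (∈-allPoints x))
  ∈-allPoints {suc n} (false ∷ x) = ∈-++⁺ʳ (map (true ∷_) (allPoints n)) (∈-map⁺ (false ∷_) (∈-allPoints x))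

  ∈-listsUpTo : ∀ {M} s (H : List (Point M)) → length H ≤ s → H ∈ listsUpTo (allPoints M) s
  ∈-listsUpTo zero    []      l       = here refl
  ∈-listsUpTo (suc s) []      l       = here refl
  ∈-listsUpTo (suc s) (Θ ∷ H) (s≤s l) = there (∈-map⁺ (λ p → proj₁ p ∷ proj₂ p) (∈-⊗ (∈-allPoints Θ) (∈-listsUpTo s H l)))

  ∑-hits : {X : Set} (L : List X) (ξ : X → Bool) (N : ℕ) →
           (∑ (vecs L N) λ v → hits ξ 𝟏 v) * length L ≡ N * length L ^ N * ∑ L (λ x → ⟦ ξ x ⟧)
  ∑-hits L ξ zero    = refl
  ∑-hits L ξ (suc N) = begin
    (∑ (vecs L (suc N)) λ v → hits ξ 𝟏 v) * W
      ≡⟨ cong (_* W) (trans (∑-vecs L N _) (∑-cong L λ x → trans (∑-+ (vecs L N) _ _) (cong (_+ S) (trans (∑-const (vecs L N) ⟦ ξ x ⟧) (cong (_* ⟦ ξ x ⟧) (length-vecs L N)))))) ⟩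
    (∑ L λ x → W ^ N * ⟦ ξ x ⟧ + S) * W
      ≡⟨ cong (_* W) (trans (∑-+ L _ _) (cong₂ _+_ (∑-*ˡ L (W ^ N) _) (∑-const L S))) ⟩
    (W ^ N * p + W * S) * W
      ≡⟨ r₁ (W ^ N) p W S ⟩
    W * W ^ N * p + W * (S * W)
      ≡⟨ cong (λ z → W * W ^ N * p + W * z) (∑-hits L ξ N) ⟩
    W * W ^ N * p + W * (N * W ^ N * p)
      ≡⟨ r₂ W (W ^ N) N p ⟩
    suc N * (W * W ^ N) * p ∎
    where
    open ≡-Reasoning
    W = length L
    p = ∑ L (λ x → ⟦ ξ x ⟧)
    S = ∑ (vecs L N) λ v → hits ξ 𝟏 v
    r₁ : ∀ y p w s → (y * p + w * s) * w ≡ w * y * p + w * (s * w)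
    r₁ = solve-∀
    r₂ : ∀ w y n p → w * y * p + w * (n * y * p) ≡ (1 + n) * (w * y) * p
    r₂ = solve-∀

  covered-term : ∀ p q m r → (p ≡ true → m ≡ true) → ⟦ p ∨ q ⟧ * ⟦ not (m ∨ r) ⟧ ≤ ⟦ q ⟧ * ⟦ not r ⟧
  covered-term p     q true  r i = ≤-trans (≤-reflexive (*-zeroʳ ⟦ p ∨ q ⟧)) z≤n
  covered-term false q false r i = ≤-refl
  covered-term true  q false r i = ⊥-elim (false≢true (i refl))

  not-accepted : ∀ v b k → ((b ≤ᵇ k) ≡ true → v ≡ true) → ⟦ not v ⟧ * suc k ≤ b
  not-accepted true  b k i = z≤n
  not-accepted false b k i with b ≤ᵇ k in e
  ... | true  = ⊥-elim (false≢true (i refl))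
  ... | false = ≤-trans (≤-reflexive (*-identityˡ (suc k))) (≤ᵇ-false⁻¹ {b} e)

  ⊻-true : ∀ b → b ⊻ true ≡ not b
  ⊻-true true  = refl
  ⊻-true false = refl

  ⊻-false : ∀ b → b ⊻ false ≡ b
  ⊻-false true  = refl
  ⊻-false false = refl

  covered-step : ∀ b p m c c′ Z → ⟦ not c ⟧ ≤ ⟦ not b ⟧ + ⟦ not c′ ⟧ + Z → ⟦ not (b ∧ p ∨ c) ⟧ ≤ ⟦ not b ⟧ + ⟦ not (m ∨ c′) ⟧ + (⟦ p ⊻ m ⟧ + Z)
  covered-step false p     m     c c′ Z h = ≤-trans (⟦⟧≤1 (not c)) (s≤s z≤n)
  covered-step true  true  m     c c′ Z h = z≤n
  covered-step true  false true  c c′ Z h = ≤-trans (⟦⟧≤1 (not c)) (s≤s z≤n)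
  covered-step true  false false c c′ Z h = h

  -- If `x`, `y`, `y′` and the splice are all labelled according to the cube, a violation puts the
  -- first three in the cube, hence the splice too by `i`; it can then only lack the label by lying
  -- outside `f`, which is an escape.
  violated-step : ∀ bx px mx by py my bz pz mz bw pw mw →
    (mx ≡ true → my ≡ true → mz ≡ true → mw ≡ true) →
    ⟦ (bx ∧ px) ∧ (by ∧ py) ∧ (bz ∧ pz) ∧ not (bw ∧ pw) ⟧
    ≤ ⟦ px ⊻ mx ⟧ + ⟦ py ⊻ my ⟧ + ⟦ pz ⊻ mz ⟧ + ⟦ pw ⊻ mw ⟧ + ⟦ mx ∧ (my ∧ (mz ∧ not bw)) ⟧
  violated-step false px    mx    by    py    my    bz    pz    mz    bw    pw    mw    i = z≤n
  violated-step true  false mx    by    py    my    bz    pz    mz    bw    pw    mw    i = z≤n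
  violated-step true  true  mx    false py    my    bz    pz    mz    bw    pw    mw    i = z≤n
  violated-step true  true  mx    true  false my    bz    pz    mz    bw    pw    mw    i = z≤n
  violated-step true  true  mx    true  true  my    false pz    mz    bw    pw    mw    i = z≤n
  violated-step true  true  mx    true  true  my    true  false mz    bw    pw    mw    i = z≤n
  violated-step true  true  false true  true  my    true  true  mz    bw    pw    mw    i = ≤-trans (⟦⟧≤1 (not (bw ∧ pw))) (s≤s z≤n)
  violated-step true  true  true  true  true  false true  true  mz    bw    pw    mw    i = ≤-trans (⟦⟧≤1 (not (bw ∧ pw))) (s≤s z≤n)
  violated-step true  true  true  true  true  true  true  true  false bw    pw    mw    i = ≤-trans (⟦⟧≤1 (not (bw ∧ pw))) (s≤s z≤n)
  violated-step true  true  true  true  true  true  true  true  true  false pw    mw    i = m≤n+m 1 _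
  violated-step true  true  true  true  true  true  true  true  true  true  true  mw    i = z≤n
  violated-step true  true  true  true  true  true  true  true  true  true  false mw    i = ≤-reflexive (cong (λ m → ⟦ m ⟧ + 0) (sym (i refl refl refl)))

  module Complete {n : ℕ} (f : BoolFun n) (a>0 : 0 < count1 f) (t κ G K₀ M : ℕ) (G>0 : 0 < G)
                  (κ-big : 32768 * G * t ^ 7 ≤ κ) (M-big : t * t * κ * K₀ ≤ M) where
    open Heavy f a>0 t κ G K₀ M G>0 κ-big M-big
    open Implicant

    W>0 : 0 < W
    W>0 = Ω-nonempty f a>0

    inCubes : List Implicant → Point n → Bool
    inCubes Is x = anyᵇ (λ I → mem (cube I) x) Is

    record Cover (g : Point n → Bool) (l : ℕ) : Set where
      field
        implicants : List Implicant
        number     : length implicants ≤ l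
        light      : (∑ P λ x → ⟦ g x ⟧ * ⟦ not (inCubes implicants x) ⟧) * t ≤ l * a
    open Cover

    -- A contradictory term is set aside since `termCube` does not describe it. A term with fewer
    -- than `a / t` points is charged to `light`; any other is heavy enough for `fromTerm` and is
    -- covered completely.
    addTerm : ∀ (T : Term n) {g l} → (∀ x → evalTerm T x ≡ true → f x ≡ true) → Cover g l →
              (∃ λ x → evalTerm T x ≡ true) ⊎ (∀ x → evalTerm T x ≡ false) → Cover (λ x → evalTerm T x ∨ g x) (suc l)
    addTerm T {g} {l} sub rest (inj₂ unsat) = record
      { implicants = implicants rest
      ; number     = m≤n⇒m≤1+n (number rest)
      ; light      = ≤-trans (*-monoˡ-≤ t (≤-reflexive (∑-cong P λ x → cong (λ b → ⟦ b ∨ g x ⟧ * ⟦ not (inCubes (implicants rest) x) ⟧) (unsat x))))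
                     (≤-trans (light rest) (m≤n+m (l * a) a))
      }
    addTerm T {g} {l} sub rest (inj₁ (x₀ , sat)) with a ≤? t * size (termCube T)
    ... | no small = record
      { implicants = implicants rest
      ; number     = m≤n⇒m≤1+n (number rest)
      ; light      = ≤-trans (*-monoˡ-≤ t (≤-trans (∑-mono P λ x → ∨-∖ (evalTerm T x) (g x) (inCubes (implicants rest) x)) (≤-reflexive (∑-+ P _ _))))
                     (≤-trans (≤-reflexive (*-distribʳ-+ t (∑ P λ x → ⟦ evalTerm T x ⟧) _)) (+-mono-≤ term-small (light rest)))
      }
      where
      term-size : (∑ P λ x → ⟦ evalTerm T x ⟧) ≡ size (termCube T)
      term-size = trans (∑-cong P λ x → cong ⟦_⟧ (sym (mem-termCube T x₀ sat x))) (size-count (termCube T))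
      term-small : (∑ P λ x → ⟦ evalTerm T x ⟧) * t ≤ a
      term-small = ≤-trans (≤-reflexive (trans (cong (_* t) term-size) (*-comm (size (termCube T)) t))) (<⇒≤ (≰⇒> small))
    ... | yes heavy = record
      { implicants = proj₁ I ∷ implicants rest
      ; number     = s≤s (number rest)
      ; light      = ≤-trans (*-monoˡ-≤ t (∑-mono P λ x → covered-term (evalTerm T x) (g x) (mem (cube (proj₁ I)) x) (inCubes (implicants rest) x)
                                                            (λ e → proj₂ I x (trans (mem-termCube T x₀ sat x) e))))
                     (≤-trans (light rest) (m≤n+m (l * a) a))
      }
      where
      I = fromTerm (termCube T) (λ x e → sub x (trans (sym (mem-termCube T x₀ sat x)) e)) heavy

    cover : ∀ (d : DNF n) → (∀ x → evalDNF d x ≡ true → f x ≡ true) → Cover (evalDNF d) (length d)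
    cover []      sub = record { implicants = [] ; number = z≤n ; light = ≤-reflexive (cong (_* t) (trans (∑-const P 0) (*-zeroʳ (length P)))) }
    cover (T ∷ d) sub = addTerm T (λ x e → sub x (cong (_∨ evalDNF d x) e)) (cover d λ x e → sub x (trans (cong (evalTerm T x ∨_) e) (∨-zeroʳ _))) (findPoint (evalTerm T))

    maskOf : (I : Implicant) → Σ (Vec Bool M) λ v → trues v ≡ scale I * K₀
    maskOf I = mask M (scale I * K₀) (scale-≤ I)

    select : ∀ {k} → Cube n → Vec Bool k → Vec (Draw n) k → Vec Bool k
    select T []       []                     = []
    select T (b ∷ bs) ((x , y , _ , _) ∷ 𝒬) = (b ∧ (mem T x ∧ mem T y)) ∷ select T bs 𝒬

    hypothesis : Vec (Draw n) M → Implicant → Vec Bool M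
    hypothesis 𝒬 I = select (cube I) (proj₁ (maskOf I)) 𝒬

    -- The selected subset depends on the seeds, which would spoil independence. But its misses are
    -- the hits of `ξ` on a mask fixed beforehand, and to those the tail bounds apply.
    misses-select : ∀ {k} T (bs : Vec Bool k) (𝒬 : Vec (Draw n) k) w →
      misses (select T bs 𝒬) (Vec.map f (Vec.map (λ (x , y , _ , R) → splice x y w R) 𝒬)) ≡ hits (ξ T w) bs 𝒬
    misses-select T []       []                     w = refl
    misses-select T (b ∷ bs) ((x , y , _ , R) ∷ 𝒬) w =
      cong₂ _+_ (cong ⟦_⟧ (trans (∧-assoc b _ _) (cong (b ∧_) (∧-assoc (mem T x) (mem T y) _)))) (misses-select T bs 𝒬 w)

    passing : Implicant → Point n → Vec (Draw n) M → Bool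
    passing I w 𝒬 = hits (ξ (cube I) w) (proj₁ (maskOf I)) 𝒬 ≤ᵇ K₀

    mislabelled : Implicant → Point n → Vec (Draw n) M → Bool
    mislabelled I w 𝒬 = passing I w 𝒬 ⊻ mem (cube I) w

    label-passing : ∀ 𝒬 I w → label K₀ (hypothesis 𝒬 I) (observe f 𝒬 w) ≡ f w ∧ passing I w 𝒬
    label-passing 𝒬 I w = cong (λ z → f w ∧ (z ≤ᵇ K₀)) (misses-select (cube I) (proj₁ (maskOf I)) 𝒬 w)

    mislabelled-rare : ∀ I w → (∑ (vecs (Ω f) M) λ 𝒬 → ⟦ mislabelled I w 𝒬 ⟧) * 2 ^ K₀ ≤ W ^ M
    mislabelled-rare I w with mem (cube I) w in e
    ... | true  = ≤-trans (≤-reflexive (cong (_* 2 ^ K₀) (∑-cong (vecs (Ω f) M) λ 𝒬 → cong ⟦_⟧ (⊻-true (passing I w 𝒬)))))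
                          (upper-tail (Ω f) (ξ (cube I) w) (proj₁ (maskOf I)) (scale I) K₀ W>0 (proj₂ (maskOf I)) (inside I w e))
    ... | false = ≤-trans (≤-reflexive (cong (_* 2 ^ K₀) (∑-cong (vecs (Ω f) M) λ 𝒬 → cong ⟦_⟧ (⊻-false (passing I w 𝒬)))))
                          (lower-tail (Ω f) (ξ (cube I) w) (proj₁ (maskOf I)) (scale I) K₀ W>0 (proj₂ (maskOf I)) (outside I w e))

    escaping : Implicant → Draw n → Bool
    escaping I (x , y , y′ , R) = mem (cube I) x ∧ (mem (cube I) y ∧ (mem (cube I) y′ ∧ not (f (splice x y y′ R))))

    -- The point `x` counts twice: a wrong label on it can leave the trial uncovered as well as
    -- cause a violation.
    errors : Implicant → Draw n → Vec (Draw n) M → ℕ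
    errors I (x , y , y′ , R) 𝒬 = 2 * ⟦ mislabelled I x 𝒬 ⟧ + ⟦ mislabelled I y 𝒬 ⟧ + ⟦ mislabelled I y′ 𝒬 ⟧ + ⟦ mislabelled I (splice x y y′ R) 𝒬 ⟧

    flaws : Implicant → Draw n → Vec (Draw n) M → ℕ
    flaws I ω@(x , y , y′ , R) 𝒬 = ⟦ mislabelled I x 𝒬 ⟧ + ⟦ mislabelled I y 𝒬 ⟧ + ⟦ mislabelled I y′ 𝒬 ⟧ + ⟦ mislabelled I (splice x y y′ R) 𝒬 ⟧ + ⟦ escaping I ω ⟧

    errors-rare : ∀ I ω → (∑ (vecs (Ω f) M) (errors I ω)) * 2 ^ K₀ ≤ 5 * W ^ M
    errors-rare I (x , y , y′ , R) = begin
      (∑ Q (errors I (x , y , y′ , R))) * 2 ^ K₀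
        ≡⟨ cong (_* 2 ^ K₀) (trans (∑-+ Q _ _) (cong (_+ ∑ Q (m (splice x y y′ R))) (trans (∑-+ Q _ _) (cong (_+ ∑ Q (m y′)) (trans (∑-+ Q _ _) (cong (_+ ∑ Q (m y)) (∑-*ˡ Q 2 (m x)))))))) ⟩
      (2 * ∑ Q (m x) + ∑ Q (m y) + ∑ Q (m y′) + ∑ Q (m (splice x y y′ R))) * 2 ^ K₀
        ≡⟨ r (∑ Q (m x)) (∑ Q (m y)) (∑ Q (m y′)) (∑ Q (m (splice x y y′ R))) (2 ^ K₀) ⟩
      2 * (∑ Q (m x) * 2 ^ K₀) + ∑ Q (m y) * 2 ^ K₀ + ∑ Q (m y′) * 2 ^ K₀ + ∑ Q (m (splice x y y′ R)) * 2 ^ K₀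
        ≤⟨ +-mono-≤ (+-mono-≤ (+-mono-≤ (*-monoʳ-≤ 2 (mislabelled-rare I x)) (mislabelled-rare I y)) (mislabelled-rare I y′)) (mislabelled-rare I (splice x y y′ R)) ⟩
      2 * W ^ M + W ^ M + W ^ M + W ^ M
        ≡⟨ r₂ (W ^ M) ⟩
      5 * W ^ M ∎
      where
      open ≤-Reasoning
      Q = vecs (Ω f) M
      m : Point n → Vec (Draw n) M → ℕ
      m w 𝒬 = ⟦ mislabelled I w 𝒬 ⟧
      r : ∀ a b c d k → (2 * a + b + c + d) * k ≡ 2 * (a * k) + b * k + c * k + d * k
      r = solve-∀
      r₂ : ∀ a → 2 * a + a + a + a ≡ 5 * a
      r₂ = solve-∀

    uncovered-≤ : ∀ 𝒬 x Is → ⟦ not (anyᵇ (λ Θ → label K₀ Θ (observe f 𝒬 x)) (map (hypothesis 𝒬) Is)) ⟧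
                  ≤ ⟦ not (f x) ⟧ + ⟦ not (inCubes Is x) ⟧ + ∑ Is λ I → ⟦ mislabelled I x 𝒬 ⟧
    uncovered-≤ 𝒬 x []       = ≤-trans (m≤n+m 1 ⟦ not (f x) ⟧) (m≤m+n (⟦ not (f x) ⟧ + 1) 0)
    uncovered-≤ 𝒬 x (I ∷ Is) = ≤-trans
      (≤-reflexive (cong (λ b → ⟦ not (b ∨ anyᵇ (λ Θ → label K₀ Θ (observe f 𝒬 x)) (map (hypothesis 𝒬) Is)) ⟧) (label-passing 𝒬 I x)))
      (covered-step (f x) (passing I x 𝒬) (mem (cube I) x) _ (inCubes Is x) _ (uncovered-≤ 𝒬 x Is))

    violated-≤ : ∀ 𝒬 x y y′ R Is →
      ⟦ anyᵇ (λ Θ → label K₀ Θ (observe f 𝒬 x) ∧ label K₀ Θ (observe f 𝒬 y) ∧ label K₀ Θ (observe f 𝒬 y′) ∧ not (label K₀ Θ (observe f 𝒬 (splice x y y′ R)))) (map (hypothesis 𝒬) Is) ⟧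
      ≤ ∑ Is λ I → flaws I (x , y , y′ , R) 𝒬
    violated-≤ 𝒬 x y y′ R []       = z≤n
    violated-≤ 𝒬 x y y′ R (I ∷ Is) = ≤-trans (∨-⟦⟧-+ (v I) _) (+-mono-≤ one (violated-≤ 𝒬 x y y′ R Is))
      where
      w = splice x y y′ R
      T = cube I
      v : Implicant → Bool
      v I = label K₀ (hypothesis 𝒬 I) (observe f 𝒬 x) ∧ label K₀ (hypothesis 𝒬 I) (observe f 𝒬 y) ∧ label K₀ (hypothesis 𝒬 I) (observe f 𝒬 y′) ∧ not (label K₀ (hypothesis 𝒬 I) (observe f 𝒬 w))
      v≡ : v I ≡ (f x ∧ passing I x 𝒬) ∧ (f y ∧ passing I y 𝒬) ∧ (f y′ ∧ passing I y′ 𝒬) ∧ not (f w ∧ passing I w 𝒬)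
      v≡ = cong₂ _∧_ (label-passing 𝒬 I x) (cong₂ _∧_ (label-passing 𝒬 I y) (cong₂ _∧_ (label-passing 𝒬 I y′) (cong not (label-passing 𝒬 I w))))
      one : ⟦ v I ⟧ ≤ flaws I (x , y , y′ , R) 𝒬
      one = ≤-trans (≤-reflexive (cong ⟦_⟧ v≡))
            (violated-step (f x) (passing I x 𝒬) (mem T x) (f y) (passing I y 𝒬) (mem T y) (f y′) (passing I y′ 𝒬) (mem T y′) (f w) (passing I w 𝒬) (mem T w)
               (mem-splice T x y y′ R))

    bad-≤ : ∀ Is 𝒬 ω → ⟦ badDraw f K₀ 𝒬 (map (hypothesis 𝒬) Is) ω ⟧
            ≤ ⟦ not (f (proj₁ ω)) ⟧ + ⟦ not (inCubes Is (proj₁ ω)) ⟧ + ∑ Is λ I → errors I ω 𝒬 + ⟦ escaping I ω ⟧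
    bad-≤ Is 𝒬 ω@(x , y , y′ , R) = begin
      ⟦ badDraw f K₀ 𝒬 (map (hypothesis 𝒬) Is) ω ⟧
        ≤⟨ ∨-⟦⟧-+ (not (anyᵇ (λ Θ → label K₀ Θ (observe f 𝒬 x)) (map (hypothesis 𝒬) Is))) _ ⟩
      _ ≤⟨ +-mono-≤ (uncovered-≤ 𝒬 x Is) (violated-≤ 𝒬 x y y′ R Is) ⟩
      A + ∑ Is e₁ + ∑ Is e₂
        ≡⟨ trans (+-assoc A _ _) (cong (A +_) (trans (sym (∑-+ Is e₁ e₂)) (∑-cong Is λ I → r ⟦ mislabelled I x 𝒬 ⟧ ⟦ mislabelled I y 𝒬 ⟧ ⟦ mislabelled I y′ 𝒬 ⟧ ⟦ mislabelled I (splice x y y′ R) 𝒬 ⟧ ⟦ escaping I ω ⟧))) ⟩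
      A + (∑ Is λ I → errors I ω 𝒬 + ⟦ escaping I ω ⟧) ∎
      where
      open ≤-Reasoning
      A = ⟦ not (f x) ⟧ + ⟦ not (inCubes Is x) ⟧
      e₁ e₂ : Implicant → ℕ
      e₁ I = ⟦ mislabelled I x 𝒬 ⟧
      e₂ I = flaws I ω 𝒬
      r : ∀ a b c d e → a + (a + b + c + d + e) ≡ 2 * a + b + c + d + e
      r = solve-∀

    module Rejections (s D : ℕ) (s>0 : 0 < s) (G≤t : G ≤ t) (G≤2^K₀ : G ≤ 2 ^ K₀) (G-big : 210 * (s * D) ≤ G)
                      (d : DNF n) (short : length d ≤ s) (f≡d : ∀ x → f x ≡ evalDNF d x) where
      covering : Cover (evalDNF d) (length d)
      covering = cover d λ x e → trans (f≡d x) e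

      Is = implicants covering
      Q = vecs (Ω f) M

      expected : ℕ
      expected = ∑ Q λ 𝒬 → ∑ (Ω f) λ ω → ⟦ badDraw f K₀ 𝒬 (map (hypothesis 𝒬) Is) ω ⟧

      Is-short : length Is ≤ s
      Is-short = ≤-trans (number covering) short

      noNegatives : ∑ (Ω f) (λ ω → ⟦ not (f (proj₁ ω)) ⟧) ≡ 0
      noNegatives = trans (∑-Ω-first f λ x → ⟦ not (f x) ⟧) (cong (_* (a * (a * 2 ^ n)))
        (trans (∑-ones f _) (trans (∑-cong P λ x → ⟦⟧*⟦not⟧ (f x)) (trans (∑-const P 0) (*-zeroʳ (length P))))))

      fewUncovered : G * ∑ (Ω f) (λ ω → ⟦ not (inCubes Is (proj₁ ω)) ⟧) ≤ s * W
      fewUncovered = begin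
        G * ∑ (Ω f) (λ ω → ⟦ not (inCubes Is (proj₁ ω)) ⟧) ≡⟨ cong (G *_) (∑-Ω-first f λ x → ⟦ not (inCubes Is x) ⟧) ⟩
        G * (u * (a * (a * 2 ^ n))) ≡⟨ r₁ G u (a * (a * 2 ^ n)) ⟩
        u * G * (a * (a * 2 ^ n)) ≤⟨ *-monoˡ-≤ (a * (a * 2 ^ n)) (≤-trans (*-monoʳ-≤ u G≤t) (≤-trans (≤-reflexive (cong (_* t) u≡)) (≤-trans (light covering) (*-monoˡ-≤ a short)))) ⟩
        s * a * (a * (a * 2 ^ n)) ≡⟨ *-assoc s a _ ⟩
        s * (a * (a * (a * 2 ^ n))) ≡⟨ cong (s *_) (sym (length-Ω f)) ⟩
        s * W ∎
        where
        open ≤-Reasoning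
        u = ∑ (ones f) λ x → ⟦ not (inCubes Is x) ⟧
        r₁ : ∀ g u z → g * (u * z) ≡ u * g * z
        r₁ = solve-∀
        u≡ : u ≡ ∑ P λ x → ⟦ evalDNF d x ⟧ * ⟦ not (inCubes Is x) ⟧
        u≡ = trans (∑-ones f _) (∑-cong P λ x → cong (λ b → ⟦ b ⟧ * ⟦ not (inCubes Is x) ⟧) (f≡d x))

      -- With the draw fixed, its four points do not depend on the seeds and `mislabelled-rare`
      -- applies to each; hence the sum over the seeds is the inner one.
      perDraw : ∀ ω → G * (∑ Q λ 𝒬 → ⟦ badDraw f K₀ 𝒬 (map (hypothesis 𝒬) Is) ω ⟧)
                ≤ W ^ M * (G * (⟦ not (f (proj₁ ω)) ⟧ + ⟦ not (inCubes Is (proj₁ ω)) ⟧) + ∑ Is λ I → 5 + G * ⟦ escaping I ω ⟧)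
      perDraw ω = begin
        G * (∑ Q λ 𝒬 → ⟦ badDraw f K₀ 𝒬 (map (hypothesis 𝒬) Is) ω ⟧)
          ≤⟨ *-monoʳ-≤ G (∑-mono Q λ 𝒬 → bad-≤ Is 𝒬 ω) ⟩
        G * (∑ Q λ 𝒬 → A + ∑ Is λ I → errors I ω 𝒬 + ⟦ escaping I ω ⟧)
          ≡⟨ cong (G *_) (trans (∑-+ Q _ _) (cong₂ _+_ (constQ A) (∑-swap Q Is _))) ⟩
        G * (W ^ M * A + ∑ Is λ I → ∑ Q λ 𝒬 → errors I ω 𝒬 + ⟦ escaping I ω ⟧)
          ≡⟨ cong (λ z → G * (W ^ M * A + z)) (∑-cong Is λ I → trans (∑-+ Q (errors I ω) _) (cong (∑ Q (errors I ω) +_) (constQ ⟦ escaping I ω ⟧))) ⟩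
        G * (W ^ M * A + ∑ Is λ I → ∑ Q (errors I ω) + W ^ M * ⟦ escaping I ω ⟧)
          ≡⟨ trans (*-distribˡ-+ G (W ^ M * A) _) (cong₂ _+_ (swap3 G (W ^ M) A) (sym (∑-*ˡ Is G _))) ⟩
        W ^ M * (G * A) + (∑ Is λ I → G * (∑ Q (errors I ω) + W ^ M * ⟦ escaping I ω ⟧))
          ≤⟨ +-monoʳ-≤ (W ^ M * (G * A)) (∑-mono Is each) ⟩
        W ^ M * (G * A) + (∑ Is λ I → W ^ M * (5 + G * ⟦ escaping I ω ⟧))
          ≡⟨ trans (cong (W ^ M * (G * A) +_) (∑-*ˡ Is (W ^ M) _)) (sym (*-distribˡ-+ (W ^ M) (G * A) _)) ⟩
        W ^ M * (G * A + ∑ Is λ I → 5 + G * ⟦ escaping I ω ⟧) ∎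
        where
        open ≤-Reasoning
        A = ⟦ not (f (proj₁ ω)) ⟧ + ⟦ not (inCubes Is (proj₁ ω)) ⟧
        constQ : ∀ c → (∑ Q λ _ → c) ≡ W ^ M * c
        constQ c = trans (∑-const Q c) (cong (_* c) (length-vecs (Ω f) M))
        swap3 : ∀ g w a → g * (w * a) ≡ w * (g * a)
        swap3 = solve-∀
        r : ∀ g x w e → g * (x + w * e) ≡ x * g + w * (g * e)
        r = solve-∀
        r₂ : ∀ w z → 5 * w + w * z ≡ w * (5 + z)
        r₂ = solve-∀
        each : ∀ I → G * (∑ Q (errors I ω) + W ^ M * ⟦ escaping I ω ⟧) ≤ W ^ M * (5 + G * ⟦ escaping I ω ⟧)
        each I = begin
          G * (∑ Q (errors I ω) + W ^ M * ⟦ escaping I ω ⟧) ≡⟨ r G _ (W ^ M) _ ⟩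
          ∑ Q (errors I ω) * G + W ^ M * (G * ⟦ escaping I ω ⟧) ≤⟨ +-monoˡ-≤ _ (≤-trans (*-monoʳ-≤ (∑ Q (errors I ω)) G≤2^K₀) (errors-rare I ω)) ⟩
          5 * W ^ M + W ^ M * (G * ⟦ escaping I ω ⟧) ≡⟨ r₂ (W ^ M) _ ⟩
          W ^ M * (5 + G * ⟦ escaping I ω ⟧) ∎

      -- Per term, 7 units of `1 / G` are spent: one for points lost to dropped terms, five for the
      -- mislabelled points in `errors`, one for escapes.
      expected-≤ : G * expected ≤ 7 * s * (W ^ M * W)
      expected-≤ = begin
        G * expected
          ≡⟨ cong (G *_) (∑-swap Q (Ω f) _) ⟩
        G * (∑ (Ω f) λ ω → ∑ Q λ 𝒬 → ⟦ badDraw f K₀ 𝒬 (map (hypothesis 𝒬) Is) ω ⟧)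
          ≡⟨ sym (∑-*ˡ (Ω f) G _) ⟩
        (∑ (Ω f) λ ω → G * ∑ Q λ 𝒬 → ⟦ badDraw f K₀ 𝒬 (map (hypothesis 𝒬) Is) ω ⟧)
          ≤⟨ ∑-mono (Ω f) perDraw ⟩
        (∑ (Ω f) λ ω → W ^ M * (G * (⟦ not (f (proj₁ ω)) ⟧ + ⟦ not (inCubes Is (proj₁ ω)) ⟧) + ∑ Is λ I → 5 + G * ⟦ escaping I ω ⟧))
          ≡⟨ trans (∑-*ˡ (Ω f) (W ^ M) _) (cong (W ^ M *_) (trans (∑-+ (Ω f) _ _) (cong₂ _+_
               (trans (∑-*ˡ (Ω f) G _) (cong (G *_) (trans (∑-+ (Ω f) _ _) (cong (_+ ∑ (Ω f) (λ ω → ⟦ not (inCubes Is (proj₁ ω)) ⟧)) noNegatives))))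
               (trans (∑-swap (Ω f) Is _) (∑-cong Is λ I → trans (∑-+ (Ω f) _ _) (cong₂ _+_ (∑-const (Ω f) 5) (∑-*ˡ (Ω f) G _))))))) ⟩
        W ^ M * (G * ∑ (Ω f) (λ ω → ⟦ not (inCubes Is (proj₁ ω)) ⟧) + ∑ Is λ I → W * 5 + G * escapes (cube I))
          ≤⟨ *-monoʳ-≤ (W ^ M) (+-mono-≤ fewUncovered (≤-trans (∑-mono Is each) (≤-trans (≤-reflexive (∑-const Is (6 * W))) (*-monoˡ-≤ (6 * W) Is-short)))) ⟩
        W ^ M * (s * W + s * (6 * W))
          ≡⟨ r (W ^ M) s W ⟩
        7 * s * (W ^ M * W) ∎
        where
        open ≤-Reasoning
        r : ∀ x s w → x * (s * w + s * (6 * w)) ≡ 7 * s * (x * w)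
        r = solve-∀
        r₂ : ∀ w → w * 5 + w ≡ 6 * w
        r₂ = solve-∀
        each : ∀ I → W * 5 + G * escapes (cube I) ≤ 6 * W
        each I = ≤-trans (+-monoʳ-≤ (W * 5) (≤-trans (≤-reflexive (*-comm G _)) (closed I))) (≤-reflexive (r₂ W))

      30D-expected : 30 * D * expected ≤ W ^ M * W
      30D-expected = *-cancelˡ-≤ (7 * s) ⦃ >-nonZero (*-mono-≤ (s≤s (z≤n {6})) s>0) ⦄ (begin
        7 * s * (30 * D * expected) ≡⟨ r s D expected ⟩
        210 * (s * D) * expected ≤⟨ *-monoˡ-≤ expected G-big ⟩
        G * expected ≤⟨ expected-≤ ⟩
        7 * s * (W ^ M * W) ∎)
        where
        open ≤-Reasoning
        r : ∀ s d e → 7 * s * (30 * d * e) ≡ 210 * (s * d) * e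
        r = solve-∀

      -- Markov's inequality over seeds and trials jointly: at an average bad rate of at most
      -- `1 / (30 * D)`, the `10 * D * k₁` trials contain at most `k₁ / 3` bad ones on average,
      -- while rejection needs at least `suc k₁`.
      rarely-rejects : ∀ k₁ → 3 * (∑ Q λ 𝒬 → ∑ (vecs (Ω f) (10 * D * k₁)) λ ωs → ⟦ not (verdictOn f s K₀ k₁ 𝒬 ωs) ⟧) ≤ W ^ M * W ^ (10 * D * k₁)
      rarely-rejects k₁ = *-cancelˡ-≤ (suc k₁) (pos-cancel W>0 (begin
        suc k₁ * (3 * R) * W ≡⟨ r₁ (suc k₁) R W ⟩
        3 * (R * suc k₁ * W) ≤⟨ *-monoʳ-≤ 3 (*-monoˡ-≤ W counted) ⟩
        3 * ((∑ Q λ 𝒬 → ∑ S (bads 𝒬)) * W) ≡⟨ cong (3 *_) (trans (sym (∑-*ʳ Q W _)) (trans (∑-cong Q λ 𝒬 → ∑-hits (Ω f) (badDraw f K₀ 𝒬 (map (hypothesis 𝒬) Is)) N) (∑-*ˡ Q (N * W ^ N) _))) ⟩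
        3 * (10 * D * k₁ * W ^ N * expected) ≡⟨ r₂ D k₁ (W ^ N) expected ⟩
        k₁ * W ^ N * (30 * D * expected) ≤⟨ *-mono-≤ (*-monoˡ-≤ (W ^ N) (n≤1+n k₁)) 30D-expected ⟩
        suc k₁ * W ^ N * (W ^ M * W) ≡⟨ r₃ (suc k₁) (W ^ N) (W ^ M) W ⟩
        suc k₁ * (W ^ M * W ^ N) * W ∎))
        where
        open ≤-Reasoning
        N = 10 * D * k₁
        S = vecs (Ω f) N
        R = ∑ Q λ 𝒬 → ∑ S λ ωs → ⟦ not (verdictOn f s K₀ k₁ 𝒬 ωs) ⟧
        bads : Vec (Draw n) M → Vec (Draw n) N → ℕ
        bads 𝒬 ωs = hits (badDraw f K₀ 𝒬 (map (hypothesis 𝒬) Is)) 𝟏 ωs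
        r₁ : ∀ k r w → k * (3 * r) * w ≡ 3 * (r * k * w)
        r₁ = solve-∀
        r₂ : ∀ d k x e → 3 * (10 * d * k * x * e) ≡ k * x * (30 * d * e)
        r₂ = solve-∀
        r₃ : ∀ k x y w → k * x * (y * w) ≡ k * (y * x) * w
        r₃ = solve-∀
        rejected : ∀ 𝒬 ωs → ⟦ not (verdictOn f s K₀ k₁ 𝒬 ωs) ⟧ * suc k₁ ≤ bads 𝒬 ωs
        rejected 𝒬 ωs = not-accepted (verdictOn f s K₀ k₁ 𝒬 ωs) (bads 𝒬 ωs) k₁
          (anyᵇ-∈ (λ H → hits (badDraw f K₀ 𝒬 H) 𝟏 ωs ≤ᵇ k₁) (∈-listsUpTo s (map (hypothesis 𝒬) Is) (≤-trans (≤-reflexive (length-map (hypothesis 𝒬) Is)) Is-short)))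
        counted : R * suc k₁ ≤ ∑ Q λ 𝒬 → ∑ S (bads 𝒬)
        counted = ≤-trans (≤-reflexive (trans (sym (∑-*ʳ Q (suc k₁) _)) (∑-cong Q λ 𝒬 → sym (∑-*ʳ S (suc k₁) _)))) (∑-mono Q λ 𝒬 → ∑-mono S (rejected 𝒬))

  -- Choice of parameters

  ℕtoℚ-mono : ∀ {m k} → m ≤ k → ℕtoℚ m ℚ.≤ ℕtoℚ k
  ℕtoℚ-mono {m} {k} h = ℚₚ.toℚᵘ-cancel-≤ (ℚᵘₚ.≤-respˡ-≃ (ℚᵘₚ.≃-sym (toℚᵘ-/ m 1)) (ℚᵘₚ.≤-respʳ-≃ (ℚᵘₚ.≃-sym (toℚᵘ-/ k 1))
    (ℚᵘ.*≤* (subst₂ ℤ._≤_ (sym (ℤₚ.*-identityʳ (ℤ.+ m))) (sym (ℤₚ.*-identityʳ (ℤ.+ k))) (ℤ.+≤+ h)))))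

  ℕtoℚ-cancel : ∀ {m k} → ℕtoℚ m ℚ.≤ ℕtoℚ k → m ≤ k
  ℕtoℚ-cancel {m} {k} h with ℚᵘₚ.≤-respˡ-≃ (toℚᵘ-/ m 1) (ℚᵘₚ.≤-respʳ-≃ (toℚᵘ-/ k 1) (ℚₚ.toℚᵘ-mono-≤ h))
  ... | ℚᵘ.*≤* l = ℤₚ.drop‿+≤+ (subst₂ ℤ._≤_ (ℤₚ.*-identityʳ (ℤ.+ m)) (ℤₚ.*-identityʳ (ℤ.+ k)) l)

  ℕtoℚ-nonNeg : ∀ m → ℚ.NonNegative (ℕtoℚ m)
  ℕtoℚ-nonNeg m = ℚ.nonNegative (ℕtoℚ-mono {0} {m} z≤n)

  *ℕtoℚ-mono : ∀ m {p q} → p ℚ.≤ q → p ℚ.* ℕtoℚ m ℚ.≤ q ℚ.* ℕtoℚ m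
  *ℕtoℚ-mono m = ℚₚ.*-monoʳ-≤-nonNeg (ℕtoℚ m) ⦃ ℕtoℚ-nonNeg m ⦄

  ℕtoℚ*-mono : ∀ m {p q} → p ℚ.≤ q → ℕtoℚ m ℚ.* p ℚ.≤ ℕtoℚ m ℚ.* q
  ℕtoℚ*-mono m = ℚₚ.*-monoˡ-≤-nonNeg (ℕtoℚ m) ⦃ ℕtoℚ-nonNeg m ⦄

  ℕtoℚ-pos : ∀ m → 0 < m → ℚ.Positive (ℕtoℚ m)
  ℕtoℚ-pos m m>0 = ℚ.positive (ℚₚ.<-≤-trans (ℚₚ.positive⁻¹ ℚ.1ℚ) (ℕtoℚ-mono m>0))

  fraction-≤ : ∀ {p p′ x y} Z → 0 < Z → p ℚ.* ℕtoℚ Z ≡ ℕtoℚ x → p′ ℚ.* ℕtoℚ Z ≡ ℕtoℚ y → x ≤ y → p ℚ.≤ p′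
  fraction-≤ Z Z>0 e e′ h = ℚₚ.*-cancelʳ-≤-pos (ℕtoℚ Z) ⦃ ℕtoℚ-pos Z Z>0 ⦄ (subst₂ ℚ._≤_ (sym e) (sym e′) (ℕtoℚ-mono h))

  fraction-scale : ∀ {p x Z} k → p ℚ.* ℕtoℚ Z ≡ ℕtoℚ x → p ℚ.* ℕtoℚ (k * Z) ≡ ℕtoℚ (k * x)
  fraction-scale {p} {x} {Z} k e = begin
    p ℚ.* ℕtoℚ (k * Z) ≡⟨ cong (p ℚ.*_) (trans (cong ℕtoℚ (*-comm k Z)) (ℕtoℚ-* Z k)) ⟩
    p ℚ.* (ℕtoℚ Z ℚ.* ℕtoℚ k) ≡⟨ sym (ℚₚ.*-assoc p (ℕtoℚ Z) (ℕtoℚ k)) ⟩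
    (p ℚ.* ℕtoℚ Z) ℚ.* ℕtoℚ k ≡⟨ cong (ℚ._* ℕtoℚ k) e ⟩
    ℕtoℚ x ℚ.* ℕtoℚ k ≡⟨ sym (ℕtoℚ-* x k) ⟩
    ℕtoℚ (x * k) ≡⟨ cong ℕtoℚ (*-comm x k) ⟩
    ℕtoℚ (k * x) ∎
    where open ≡-Reasoning

  twoThirds-≤ : ∀ {p g} Z → 0 < Z → p ℚ.* ℕtoℚ Z ≡ ℕtoℚ g → 2 * Z ≤ 3 * g → twoThirds ℚ.≤ p
  twoThirds-≤ {p} {g} Z Z>0 e h = fraction-≤ {twoThirds} {p} {2 * Z} {3 * g} (3 * Z) (*-mono-≤ (s≤s (z≤n {2})) Z>0) two (fraction-scale {p} {g} {Z} 3 e) h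
    where
    two : twoThirds ℚ.* ℕtoℚ (3 * Z) ≡ ℕtoℚ (2 * Z)
    two = trans (cong (twoThirds ℚ.*_) (ℕtoℚ-* 3 Z)) (trans (sym (ℚₚ.*-assoc twoThirds (ℕtoℚ 3) (ℕtoℚ Z))) (sym (ℕtoℚ-* 2 Z)))

  complement : ∀ {p g h} Z → g + h ≡ Z → p ℚ.* ℕtoℚ Z ≡ ℕtoℚ g → (ℚ.1ℚ ℚ.- p) ℚ.* ℕtoℚ Z ≡ ℕtoℚ h
  complement {p} {g} {h} Z sum e = begin
    (ℚ.1ℚ ℚ.+ (ℚ.- p)) ℚ.* z ≡⟨ ℚₚ.*-distribʳ-+ z ℚ.1ℚ (ℚ.- p) ⟩
    ℚ.1ℚ ℚ.* z ℚ.+ (ℚ.- p) ℚ.* z ≡⟨ cong₂ ℚ._+_ (ℚₚ.*-identityˡ z) (sym (ℚₚ.neg-distribˡ-* p z)) ⟩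
    z ℚ.+ (ℚ.- (p ℚ.* z)) ≡⟨ cong₂ (λ u v → u ℚ.+ (ℚ.- v)) (trans (cong ℕtoℚ (trans (sym sum) (+-comm g h))) (ℕtoℚ-+ h g)) e ⟩
    (ℕtoℚ h ℚ.+ ℕtoℚ g) ℚ.+ (ℚ.- ℕtoℚ g) ≡⟨ ℚₚ.+-assoc (ℕtoℚ h) (ℕtoℚ g) _ ⟩
    ℕtoℚ h ℚ.+ (ℕtoℚ g ℚ.+ (ℚ.- ℕtoℚ g)) ≡⟨ cong (ℕtoℚ h ℚ.+_) (ℚₚ.+-inverseʳ (ℕtoℚ g)) ⟩
    ℕtoℚ h ℚ.+ ℚ.0ℚ ≡⟨ ℚₚ.+-identityʳ (ℕtoℚ h) ⟩
    ℕtoℚ h ∎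
    where
    open ≡-Reasoning
    z = ℕtoℚ Z

  record _≤[_]^_ (x σ k : ℕ) : Set where
    constructor bound
    field unbound : x ≤ σ ^ k
  open _≤[_]^_

  -- Because `2 ≤ σ`, constants and sums are absorbed into the exponent, so every bound is a pure
  -- power of `σ`.
  module Polynomial (σ : ℕ) (2≤σ : 2 ≤ σ) where
    instance
      σ-nonZero : NonZero σ
      σ-nonZero = >-nonZero (≤-trans (s≤s z≤n) 2≤σ)

    const : ∀ k {x} → x ≤ 2 ^ k → x ≤[ σ ]^ k
    const k h = bound (≤-trans h (^-monoˡ-≤ k 2≤σ))

    mul : ∀ x y {i j} → x ≤[ σ ]^ i → y ≤[ σ ]^ j → (x * y) ≤[ σ ]^ (i + j)
    mul x y {i} {j} (bound p) (bound q) = bound (≤-trans (*-mono-≤ p q) (≤-reflexive (sym (^-distribˡ-+-* σ i j))))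

    raise : ∀ {x i} j → x ≤[ σ ]^ i → x ≤[ σ ]^ (j + i)
    raise {i = i} j (bound p) = bound (≤-trans p (^-monoʳ-≤ σ (m≤n+m i j)))

    add : ∀ x y {i} → x ≤[ σ ]^ i → y ≤[ σ ]^ i → (x + y) ≤[ σ ]^ (1 + i)
    add x y {i} (bound p) (bound q) = bound (≤-trans (+-mono-≤ p q) (≤-trans (≤-reflexive (cong (σ ^ i +_) (sym (+-identityʳ (σ ^ i))))) (*-monoˡ-≤ (σ ^ i) 2≤σ)))

    power : ∀ {x i} j → x ≤[ σ ]^ i → (x ^ j) ≤[ σ ]^ (j * i)
    power         zero    p = bound ≤-refl
    power {x}     (suc j) p = mul x (x ^ j) p (power j p)

  module Parameters (s e : ℕ) (1≤s : 1 ≤ s) (2≤e : 2 ≤ e) where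
    -- `e₁` divides the error among `s` labels and four quarters, and `D` is what `extend` demands
    -- for `r = e₁`. In `G` the factor is `210 = 7 * 30`: the 7 units per term and the rate
    -- `1 / (30 * D)`. `G` also serves as `t` and as `K₀`; then `κ` and `M` are the bounds required
    -- by `Heavy`, and `k₁` is the one from the union bound.
    e₁ K D G κ M k₁ N q : ℕ
    e₁ = 4 * s * e
    K  = 64 * e₁
    D  = e₁ * e₁ * e₁ * (K * K)
    G  = 210 * (s * D)
    κ  = 32768 * G * G ^ 7
    M  = G * G * κ * G
    k₁ = suc M * s + 2
    N  = 10 * D * k₁
    q  = M * 3 + (N * 3 + (N * (4 * suc M) + 0))

    q-polynomial : q ≤[ s * e ]^ 862
    q-polynomial = add (M * 3) _ (raise 448 (mul M 3 M′ (const 2 (m≤m+n 3 1))))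
      (add (N * 3) _ (raise 413 (mul N 3 N′ (const 2 (m≤m+n 3 1))))
      (add (N * (4 * suc M)) 0 (mul N (4 * suc M) N′ (mul 4 (suc M) (const 2 ≤-refl) suc-M′)) (raise 859 (const 0 z≤n))))
      where
      open Polynomial (s * e) (*-mono-≤ 1≤s 2≤e)
      s′ : s ≤[ s * e ]^ 1
      s′ = bound (≤-trans (≤-trans (≤-reflexive (sym (*-identityʳ s))) (*-monoʳ-≤ s (≤-trans (s≤s z≤n) 2≤e))) (≤-reflexive (sym (*-identityʳ (s * e)))))
      e₁′ : e₁ ≤[ s * e ]^ 3
      e₁′ = subst (_≤[ s * e ]^ 3) (sym (*-assoc 4 s e)) (mul 4 (s * e) (const 2 ≤-refl) (bound (≤-reflexive (sym (*-identityʳ (s * e))))))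
      K′ : K ≤[ s * e ]^ 9
      K′ = mul 64 e₁ (const 6 ≤-refl) e₁′
      D′ : D ≤[ s * e ]^ 27
      D′ = mul (e₁ * e₁ * e₁) (K * K) (mul (e₁ * e₁) e₁ (mul e₁ e₁ e₁′ e₁′) e₁′) (mul K K K′ K′)
      G′ : G ≤[ s * e ]^ 36
      G′ = mul 210 (s * D) (const 8 (m≤m+n 210 46)) (mul s D s′ D′)
      κ′ : κ ≤[ s * e ]^ 303
      κ′ = mul (32768 * G) (G ^ 7) (mul 32768 G (const 15 ≤-refl) G′) (power 7 G′)
      M′ : M ≤[ s * e ]^ 411
      M′ = mul (G * G * κ) G (mul (G * G) κ (mul G G G′ G′) κ′) G′
      suc-M′ : suc M ≤[ s * e ]^ 412
      suc-M′ = add 1 M (raise 411 (const 0 ≤-refl)) M′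
      k₁′ : k₁ ≤[ s * e ]^ 414
      k₁′ = add (suc M * s) 2 (mul (suc M) s suc-M′ s′) (raise 412 (const 1 ≤-refl))
      N′ : N ≤[ s * e ]^ 445
      N′ = mul (10 * D) k₁ (mul 10 D (const 4 (m≤m+n 10 6)) D′) k₁′

    e>0 : 0 < e
    e>0 = ≤-trans (s≤s z≤n) 2≤e

    e₁>0 : 0 < e₁
    e₁>0 = *-mono-≤ (*-mono-≤ (s≤s (z≤n {3})) 1≤s) e>0

    K>0 : 0 < K
    K>0 = *-mono-≤ (s≤s (z≤n {63})) e₁>0

    D>0 : 0 < D
    D>0 = *-mono-≤ (*-mono-≤ (*-mono-≤ e₁>0 e₁>0) e₁>0) (*-mono-≤ K>0 K>0)

    G>0 : 0 < G
    G>0 = *-mono-≤ (s≤s (z≤n {209})) (*-mono-≤ 1≤s D>0)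

    10e₁≤K : 10 * e₁ ≤ K
    10e₁≤K = *-monoˡ-≤ e₁ (m≤m+n 10 54)

    64≤K : 64 ≤ K
    64≤K = ≤-trans (≤-reflexive (sym (*-identityʳ 64))) (*-monoʳ-≤ 64 e₁>0)

    4e≤D : 4 * e ≤ D
    4e≤D = begin
      4 * e ≤⟨ *-monoˡ-≤ e (≤-trans (≤-reflexive (sym (*-identityʳ 4))) (*-monoʳ-≤ 4 1≤s)) ⟩
      e₁ ≡⟨ sym (trans (*-identityʳ _) (*-identityˡ e₁)) ⟩
      1 * e₁ * 1 ≤⟨ *-mono-≤ (*-monoˡ-≤ e₁ (*-mono-≤ e₁>0 e₁>0)) (*-mono-≤ K>0 K>0) ⟩
      D ∎
      where open ≤-Reasoning

  n≤2^n : ∀ x → x ≤ 2 ^ x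
  n≤2^n zero    = z≤n
  n≤2^n (suc x) = ≤-trans (+-mono-≤ (m^n>0 2 x) (n≤2^n x)) (≤-reflexive (cong (2 ^ x +_) (sym (+-identityʳ (2 ^ x)))))

  powℚ-nonNeg : ∀ p k → ℚ.NonNegative p → ℚ.NonNegative (powℚ p k)
  powℚ-nonNeg p zero    h = ℚ.nonNegative (ℚₚ.nonNegative⁻¹ ℚ.1ℚ)
  powℚ-nonNeg p (suc k) h = ℚₚ.nonNeg*nonNeg⇒nonNeg p ⦃ h ⦄ (powℚ p k) ⦃ powℚ-nonNeg p k h ⦄

  powℚ-ℕtoℚ : ∀ s k → powℚ (ℕtoℚ s) k ≡ ℕtoℚ (s ^ k)
  powℚ-ℕtoℚ s zero    = refl
  powℚ-ℕtoℚ s (suc k) = trans (cong (ℕtoℚ s ℚ.*_) (powℚ-ℕtoℚ s k)) (sym (ℕtoℚ-* s (s ^ k)))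

  *-monoℚ : ∀ {a b c d} → ℚ.NonNegative b → ℚ.NonNegative c → a ℚ.≤ b → c ℚ.≤ d → a ℚ.* c ℚ.≤ b ℚ.* d
  *-monoℚ {a} {b} {c} {d} b≥0 c≥0 h₁ h₂ = ℚₚ.≤-trans (ℚₚ.*-monoʳ-≤-nonNeg c ⦃ c≥0 ⦄ h₁) (ℚₚ.*-monoˡ-≤-nonNeg b ⦃ b≥0 ⦄ h₂)

  -- An integer `e` with `1/ε ≤ e ≤ 1/(ε * ε)`. The upper bound is weaker than `2/ε` but has no
  -- constant, so that taking powers in `shrink` produces none either.
  record Scale (ε : ℚ.ℚ) : Set where
    field
      e     : ℕ
      2≤e   : 2 ≤ e
      above : ℚ.1ℚ ℚ.≤ ε ℚ.* ℕtoℚ e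
      below : (ε ℚ.* ε) ℚ.* ℕtoℚ e ℚ.≤ ℚ.1ℚ

  numerator : ∀ ε → ℚ.0ℚ ℚ.< ε → ∃ λ a → ∃ λ d → (0 < a) × (0 < d) × (ε ℚ.* ℕtoℚ d ≡ ℕtoℚ a)
  numerator (ℚ.mkℚ (ℤ.+ suc a) d c)    _ = suc a , suc d , s≤s z≤n , s≤s z≤n ,
    trans (cong (ℚ._* ℕtoℚ (suc d)) (sym (ℚₚ.↥p/↧p≡p (ℚ.mkℚ (ℤ.+ suc a) d c)))) (/-*-cancel (suc a) (suc d))
  numerator (ℚ.mkℚ (ℤ.+ zero) d c)     (ℚ.*<* (ℤ.+<+ ()))
  numerator (ℚ.mkℚ (ℤ.-[1+ a ]) d c)   (ℚ.*<* ())

  module Reciprocal (ε : ℚ.ℚ) (ε≤½ : ε ℚ.≤ ℚ.½) (a d : ℕ) (a>0 : 0 < a) (d>0 : 0 < d) (ed : ε ℚ.* ℕtoℚ d ≡ ℕtoℚ a) where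
    open import Data.Rational.Solver using (module +-*-Solver)
    open +-*-Solver
    2a≤d : 2 * a ≤ d
    2a≤d = ℕtoℚ-cancel (begin
      ℕtoℚ (2 * a) ≡⟨ ℕtoℚ-* 2 a ⟩
      ℕtoℚ 2 ℚ.* ℕtoℚ a ≡⟨ cong (ℕtoℚ 2 ℚ.*_) (sym ed) ⟩
      ℕtoℚ 2 ℚ.* (ε ℚ.* ℕtoℚ d) ≤⟨ ℕtoℚ*-mono 2 (*ℕtoℚ-mono d ε≤½) ⟩
      ℕtoℚ 2 ℚ.* (ℚ.½ ℚ.* ℕtoℚ d) ≡⟨ sym (ℚₚ.*-assoc (ℕtoℚ 2) ℚ.½ (ℕtoℚ d)) ⟩
      ℚ.1ℚ ℚ.* ℕtoℚ d ≡⟨ ℚₚ.*-identityˡ (ℕtoℚ d) ⟩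
      ℕtoℚ d ∎)
      where open ℚₚ.≤-Reasoning
    ratio : ∃ λ m → (m * a ≤ d) × (d ≤ 2 * (m * a))
    ratio = quotient d a a>0 (≤-trans (m≤m+n a (a + 0)) 2a≤d)

    m = proj₁ ratio

    m>0 : 0 < m
    m>0 = n≢0⇒n>0 λ z → <⇒≱ d>0 (≤-trans (proj₂ (proj₂ ratio)) (≤-reflexive (cong (λ m → 2 * (m * a)) z)))
    εe : (ε ℚ.* ℕtoℚ (2 * m)) ℚ.* ℕtoℚ d ≡ ℕtoℚ (a * (2 * m))
    εe = trans (solve 3 (λ x y z → (x :* y) :* z := (x :* z) :* y) refl ε (ℕtoℚ (2 * m)) (ℕtoℚ d))
         (trans (cong (ℚ._* ℕtoℚ (2 * m)) ed) (sym (ℕtoℚ-* a (2 * m))))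
    high′ : d ≤ a * (2 * m)
    high′ = ≤-trans (proj₂ (proj₂ ratio)) (≤-reflexive (r a m))
      where
      r : ∀ a m → 2 * (m * a) ≡ a * (2 * m)
      r = solve-∀
    εεe : ((ε ℚ.* ε) ℚ.* ℕtoℚ (2 * m)) ℚ.* ℕtoℚ (d * d) ≡ ℕtoℚ (a * a * (2 * m))
    εεe = begin
      ((ε ℚ.* ε) ℚ.* ℕtoℚ (2 * m)) ℚ.* ℕtoℚ (d * d)
        ≡⟨ cong (((ε ℚ.* ε) ℚ.* ℕtoℚ (2 * m)) ℚ.*_) (ℕtoℚ-* d d) ⟩
      ((ε ℚ.* ε) ℚ.* ℕtoℚ (2 * m)) ℚ.* (ℕtoℚ d ℚ.* ℕtoℚ d)
        ≡⟨ solve 3 (λ x y z → ((x :* x) :* y) :* (z :* z) := ((x :* z) :* (x :* z)) :* y) refl ε (ℕtoℚ (2 * m)) (ℕtoℚ d) ⟩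
      ((ε ℚ.* ℕtoℚ d) ℚ.* (ε ℚ.* ℕtoℚ d)) ℚ.* ℕtoℚ (2 * m)
        ≡⟨ cong (λ z → (z ℚ.* z) ℚ.* ℕtoℚ (2 * m)) ed ⟩
      (ℕtoℚ a ℚ.* ℕtoℚ a) ℚ.* ℕtoℚ (2 * m)
        ≡⟨ trans (cong (ℚ._* ℕtoℚ (2 * m)) (sym (ℕtoℚ-* a a))) (sym (ℕtoℚ-* (a * a) (2 * m))) ⟩
      ℕtoℚ (a * a * (2 * m)) ∎
      where open ≡-Reasoning
    low′ : a * a * (2 * m) ≤ d * d
    low′ = ≤-trans (≤-reflexive (r a m)) (*-mono-≤ 2a≤d (proj₁ (proj₂ ratio)))
      where
      r : ∀ a m → a * a * (2 * m) ≡ 2 * a * (m * a)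
      r = solve-∀

    -- Here `m` is `1/ε = d/a` rounded down; this at most halves it, so `2 * m` is at least `1/ε`.
    -- It is also at most `2/ε`, and `ε ≤ ½` turns this into `1/(ε * ε)`.
    scale : Scale ε
    scale = record
      { e     = 2 * m
      ; 2≤e   = *-monoʳ-≤ 2 m>0
      ; above = fraction-≤ {x = d} {a * (2 * m)} d d>0 (ℚₚ.*-identityˡ (ℕtoℚ d)) εe high′
      ; below = fraction-≤ {x = a * a * (2 * m)} {d * d} (d * d) (*-mono-≤ d>0 d>0) εεe (ℚₚ.*-identityˡ (ℕtoℚ (d * d))) low′
      }

  scaleOf : ∀ ε → ℚ.0ℚ ℚ.< ε → ε ℚ.≤ ℚ.½ → Scale ε
  scaleOf ε ε>0 ε≤½ with numerator ε ε>0
  ... | a , d , a>0 , d>0 , ed = Reciprocal.scale ε ε≤½ a d a>0 d>0 ed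

  module _ {ε : ℚ.ℚ} (ε>0 : ℚ.0ℚ ℚ.< ε) (sc : Scale ε) where
    open Scale sc

    shrink : ∀ s k → ℕtoℚ ((s * e) ^ k) ℚ.* powℚ ε (k * 2) ℚ.≤ ℕtoℚ (s ^ k)
    shrink s zero    = ℚₚ.≤-reflexive (ℚₚ.*-identityˡ ℚ.1ℚ)
    shrink s (suc k) = begin
      ℕtoℚ (s * e * Q) ℚ.* (ε ℚ.* (ε ℚ.* E))
        ≡⟨ cong (ℚ._* (ε ℚ.* (ε ℚ.* E))) (trans (ℕtoℚ-* (s * e) Q) (cong (ℚ._* ℕtoℚ Q) (ℕtoℚ-* s e))) ⟩
      ((ℕtoℚ s ℚ.* ℕtoℚ e) ℚ.* ℕtoℚ Q) ℚ.* (ε ℚ.* (ε ℚ.* E))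
        ≡⟨ solve 5 (λ s e x ε E → ((s :* e) :* x) :* (ε :* (ε :* E)) := (s :* ((ε :* ε) :* e)) :* (x :* E)) refl (ℕtoℚ s) (ℕtoℚ e) (ℕtoℚ Q) ε E ⟩
      (ℕtoℚ s ℚ.* ((ε ℚ.* ε) ℚ.* ℕtoℚ e)) ℚ.* (ℕtoℚ Q ℚ.* E)
        ≤⟨ *-monoℚ (ℕtoℚ-nonNeg s) (ℚₚ.nonNeg*nonNeg⇒nonNeg (ℕtoℚ Q) ⦃ ℕtoℚ-nonNeg Q ⦄ E ⦃ powℚ-nonNeg ε (k * 2) (ℚ.nonNegative (ℚₚ.<⇒≤ ε>0)) ⦄)
             (ℚₚ.≤-trans (ℕtoℚ*-mono s below) (ℚₚ.≤-reflexive (ℚₚ.*-identityʳ (ℕtoℚ s)))) (shrink s k) ⟩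
      ℕtoℚ s ℚ.* ℕtoℚ (s ^ k)
        ≡⟨ sym (ℕtoℚ-* s (s ^ k)) ⟩
      ℕtoℚ (s ^ suc k) ∎
      where
      open import Data.Rational.Solver using (module +-*-Solver)
      open +-*-Solver
      open ℚₚ.≤-Reasoning
      Q = (s * e) ^ k
      E = powℚ ε (k * 2)

    polynomial-cost : ∀ s q k → 1 ≤ s → 1 ≤ k → q ≤[ s * e ]^ k →
                      ℕtoℚ q ℚ.* powℚ ε (k * 2) ℚ.≤ ℕtoℚ (k * 2) ℚ.* powℚ (ℕtoℚ s) (k * 2)
    polynomial-cost s q k 1≤s 1≤k (bound h) = begin
      ℕtoℚ q ℚ.* powℚ ε (k * 2) ≤⟨ ℚₚ.*-monoʳ-≤-nonNeg (powℚ ε (k * 2)) ⦃ powℚ-nonNeg ε (k * 2) (ℚ.nonNegative (ℚₚ.<⇒≤ ε>0)) ⦄ (ℕtoℚ-mono h) ⟩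
      ℕtoℚ ((s * e) ^ k) ℚ.* powℚ ε (k * 2) ≤⟨ shrink s k ⟩
      ℕtoℚ (s ^ k) ≤⟨ ℕtoℚ-mono (≤-trans (^-monoʳ-≤ s ⦃ >-nonZero 1≤s ⦄ (m≤m*n k 2)) (≤-trans (≤-reflexive (sym (*-identityˡ (s ^ (k * 2))))) (*-monoˡ-≤ (s ^ (k * 2)) (*-mono-≤ 1≤k (s≤s (z≤n {1})))))) ⟩
      ℕtoℚ (k * 2 * s ^ (k * 2)) ≡⟨ ℕtoℚ-* (k * 2) (s ^ (k * 2)) ⟩
      ℕtoℚ (k * 2) ℚ.* ℕtoℚ (s ^ (k * 2)) ≡⟨ cong (ℕtoℚ (k * 2) ℚ.*_) (sym (powℚ-ℕtoℚ s (k * 2))) ⟩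
      ℕtoℚ (k * 2) ℚ.* powℚ (ℕtoℚ s) (k * 2) ∎
      where open ℚₚ.≤-Reasoning

    not-far : ∀ z a .{{_ : NonZero a}} → z * e < a → ¬ (ε ℚ.≤ (ℤ.+ z) ℚ./ a)
    not-far z a close h = <⇒≱ close (ℕtoℚ-cancel (begin
      ℕtoℚ a ≡⟨ sym (ℚₚ.*-identityˡ (ℕtoℚ a)) ⟩
      ℚ.1ℚ ℚ.* ℕtoℚ a ≤⟨ *ℕtoℚ-mono a above ⟩
      (ε ℚ.* ℕtoℚ e) ℚ.* ℕtoℚ a ≤⟨ *ℕtoℚ-mono a (*ℕtoℚ-mono e h) ⟩
      (((ℤ.+ z) ℚ./ a) ℚ.* ℕtoℚ e) ℚ.* ℕtoℚ a ≡⟨ trans (ℚₚ.*-assoc ((ℤ.+ z) ℚ./ a) (ℕtoℚ e) (ℕtoℚ a)) (trans (cong (((ℤ.+ z) ℚ./ a) ℚ.*_) (ℚₚ.*-comm (ℕtoℚ e) (ℕtoℚ a))) (sym (ℚₚ.*-assoc ((ℤ.+ z) ℚ./ a) (ℕtoℚ a) (ℕtoℚ e)))) ⟩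
      (((ℤ.+ z) ℚ./ a) ℚ.* ℕtoℚ a) ℚ.* ℕtoℚ e ≡⟨ trans (cong (ℚ._* ℕtoℚ e) (/-*-cancel z a)) (sym (ℕtoℚ-* z e)) ⟩
      ℕtoℚ (z * e) ∎))
      where open ℚₚ.≤-Reasoning

  ∑∑-not : {X : Set} (L : List X) (M N : ℕ) (v : Vec X M → Vec X N → Bool) →
           (∑ (vecs L M) λ 𝒬 → ∑ (vecs L N) λ ωs → ⟦ v 𝒬 ωs ⟧) + (∑ (vecs L M) λ 𝒬 → ∑ (vecs L N) λ ωs → ⟦ not (v 𝒬 ωs) ⟧)
           ≡ length L ^ M * length L ^ N
  ∑∑-not L M N v = trans (sym (∑-+ (vecs L M) _ _)) (trans (∑-cong (vecs L M) inner)
    (trans (∑-const (vecs L M) (length L ^ N)) (cong (_* length L ^ N) (length-vecs L M))))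
    where
    inner : ∀ 𝒬 → ∑ (vecs L N) (λ ωs → ⟦ v 𝒬 ωs ⟧) + ∑ (vecs L N) (λ ωs → ⟦ not (v 𝒬 ωs) ⟧) ≡ length L ^ N
    inner 𝒬 = trans (sym (∑-+ (vecs L N) _ _)) (trans (∑-cong (vecs L N) λ ωs → ⟦not⟧ (v 𝒬 ωs))
              (trans (sym (length-∑ (vecs L N))) (length-vecs L N)))

  majority : ∀ x y Z → x + y ≡ Z → 3 * x ≤ Z → 2 * Z ≤ 3 * y
  majority x y Z sum h = +-cancelˡ-≤ (3 * x) _ _ (begin
    3 * x + 2 * Z ≤⟨ +-monoˡ-≤ (2 * Z) h ⟩
    3 * Z ≡⟨ cong (3 *_) (sym sum) ⟩
    3 * (x + y) ≡⟨ *-distribˡ-+ 3 x y ⟩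
    3 * x + 3 * y ∎)
    where open ≤-Reasoning

  module Tester {n : ℕ} (s e e₁ K D G κ M k₁ : ℕ) (1≤s : 1 ≤ s) (f : BoolFun n) (a>0 : 0 < count1 f) where
    N = 10 * D * k₁
    W = length (Ω f)

    W>0 : 0 < W
    W>0 = Ω-nonempty f a>0

    verdicts : Vec (Draw n) M → Vec (Draw n) N → Bool
    verdicts = verdictOn f s G k₁

    accepted rejected total : ℕ
    accepted = ∑ (vecs (Ω f) M) λ 𝒬 → ∑ (vecs (Ω f) N) λ ωs → ⟦ verdicts 𝒬 ωs ⟧
    rejected = ∑ (vecs (Ω f) M) λ 𝒬 → ∑ (vecs (Ω f) N) λ ωs → ⟦ not (verdicts 𝒬 ωs) ⟧
    total = W ^ M * W ^ N

    total>0 : 0 < total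
    total>0 = *-mono-≤ (m^n>0 W ⦃ >-nonZero W>0 ⦄ M) (m^n>0 W ⦃ >-nonZero W>0 ⦄ N)

    accepted+rejected : accepted + rejected ≡ total
    accepted+rejected = ∑∑-not (Ω f) M N verdicts

    acceptance : accProb f (tester n M N s G k₁) ℚ.* ℕtoℚ total ≡ ℕtoℚ accepted
    acceptance = trans (cong (λ z → accProb f (tester n M N s G k₁) ℚ.* ℕtoℚ (W ^ M * z)) (sym (*-identityʳ (W ^ N)))) (Value.fraction (tester-value f M N s G k₁))

    completeness : 0 < G → 32768 * G * G ^ 7 ≤ κ → G * G * κ * G ≤ M → 210 * (s * D) ≤ G →
                   IsSTermDNF s f → twoThirds ℚ.≤ accProb f (tester n M N s G k₁)
    completeness G>0 κ-big M-big G-big (d , short , f≡d) = twoThirds-≤ {g = accepted} total total>0 acceptance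
      (majority rejected accepted total (trans (+-comm rejected accepted) accepted+rejected)
        (Complete.Rejections.rarely-rejects f a>0 G κ G G M G>0 κ-big M-big s D 1≤s ≤-refl (n≤2^n G) G-big d short f≡d k₁))

    soundness : 0 < e₁ → e₁ ≡ 4 * s * e → 4 * e ≤ D → 10 * e₁ ≤ K → 64 ≤ K → e₁ * e₁ * e₁ * (K * K) ≤ D → suc M * s + 2 ≤ k₁ →
                (∀ (d : DNF n) → length d ≤ s → ¬ (symDiff f (evalDNF d) * e < count1 f)) →
                twoThirds ℚ.≤ ℚ.1ℚ ℚ.- accProb f (tester n M N s G k₁)
    soundness e₁>0 e₁≡ 4e≤D 10e₁≤K 64≤K D-big k₁-big far = twoThirds-≤ {g = rejected} total total>0 (complement {accProb f (tester n M N s G k₁)} {accepted} {rejected} total accepted+rejected acceptance)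
      (majority accepted rejected total accepted+rejected (≤-trans (*-monoˡ-≤ accepted (m≤m+n 3 1))
        (rarely-accepts f M s G D k₁ W>0 k₁-big bad-often)))
      where
      bad-often : ∀ (𝒬 : Vec (Draw n) M) H → length H ≤ s → W ≤ D * ∑ (Ω f) (λ ω → ⟦ badDraw f G 𝒬 H ω ⟧)
      bad-often 𝒬 H short with W ≤? D * ∑ (Ω f) (λ ω → ⟦ badDraw f G 𝒬 H ω ⟧)
      ... | yes p = p
      ... | no ¬p = ⊥-elim (far (proj₁ close) (proj₁ (proj₂ close)) (proj₂ (proj₂ close)))
        where
        close = Sound.closeDNF f G 𝒬 e₁ e₁ K D e₁>0 ≤-refl 10e₁≤K 64≤K D-big a>0 s e 1≤s e₁≡ 4e≤D H short
                  (≤-trans (s≤s (≤-reflexive (*-comm _ D))) (≰⇒> ¬p))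

  relativeErrorTester : ∀ (s : ℕ) → 1 ≤ s → (ε : ℚ.ℚ) → ℚ.0ℚ ℚ.< ε → ε ℚ.≤ ℚ.½ → (n : ℕ) →
    Σ ℕ λ q → Σ (Alg n) λ A →
      (ℕtoℚ q ℚ.* powℚ ε (862 * 2) ℚ.≤ ℕtoℚ (862 * 2) ℚ.* powℚ (ℕtoℚ s) (862 * 2))
      × QueriesAtMost A q
      × (∀ (f : BoolFun n) → .{{_ : NonZero (count1 f)}} → IsSTermDNF s f → twoThirds ℚ.≤ accProb f A)
      × (∀ (f : BoolFun n) → .{{_ : NonZero (count1 f)}} → FarFromSTermDNF s ε f → twoThirds ℚ.≤ ℚ.1ℚ ℚ.- accProb f A)
  relativeErrorTester s 1≤s ε ε>0 ε≤½ n =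
    q , tester n M N s G k₁ , polynomial-cost ε>0 reciprocal s q 862 1≤s (s≤s z≤n) q-polynomial , tester-queries n M N s G k₁ ,
    (λ f isDNF → Tester.completeness s e e₁ K D G κ M k₁ 1≤s f (>-nonZero⁻¹ (count1 f)) G>0 ≤-refl ≤-refl ≤-refl isDNF) ,
    (λ f far → Tester.soundness s e e₁ K D G κ M k₁ 1≤s f (>-nonZero⁻¹ (count1 f)) e₁>0 refl 4e≤D 10e₁≤K 64≤K ≤-refl ≤-refl
       λ d short close → not-far ε>0 reciprocal (symDiff f (evalDNF d)) (count1 f) close (far (evalDNF d) (d , short , λ x → refl)))
    where
    reciprocal = scaleOf ε ε>0 ε≤½
    open Scale reciprocal
    open Parameters s e 1≤s 2≤e

open import Data.Nat as ℕ using (ℕ)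
open import Data.Rational using (ℚ; 0ℚ; 1ℚ; ½; _*_; _-_; _≤_; _<_)
open import Data.Product using (Σ; _×_; _,_)

theorem1 : Σ ℕ λ c →
    ∀ (s : ℕ) → 1 ℕ.≤ s → (ε : ℚ) → 0ℚ < ε → ε ≤ ½ → (n : ℕ) →
    Σ ℕ λ q → Σ (Alg n) λ A →
    (ℕtoℚ q * powℚ ε c ≤ ℕtoℚ c * powℚ (ℕtoℚ s) c)
    × QueriesAtMost A q
    × (∀ (f : BoolFun n) → .{{_ : ℕ.NonZero (count1 f)}} →
    IsSTermDNF s f → twoThirds ≤ accProb f A)
    × (∀ (f : BoolFun n) → .{{_ : ℕ.NonZero (count1 f)}} →
    FarFromSTermDNF s ε f → twoThirds ≤ 1ℚ - accProb f A)
-- The cost is at most `(s * e) ^ 862`, and the exponent doubles because `e` is only bounded by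
-- `1/(ε * ε)`.
theorem1 = 862 ℕ.* 2 , Counting.relativeErrorTester
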